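{- Let $d\ge 2$, let $c_d$ be the unique positive solution of $g_d(x)=d+1$ where $g_d(x)=(d+1)(x+1)e^{ -x}+x(1-e^{ -x})^{d+1}$, let $c>c_d$ and $p=\frac{c}{n}$. For $Y\in Y_d(n,p)$ define $$v(Y)=f_d(Y)+a(Y)+\sum_{j=0}^{d}\alpha_j(Y)(d-j)-\binom{n}{d},$$ where $f_d(Y)$ is the number of $d$-simplices of $Y$, $a(Y)$ is the number of $(d-1)$-simplices $\tau$ of $\Delta_{n-1}$ contained in no $d$-simplex of $Y$, and $\alpha_j(Y)$ is the number of $d$-simplices of $Y$ that contain exactly $d+1-j$ of their $(d-1)$-faces which are contained in exactly one $d$-simplex of $Y$. Then $$\lim_{n\to\infty}\Pr\big[Y\in Y_d(n,p): v(Y)\le 0\big]=0.$$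
   Context: $\Delta_{n-1}$ denotes the $(n-1)$-dimensional simplex on vertex set $[n]$, and $\Delta_{n-1}^{(i)}$ its $i$-skeleton. $Y_d(n,p)$ is the probability space of complexes $\Delta_{n-1}^{(d-1)}\subset Y\subset\Delta_{n-1}^{(d)}$ in which each $d$-simplex is included independently with probability $p$. -}

module Defs where

open import Data.Nat as ℕ using (ℕ; zero; suc; NonZero)
import Data.Nat.Properties as ℕ
open import Data.Integer as ℤ using (ℤ; +_; 1ℤ)
import Data.Integer.Properties as ℤ
open import Data.Rational as ℚ using (ℚ; 0ℚ; 1ℚ)
import Data.Rational.Properties as ℚ
import Data.Rational.Unnormalised as ℚᵘ
import Data.Rational.Unnormalised.Properties as ℚᵘ
open import Data.Rational.Solver using (module +-*-Solver)
open import Data.List using (List; []; _∷_; _++_; map; filter; foldr; length; upTo)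
open import Data.Product using (∃-syntax; _×_; _,_)
open import Data.Sum using (inj₁; inj₂)
open import Relation.Binary.PropositionalEquality

-- Reals are Cauchy sequences of rationals; their equality is the setoid
-- relation _≈_, not _≡_.

IsCauchy : (ℕ → ℚ) → Set
IsCauchy x = ∀ ε → 0ℚ ℚ.< ε →
  ∃[ N ] ∀ m n → N ℕ.≤ m → N ℕ.≤ n → ℚ.∣ x m ℚ.- x n ∣ ℚ.< ε

record ℝ : Set where
  constructor mkℝ
  field
    seq    : ℕ → ℚ
    cauchy : IsCauchy seq

open ℝ public

infix 4 _≈_ _<_

_≈_ : ℝ → ℝ → Set
x ≈ y = ∀ ε → 0ℚ ℚ.< ε →
  ∃[ N ] ∀ n → N ℕ.≤ n → ℚ.∣ seq x n ℚ.- seq y n ∣ ℚ.< ε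

_<_ : ℝ → ℝ → Set
x < y = ∃[ ε ] 0ℚ ℚ.< ε × ∃[ N ] ∀ n → N ℕ.≤ n → seq x n ℚ.+ ε ℚ.< seq y n

private

  open +-*-Solver using (solve; _:+_; _:*_; _:-_; :-_; con; _:=_)

  0<1 : 0ℚ ℚ.< 1ℚ
  0<1 = ℚ.positive⁻¹ 1ℚ

  ∣x-x∣≡0 : ∀ q → ℚ.∣ q ℚ.- q ∣ ≡ 0ℚ
  ∣x-x∣≡0 q = cong ℚ.∣_∣ (ℚ.+-inverseʳ q)

  *-mono-≤ : ∀ {a b c d} → 0ℚ ℚ.≤ b → 0ℚ ℚ.≤ c → a ℚ.≤ b → c ℚ.≤ d →
             a ℚ.* c ℚ.≤ b ℚ.* d
  *-mono-≤ {a} {b} {c} {d} 0≤b 0≤c a≤b c≤d = ℚ.≤-trans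
    (ℚ.*-monoʳ-≤-nonNeg c {{ℚ.nonNegative 0≤c}} a≤b)
    (ℚ.*-monoˡ-≤-nonNeg b {{ℚ.nonNegative 0≤b}} c≤d)

  *-pos : ∀ {a b} → 0ℚ ℚ.< a → 0ℚ ℚ.< b → 0ℚ ℚ.< a ℚ.* b
  *-pos {a} {b} 0<a 0<b = subst (ℚ._< a ℚ.* b) (ℚ.*-zeroʳ a)
    (ℚ.*-monoʳ-<-pos a {{ℚ.positive 0<a}} 0<b)

  *-nonNeg : ∀ {a b} → 0ℚ ℚ.≤ a → 0ℚ ℚ.≤ b → 0ℚ ℚ.≤ a ℚ.* b
  *-nonNeg {a} {b} 0≤a 0≤b = subst (ℚ._≤ a ℚ.* b) (ℚ.*-zeroʳ a)
    (ℚ.*-monoˡ-≤-nonNeg a {{ℚ.nonNegative 0≤a}} 0≤b)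

  opaque
    divide : ∀ K ε → 0ℚ ℚ.< K → 0ℚ ℚ.< ε → ∃[ δ ] 0ℚ ℚ.< δ × K ℚ.* δ ≡ ε
    divide K ε 0<K 0<ε = δ , *-pos 0<ε 0<1/K , eq
      where
      instance
        K⁺ : ℚ.Positive K
        K⁺ = ℚ.positive 0<K
        K≠0 : ℚ.NonZero K
        K≠0 = ℚ.pos⇒nonZero K
      0<1/K : 0ℚ ℚ.< ℚ.1/ K
      0<1/K = ℚ.positive⁻¹ (ℚ.1/ K) {{ℚ.1/pos⇒pos K}}
      δ : ℚ
      δ = ε ℚ.* ℚ.1/ K
      eq : K ℚ.* δ ≡ ε
      eq = trans (solve 3 (λ k e i → k :* (e :* i) := e :* (k :* i)) refl K ε (ℚ.1/ K))
          (trans (cong (ε ℚ.*_) (ℚ.*-inverseʳ K)) (ℚ.*-identityʳ ε))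

  IsCauchyUpTo : ℚ → (ℕ → ℚ) → Set
  IsCauchyUpTo K x = ∀ ε → 0ℚ ℚ.< ε →
    ∃[ N ] ∀ m n → N ℕ.≤ m → N ℕ.≤ n → ℚ.∣ x m ℚ.- x n ∣ ℚ.< K ℚ.* ε

  rescale : ∀ {K x} → 0ℚ ℚ.< K → IsCauchyUpTo K x → IsCauchy x
  rescale {K} {x} 0<K h ε 0<ε with divide K ε 0<K 0<ε
  ... | δ , 0<δ , Kδ≡ε with h δ 0<δ
  ... | N , hN = N , λ m n N≤m N≤n →
    subst (ℚ.∣ x m ℚ.- x n ∣ ℚ.<_) Kδ≡ε (hN m n N≤m N≤n)

  ⊔-≤ˡ : ∀ {a} b {n} → a ℕ.⊔ b ℕ.≤ n → a ℕ.≤ n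
  ⊔-≤ˡ {a} b = ℕ.≤-trans (ℕ.m≤m⊔n a b)

  ⊔-≤ʳ : ∀ a {b n} → a ℕ.⊔ b ℕ.≤ n → b ℕ.≤ n
  ⊔-≤ʳ a {b} = ℕ.≤-trans (ℕ.m≤n⊔m a b)

  opaque
    eventuallyBounded : ∀ {x} → IsCauchy x →
      ∃[ B ] 0ℚ ℚ.< B × ∃[ N ] ∀ n → N ℕ.≤ n → ℚ.∣ x n ∣ ℚ.≤ B
    eventuallyBounded {x} hx with hx 1ℚ 0<1
    ... | N , hN = ℚ.∣ x N ∣ ℚ.+ 1ℚ
                 , ℚ.+-mono-≤-< (ℚ.0≤∣p∣ (x N)) 0<1
                 , N , bound
      where
      bound : ∀ n → N ℕ.≤ n → ℚ.∣ x n ∣ ℚ.≤ ℚ.∣ x N ∣ ℚ.+ 1ℚ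
      bound n N≤n = begin
        ℚ.∣ x n ∣                         ≡⟨ cong ℚ.∣_∣ (solve 2 (λ a b → a := b :+ (a :- b)) refl (x n) (x N)) ⟩
        ℚ.∣ x N ℚ.+ (x n ℚ.- x N) ∣       ≤⟨ ℚ.∣p+q∣≤∣p∣+∣q∣ (x N) (x n ℚ.- x N) ⟩
        ℚ.∣ x N ∣ ℚ.+ ℚ.∣ x n ℚ.- x N ∣   ≤⟨ ℚ.+-monoʳ-≤ ℚ.∣ x N ∣ (ℚ.<⇒≤ (hN n N N≤n ℕ.≤-refl)) ⟩
        ℚ.∣ x N ∣ ℚ.+ 1ℚ                  ∎
        where open ℚ.≤-Reasoning

  opaque
    cauchy-const : ∀ q → IsCauchy (λ _ → q)
    cauchy-const q ε 0<ε = 0 , λ _ _ _ _ → subst (ℚ._< ε) (sym (∣x-x∣≡0 q)) 0<ε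

  opaque
    cauchy-+ : ∀ {x y} → IsCauchy x → IsCauchy y → IsCauchy (λ n → x n ℚ.+ y n)
    cauchy-+ {x} {y} hx hy = rescale {K = 1ℚ ℚ.+ 1ℚ} {x = λ n → x n ℚ.+ y n} (ℚ.positive⁻¹ _) go
      where
      go : IsCauchyUpTo (1ℚ ℚ.+ 1ℚ) (λ n → x n ℚ.+ y n)
      go ε 0<ε with hx ε 0<ε | hy ε 0<ε
      ... | N , hN | M , hM = N ℕ.⊔ M , λ m n ≤m ≤n → begin-strict
        ℚ.∣ (x m ℚ.+ y m) ℚ.- (x n ℚ.+ y n) ∣
          ≡⟨ cong ℚ.∣_∣ (solve 4 (λ a b c d → (a :+ b) :- (c :+ d) := (a :- c) :+ (b :- d)) refl (x m) (y m) (x n) (y n)) ⟩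
        ℚ.∣ (x m ℚ.- x n) ℚ.+ (y m ℚ.- y n) ∣
          ≤⟨ ℚ.∣p+q∣≤∣p∣+∣q∣ (x m ℚ.- x n) (y m ℚ.- y n) ⟩
        ℚ.∣ x m ℚ.- x n ∣ ℚ.+ ℚ.∣ y m ℚ.- y n ∣
          <⟨ ℚ.+-mono-< (hN m n (⊔-≤ˡ M ≤m) (⊔-≤ˡ M ≤n)) (hM m n (⊔-≤ʳ N ≤m) (⊔-≤ʳ N ≤n)) ⟩
        ε ℚ.+ ε
          ≡⟨ solve 1 (λ e → e :+ e := (con 1ℚ :+ con 1ℚ) :* e) refl ε ⟩
        (1ℚ ℚ.+ 1ℚ) ℚ.* ε ∎
        where open ℚ.≤-Reasoning

  opaque
    cauchy-neg : ∀ {x} → IsCauchy x → IsCauchy (λ n → ℚ.- x n)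
    cauchy-neg {x} hx ε 0<ε with hx ε 0<ε
    ... | N , hN = N , λ m n ≤m ≤n → subst (ℚ._< ε) (sym (eq m n)) (hN m n ≤m ≤n)
      where
      eq : ∀ m n → ℚ.∣ (ℚ.- x m) ℚ.- (ℚ.- x n) ∣ ≡ ℚ.∣ x m ℚ.- x n ∣
      eq m n = trans
        (cong ℚ.∣_∣ (solve 2 (λ a b → (:- a) :- (:- b) := :- (a :- b)) refl (x m) (x n)))
        (ℚ.∣-p∣≡∣p∣ (x m ℚ.- x n))

  opaque
    cauchy-* : ∀ {x y} → IsCauchy x → IsCauchy y → IsCauchy (λ n → x n ℚ.* y n)
    cauchy-* {x} {y} hx hy with eventuallyBounded {x} hx | eventuallyBounded {y} hy
    ... | A , 0<A , N₁ , bx | B , 0<B , N₂ , by =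
      rescale {K = A ℚ.+ B ℚ.+ 1ℚ} {x = λ n → x n ℚ.* y n} (ℚ.+-mono-< (ℚ.+-mono-< 0<A 0<B) 0<1) go
      where
      go : IsCauchyUpTo (A ℚ.+ B ℚ.+ 1ℚ) (λ n → x n ℚ.* y n)
      go ε 0<ε with hx ε 0<ε | hy ε 0<ε
      ... | N , hN | M , hM = (N ℕ.⊔ M) ℕ.⊔ (N₁ ℕ.⊔ N₂) , λ m n ≤m ≤n → begin-strict
        ℚ.∣ x m ℚ.* y m ℚ.- x n ℚ.* y n ∣
          ≡⟨ cong ℚ.∣_∣ (solve 4 (λ a b c d → a :* b :- c :* d := a :* (b :- d) :+ (a :- c) :* d) refl (x m) (y m) (x n) (y n)) ⟩
        ℚ.∣ x m ℚ.* (y m ℚ.- y n) ℚ.+ (x m ℚ.- x n) ℚ.* y n ∣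
          ≤⟨ ℚ.∣p+q∣≤∣p∣+∣q∣ (x m ℚ.* (y m ℚ.- y n)) ((x m ℚ.- x n) ℚ.* y n) ⟩
        ℚ.∣ x m ℚ.* (y m ℚ.- y n) ∣ ℚ.+ ℚ.∣ (x m ℚ.- x n) ℚ.* y n ∣
          ≡⟨ cong₂ ℚ._+_ (ℚ.∣p*q∣≡∣p∣*∣q∣ (x m) (y m ℚ.- y n)) (ℚ.∣p*q∣≡∣p∣*∣q∣ (x m ℚ.- x n) (y n)) ⟩
        ℚ.∣ x m ∣ ℚ.* ℚ.∣ y m ℚ.- y n ∣ ℚ.+ ℚ.∣ x m ℚ.- x n ∣ ℚ.* ℚ.∣ y n ∣
          ≤⟨ ℚ.+-mono-≤
               (*-mono-≤ (ℚ.<⇒≤ 0<A) (ℚ.0≤∣p∣ (y m ℚ.- y n)) (bx m (⊔-≤ˡ N₂ (⊔-≤ʳ (N ℕ.⊔ M) ≤m)))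
                 (ℚ.<⇒≤ (hM m n (⊔-≤ʳ N (⊔-≤ˡ (N₁ ℕ.⊔ N₂) ≤m)) (⊔-≤ʳ N (⊔-≤ˡ (N₁ ℕ.⊔ N₂) ≤n)))))
               (*-mono-≤ (ℚ.<⇒≤ 0<ε) (ℚ.0≤∣p∣ (y n))
                 (ℚ.<⇒≤ (hN m n (⊔-≤ˡ M (⊔-≤ˡ (N₁ ℕ.⊔ N₂) ≤m)) (⊔-≤ˡ M (⊔-≤ˡ (N₁ ℕ.⊔ N₂) ≤n))))
                 (by n (⊔-≤ʳ N₁ (⊔-≤ʳ (N ℕ.⊔ M) ≤n)))) ⟩
        A ℚ.* ε ℚ.+ ε ℚ.* B
          ≡⟨ ℚ.+-identityʳ (A ℚ.* ε ℚ.+ ε ℚ.* B) ⟨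
        A ℚ.* ε ℚ.+ ε ℚ.* B ℚ.+ 0ℚ
          <⟨ ℚ.+-monoʳ-< (A ℚ.* ε ℚ.+ ε ℚ.* B) 0<ε ⟩
        A ℚ.* ε ℚ.+ ε ℚ.* B ℚ.+ ε
          ≡⟨ solve 3 (λ a b e → a :* e :+ e :* b :+ e := (a :+ b :+ con 1ℚ) :* e) refl A B ε ⟩
        (A ℚ.+ B ℚ.+ 1ℚ) ℚ.* ε ∎
        where open ℚ.≤-Reasoning

  ∣-∣-contract : ∀ p q → ℚ.∣ ℚ.∣ p ∣ ℚ.- ℚ.∣ q ∣ ∣ ℚ.≤ ℚ.∣ p ℚ.- q ∣
  ∣-∣-contract p q with ℚ.∣p∣≡p∨∣p∣≡-p (ℚ.∣ p ∣ ℚ.- ℚ.∣ q ∣)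
  ... | inj₁ eq = subst (ℚ._≤ ℚ.∣ p ℚ.- q ∣) (sym eq) (half p q)
    where
    half : ∀ p q → ℚ.∣ p ∣ ℚ.- ℚ.∣ q ∣ ℚ.≤ ℚ.∣ p ℚ.- q ∣
    half p q = begin
      ℚ.∣ p ∣ ℚ.- ℚ.∣ q ∣
        ≡⟨ cong (λ r → ℚ.∣ r ∣ ℚ.- ℚ.∣ q ∣) (solve 2 (λ a b → a := (a :- b) :+ b) refl p q) ⟩
      ℚ.∣ (p ℚ.- q) ℚ.+ q ∣ ℚ.- ℚ.∣ q ∣
        ≤⟨ ℚ.+-monoˡ-≤ (ℚ.- ℚ.∣ q ∣) (ℚ.∣p+q∣≤∣p∣+∣q∣ (p ℚ.- q) q) ⟩
      ℚ.∣ p ℚ.- q ∣ ℚ.+ ℚ.∣ q ∣ ℚ.- ℚ.∣ q ∣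
        ≡⟨ solve 2 (λ a b → a :+ b :- b := a) refl ℚ.∣ p ℚ.- q ∣ ℚ.∣ q ∣ ⟩
      ℚ.∣ p ℚ.- q ∣ ∎
      where open ℚ.≤-Reasoning
  ... | inj₂ eq = subst (ℚ._≤ ℚ.∣ p ℚ.- q ∣) (sym eq) (begin
      ℚ.- (ℚ.∣ p ∣ ℚ.- ℚ.∣ q ∣)
        ≡⟨ cong (λ r → ℚ.- (ℚ.∣ p ∣ ℚ.- ℚ.∣ r ∣)) (solve 2 (λ a b → b := :- (a :- b) :+ a) refl p q) ⟩
      ℚ.- (ℚ.∣ p ∣ ℚ.- ℚ.∣ ℚ.- (p ℚ.- q) ℚ.+ p ∣)
        ≡⟨ solve 2 (λ a b → :- (a :- b) := b :- a) refl ℚ.∣ p ∣ ℚ.∣ ℚ.- (p ℚ.- q) ℚ.+ p ∣ ⟩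
      ℚ.∣ ℚ.- (p ℚ.- q) ℚ.+ p ∣ ℚ.- ℚ.∣ p ∣
        ≤⟨ ℚ.+-monoˡ-≤ (ℚ.- ℚ.∣ p ∣) (ℚ.∣p+q∣≤∣p∣+∣q∣ (ℚ.- (p ℚ.- q)) p) ⟩
      ℚ.∣ ℚ.- (p ℚ.- q) ∣ ℚ.+ ℚ.∣ p ∣ ℚ.- ℚ.∣ p ∣
        ≡⟨ solve 2 (λ a b → a :+ b :- b := a) refl ℚ.∣ ℚ.- (p ℚ.- q) ∣ ℚ.∣ p ∣ ⟩
      ℚ.∣ ℚ.- (p ℚ.- q) ∣
        ≡⟨ ℚ.∣-p∣≡∣p∣ (p ℚ.- q) ⟩
      ℚ.∣ p ℚ.- q ∣ ∎)
      where open ℚ.≤-Reasoning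

  opaque
    cauchy-∣-∣ : ∀ {x} → IsCauchy x → IsCauchy (λ n → ℚ.∣ x n ∣)
    cauchy-∣-∣ {x} hx ε 0<ε with hx ε 0<ε
    ... | N , hN = N , λ m n ≤m ≤n → ℚ.≤-<-trans (∣-∣-contract (x m) (x n)) (hN m n ≤m ≤n)

infix  8 -_
infixl 7 _*_ _/_
infixl 6 _+_ _-_
infixr 8 _^_

fromℚ : ℚ → ℝ
fromℚ q = mkℝ (λ _ → q) (cauchy-const q)

fromℕ : ℕ → ℝ
fromℕ k = fromℚ (+ k ℚ./ 1)

0ℝ 1ℝ : ℝ
0ℝ = fromℚ 0ℚ
1ℝ = fromℚ 1ℚ

_+_ : ℝ → ℝ → ℝ
x + y = mkℝ (λ n → seq x n ℚ.+ seq y n) (cauchy-+ {seq x} {seq y} (cauchy x) (cauchy y))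

-_ : ℝ → ℝ
-_ x = mkℝ (λ n → ℚ.- seq x n) (cauchy-neg {seq x} (cauchy x))

_-_ : ℝ → ℝ → ℝ
x - y = x + (- y)

_*_ : ℝ → ℝ → ℝ
x * y = mkℝ (λ n → seq x n ℚ.* seq y n) (cauchy-* {seq x} {seq y} (cauchy x) (cauchy y))

abs : ℝ → ℝ
abs x = mkℝ (λ n → ℚ.∣ seq x n ∣) (cauchy-∣-∣ {seq x} (cauchy x))

_/_ : ℝ → (n : ℕ) → .{{NonZero n}} → ℝ
x / n = x * fromℚ (1ℤ ℚ./ n)

_^_ : ℝ → ℕ → ℝ
x ^ zero  = 1ℝ
x ^ suc k = x * x ^ k

∑ ∏ : List ℝ → ℝ
∑ = foldr _+_ 0ℝ
∏ = foldr _*_ 1ℝ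

-- Limits of sequences indexed by the positive integers.
infix 3 _⟶_

_⟶_ : (∀ n → .{{NonZero n}} → ℝ) → ℝ → Set
u ⟶ l = ∀ ε → 0ℝ < ε →
  ∃[ N ] ∀ n .{{_ : NonZero n}} → N ℕ.≤ n → abs (u n - l) < ε

-- q ^ k / k !
expTerm : ℚ → ℕ → ℚ
expTerm q zero    = 1ℚ
expTerm q (suc k) = expTerm q k ℚ.* (q ℚ.* (1ℤ ℚ./ suc k))

expSum : ℚ → ℕ → ℚ
expSum q zero    = 0ℚ
expSum q (suc n) = expSum q n ℚ.+ expTerm q n

private

  ι : ℕ → ℚ
  ι k = + k ℚ./ 1

  2ℚ : ℚ
  2ℚ = 1ℚ ℚ.+ 1ℚ

  inv : ℕ → ℚ
  inv k = 1ℤ ℚ./ suc k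

  opaque
    ι-suc : ∀ k → ι (suc k) ≡ ι k ℚ.+ 1ℚ
    ι-suc k = ℚ.toℚᵘ-injective (begin
      ℚ.toℚᵘ (ι (suc k))                 ≈⟨ ℚ.toℚᵘ-fromℚᵘ (ℚᵘ.mkℚᵘ (+ suc k) 0) ⟩
      ℚᵘ.mkℚᵘ (+ suc k) 0                ≈⟨ ℚᵘ.*≡* (aux k) ⟩
      ℚᵘ.mkℚᵘ (+ k) 0 ℚᵘ.+ ℚᵘ.1ℚᵘ        ≈⟨ ℚᵘ.+-congˡ ℚᵘ.1ℚᵘ (ℚ.toℚᵘ-fromℚᵘ (ℚᵘ.mkℚᵘ (+ k) 0)) ⟨
      ℚ.toℚᵘ (ι k) ℚᵘ.+ ℚ.toℚᵘ 1ℚ        ≈⟨ ℚ.toℚᵘ-homo-+ (ι k) 1ℚ ⟨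
      ℚ.toℚᵘ (ι k ℚ.+ 1ℚ)                ∎)
      where
      open ℚᵘ.≃-Reasoning
      aux : ∀ k → + suc k ℤ.* + 1 ≡ (+ k ℤ.* + 1 ℤ.+ + 1) ℤ.* + 1
      aux k = cong (ℤ._* + 1) (trans (cong +_ (ℕ.+-comm 1 k))
        (cong (ℤ._+ + 1) (sym (ℤ.*-identityʳ (+ k)))))

  opaque
    ι-inv : ∀ k → ι (suc k) ℚ.* inv k ≡ 1ℚ
    ι-inv k = ℚ.toℚᵘ-injective (begin
      ℚ.toℚᵘ (ι (suc k) ℚ.* inv k)
        ≈⟨ ℚ.toℚᵘ-homo-* (ι (suc k)) (inv k) ⟩
      ℚ.toℚᵘ (ι (suc k)) ℚᵘ.* ℚ.toℚᵘ (inv k)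
        ≈⟨ ℚᵘ.*-cong (ℚ.toℚᵘ-fromℚᵘ (ℚᵘ.mkℚᵘ (+ suc k) 0)) (ℚ.toℚᵘ-fromℚᵘ (ℚᵘ.mkℚᵘ 1ℤ k)) ⟩
      ℚᵘ.mkℚᵘ (+ suc k) 0 ℚᵘ.* ℚᵘ.mkℚᵘ 1ℤ k
        ≈⟨ ℚᵘ.*≡* (aux k) ⟩
      ℚ.toℚᵘ 1ℚ ∎)
      where
      open ℚᵘ.≃-Reasoning
      aux : ∀ k → (+ suc k ℤ.* 1ℤ) ℤ.* + 1 ≡ + 1 ℤ.* + (1 ℕ.* suc k)
      aux k = trans (ℤ.*-identityʳ (+ suc k ℤ.* 1ℤ)) (trans (ℤ.*-identityʳ (+ suc k))
        (trans (cong +_ (sym (ℕ.*-identityˡ (suc k)))) (sym (ℤ.*-identityˡ (+ (1 ℕ.* suc k))))))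

  0≤ι : ∀ k → 0ℚ ℚ.≤ ι k
  0≤ι zero    = ℚ.≤-refl
  0≤ι (suc k) = subst (0ℚ ℚ.≤_) (sym (ι-suc k)) (ℚ.+-mono-≤ (0≤ι k) (ℚ.<⇒≤ 0<1))

  0≤inv : ∀ k → 0ℚ ℚ.≤ inv k
  0≤inv k = ℚ.nonNegative⁻¹ (inv k) {{ℚ.normalize-nonNeg 1 (suc k)}}

  opaque
    archimedean : ∀ q → ∃[ k ] q ℚ.≤ ι k
    archimedean q@(ℚ.mkℚ n d _) = ℤ.∣ n ∣ , ℚ.toℚᵘ-cancel-≤
      (ℚᵘ.≤-respʳ-≃ (ℚᵘ.≃-sym (ℚ.toℚᵘ-fromℚᵘ (ℚᵘ.mkℚᵘ (+ ℤ.∣ n ∣) 0))) (ℚᵘ.*≤* bound))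
      where
      bound : n ℤ.* + 1 ℤ.≤ + ℤ.∣ n ∣ ℤ.* + suc d
      bound = ℤ.≤-trans (ℤ.≤-reflexive (ℤ.*-identityʳ n))
        (ℤ.≤-trans (i≤∣i∣ n) (subst (+ ℤ.∣ n ∣ ℤ.≤_) (ℤ.pos-* ℤ.∣ n ∣ (suc d))
          (ℤ.+≤+ (ℕ.m≤m*n ℤ.∣ n ∣ (suc d)))))
        where
        i≤∣i∣ : ∀ i → i ℤ.≤ + ℤ.∣ i ∣
        i≤∣i∣ (+ n)      = ℤ.≤-refl
        i≤∣i∣ ℤ.-[1+ n ] = ℤ.-≤+

  ι-mono : ∀ K j → ι K ℚ.≤ ι (j ℕ.+ K)
  ι-mono K zero    = ℚ.≤-refl
  ι-mono K (suc j) = begin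
    ι K                     ≤⟨ ι-mono K j ⟩
    ι (j ℕ.+ K)             ≡⟨ ℚ.+-identityʳ (ι (j ℕ.+ K)) ⟨
    ι (j ℕ.+ K) ℚ.+ 0ℚ      ≤⟨ ℚ.+-monoʳ-≤ (ι (j ℕ.+ K)) (ℚ.<⇒≤ 0<1) ⟩
    ι (j ℕ.+ K) ℚ.+ 1ℚ      ≡⟨ ι-suc (j ℕ.+ K) ⟨
    ι (suc j ℕ.+ K)         ∎
    where open ℚ.≤-Reasoning

  module ExpBounds (B : ℚ) (0≤B : 0ℚ ℚ.≤ B) where

    u S : ℕ → ℚ
    u = expTerm B
    S = expSum B

    0≤u : ∀ k → 0ℚ ℚ.≤ u k
    0≤u zero    = ℚ.<⇒≤ 0<1
    0≤u (suc k) = *-nonNeg (0≤u k) (*-nonNeg 0≤B (0≤inv k))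

    ∣term∣≤ : ∀ {x} → ℚ.∣ x ∣ ℚ.≤ B → ∀ k → ℚ.∣ expTerm x k ∣ ℚ.≤ u k
    ∣term∣≤ ∣x∣≤B zero = ℚ.≤-refl
    ∣term∣≤ {x} ∣x∣≤B (suc k) = begin
      ℚ.∣ expTerm x k ℚ.* (x ℚ.* inv k) ∣
        ≡⟨ ℚ.∣p*q∣≡∣p∣*∣q∣ (expTerm x k) (x ℚ.* inv k) ⟩
      ℚ.∣ expTerm x k ∣ ℚ.* ℚ.∣ x ℚ.* inv k ∣
        ≡⟨ cong (ℚ.∣ expTerm x k ∣ ℚ.*_) (ℚ.∣p*q∣≡∣p∣*∣q∣ x (inv k)) ⟩
      ℚ.∣ expTerm x k ∣ ℚ.* (ℚ.∣ x ∣ ℚ.* ℚ.∣ inv k ∣)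
        ≡⟨ cong (λ r → ℚ.∣ expTerm x k ∣ ℚ.* (ℚ.∣ x ∣ ℚ.* r)) (ℚ.0≤p⇒∣p∣≡p (0≤inv k)) ⟩
      ℚ.∣ expTerm x k ∣ ℚ.* (ℚ.∣ x ∣ ℚ.* inv k)
        ≤⟨ *-mono-≤ (0≤u k) (*-nonNeg (ℚ.0≤∣p∣ x) (0≤inv k)) (∣term∣≤ ∣x∣≤B k)
             (ℚ.*-monoʳ-≤-nonNeg (inv k) {{ℚ.nonNegative (0≤inv k)}} ∣x∣≤B) ⟩
      u k ℚ.* (B ℚ.* inv k) ∎
      where open ℚ.≤-Reasoning

    D : ℕ → ℚ
    D zero    = 0ℚ
    D (suc k) = u k

    D-step : ∀ k → (D k ℚ.* B ℚ.+ u k) ℚ.* inv k ≡ u k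
    D-step k = trans (cong (λ r → (r ℚ.+ u k) ℚ.* inv k) (DB k))
      (trans (solve 3 (λ a b c → (a :* b :+ b) :* c := b :* ((a :+ con 1ℚ) :* c)) refl (ι k) (u k) (inv k))
      (trans (cong (λ r → u k ℚ.* (r ℚ.* inv k)) (sym (ι-suc k)))
      (trans (cong (u k ℚ.*_) (ι-inv k)) (ℚ.*-identityʳ (u k)))))
      where
      DB : ∀ k → D k ℚ.* B ≡ ι k ℚ.* u k
      DB zero    = trans (ℚ.*-zeroˡ B) (sym (ℚ.*-zeroˡ 1ℚ))
      DB (suc k) = sym (trans
        (solve 4 (λ i a b c → i :* (a :* (b :* c)) := a :* b :* (i :* c)) refl (ι (suc k)) (u k) B (inv k))
        (trans (cong (u k ℚ.* B ℚ.*_) (ι-inv k)) (ℚ.*-identityʳ (u k ℚ.* B))))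

    module Lipschitz {x y} (∣x∣≤B : ℚ.∣ x ∣ ℚ.≤ B) (∣y∣≤B : ℚ.∣ y ∣ ℚ.≤ B) where

      δ : ℚ
      δ = ℚ.∣ x ℚ.- y ∣

      0≤D : ∀ k → 0ℚ ℚ.≤ D k
      0≤D zero    = ℚ.≤-refl
      0≤D (suc k) = 0≤u k

      term-lip : ∀ k → ℚ.∣ expTerm x k ℚ.- expTerm y k ∣ ℚ.≤ δ ℚ.* D k
      term-lip zero    = ℚ.≤-reflexive (sym (ℚ.*-zeroʳ δ))
      term-lip (suc k) = begin
        ℚ.∣ tx ℚ.* (x ℚ.* i) ℚ.- ty ℚ.* (y ℚ.* i) ∣
          ≡⟨ cong ℚ.∣_∣ (solve 5 (λ a b c d e → a :* (c :* e) :- b :* (d :* e) := ((a :- b) :* c :+ b :* (c :- d)) :* e) refl tx ty x y i) ⟩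
        ℚ.∣ ((tx ℚ.- ty) ℚ.* x ℚ.+ ty ℚ.* (x ℚ.- y)) ℚ.* i ∣
          ≡⟨ ℚ.∣p*q∣≡∣p∣*∣q∣ ((tx ℚ.- ty) ℚ.* x ℚ.+ ty ℚ.* (x ℚ.- y)) i ⟩
        ℚ.∣ (tx ℚ.- ty) ℚ.* x ℚ.+ ty ℚ.* (x ℚ.- y) ∣ ℚ.* ℚ.∣ i ∣
          ≡⟨ cong (ℚ.∣ (tx ℚ.- ty) ℚ.* x ℚ.+ ty ℚ.* (x ℚ.- y) ∣ ℚ.*_) (ℚ.0≤p⇒∣p∣≡p (0≤inv k)) ⟩
        ℚ.∣ (tx ℚ.- ty) ℚ.* x ℚ.+ ty ℚ.* (x ℚ.- y) ∣ ℚ.* i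
          ≤⟨ ℚ.*-monoʳ-≤-nonNeg i {{ℚ.nonNegative (0≤inv k)}} numerator ⟩
        (δ ℚ.* D k ℚ.* B ℚ.+ u k ℚ.* δ) ℚ.* i
          ≡⟨ solve 5 (λ a b c d e → (a :* b :* c :+ d :* a) :* e := a :* ((b :* c :+ d) :* e)) refl δ (D k) B (u k) i ⟩
        δ ℚ.* ((D k ℚ.* B ℚ.+ u k) ℚ.* i)
          ≡⟨ cong (δ ℚ.*_) (D-step k) ⟩
        δ ℚ.* u k ∎
        where
        open ℚ.≤-Reasoning
        tx = expTerm x k
        ty = expTerm y k
        i  = inv k
        numerator : ℚ.∣ (tx ℚ.- ty) ℚ.* x ℚ.+ ty ℚ.* (x ℚ.- y) ∣
                      ℚ.≤ δ ℚ.* D k ℚ.* B ℚ.+ u k ℚ.* δ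
        numerator = begin
          ℚ.∣ (tx ℚ.- ty) ℚ.* x ℚ.+ ty ℚ.* (x ℚ.- y) ∣
            ≤⟨ ℚ.∣p+q∣≤∣p∣+∣q∣ ((tx ℚ.- ty) ℚ.* x) (ty ℚ.* (x ℚ.- y)) ⟩
          ℚ.∣ (tx ℚ.- ty) ℚ.* x ∣ ℚ.+ ℚ.∣ ty ℚ.* (x ℚ.- y) ∣
            ≡⟨ cong₂ ℚ._+_ (ℚ.∣p*q∣≡∣p∣*∣q∣ (tx ℚ.- ty) x) (ℚ.∣p*q∣≡∣p∣*∣q∣ ty (x ℚ.- y)) ⟩
          ℚ.∣ tx ℚ.- ty ∣ ℚ.* ℚ.∣ x ∣ ℚ.+ ℚ.∣ ty ∣ ℚ.* δ
            ≤⟨ ℚ.+-mono-≤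
                 (*-mono-≤ (*-nonNeg (ℚ.0≤∣p∣ (x ℚ.- y)) (0≤D k)) (ℚ.0≤∣p∣ x) (term-lip k) ∣x∣≤B)
                 (ℚ.*-monoʳ-≤-nonNeg δ {{ℚ.nonNegative (ℚ.0≤∣p∣ (x ℚ.- y))}} (∣term∣≤ ∣y∣≤B k)) ⟩
          δ ℚ.* D k ℚ.* B ℚ.+ u k ℚ.* δ ∎

      sum-lip : ∀ m → ℚ.∣ expSum x (suc m) ℚ.- expSum y (suc m) ∣ ℚ.≤ δ ℚ.* S m
      sum-lip zero    = ℚ.≤-reflexive (sym (ℚ.*-zeroʳ δ))
      sum-lip (suc m) = begin
        ℚ.∣ (sx ℚ.+ tx) ℚ.- (sy ℚ.+ ty) ∣
          ≡⟨ cong ℚ.∣_∣ (solve 4 (λ a b c d → (a :+ b) :- (c :+ d) := (a :- c) :+ (b :- d)) refl sx tx sy ty) ⟩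
        ℚ.∣ (sx ℚ.- sy) ℚ.+ (tx ℚ.- ty) ∣
          ≤⟨ ℚ.∣p+q∣≤∣p∣+∣q∣ (sx ℚ.- sy) (tx ℚ.- ty) ⟩
        ℚ.∣ sx ℚ.- sy ∣ ℚ.+ ℚ.∣ tx ℚ.- ty ∣
          ≤⟨ ℚ.+-mono-≤ (sum-lip m) (term-lip (suc m)) ⟩
        δ ℚ.* S m ℚ.+ δ ℚ.* u m
          ≡⟨ ℚ.*-distribˡ-+ δ (S m) (u m) ⟨
        δ ℚ.* (S m ℚ.+ u m) ∎
        where
        open ℚ.≤-Reasoning
        sx = expSum x (suc m)
        sy = expSum y (suc m)
        tx = expTerm x (suc m)
        ty = expTerm y (suc m)

    module Tail (K : ℕ) (2B≤K : 2ℚ ℚ.* B ℚ.≤ ι K) where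

      2u-step : ∀ j → 2ℚ ℚ.* u (suc (j ℕ.+ K)) ℚ.≤ u (j ℕ.+ K)
      2u-step j = begin
        2ℚ ℚ.* (u k ℚ.* (B ℚ.* inv k))
          ≡⟨ solve 4 (λ t a b c → t :* (a :* (b :* c)) := a :* (t :* b :* c)) refl 2ℚ (u k) B (inv k) ⟩
        u k ℚ.* (2ℚ ℚ.* B ℚ.* inv k)
          ≤⟨ ℚ.*-monoˡ-≤-nonNeg (u k) {{ℚ.nonNegative (0≤u k)}}
               (ℚ.*-monoʳ-≤-nonNeg (inv k) {{ℚ.nonNegative (0≤inv k)}}
                 (ℚ.≤-trans 2B≤K (ι-mono K (suc j)))) ⟩
        u k ℚ.* (ι (suc k) ℚ.* inv k)
          ≡⟨ trans (cong (u k ℚ.*_) (ι-inv k)) (ℚ.*-identityʳ (u k)) ⟩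
        u k ∎
        where
        open ℚ.≤-Reasoning
        k = j ℕ.+ K

      S+2u-decreasing : ∀ j → S (suc (j ℕ.+ K)) ℚ.+ 2ℚ ℚ.* u (suc (j ℕ.+ K))
                                ℚ.≤ S (j ℕ.+ K) ℚ.+ 2ℚ ℚ.* u (j ℕ.+ K)
      S+2u-decreasing j = begin
        S k ℚ.+ u k ℚ.+ 2ℚ ℚ.* u (suc k)
          ≤⟨ ℚ.+-monoʳ-≤ (S k ℚ.+ u k) (2u-step j) ⟩
        S k ℚ.+ u k ℚ.+ u k
          ≡⟨ solve 2 (λ a b → a :+ b :+ b := a :+ (con 1ℚ :+ con 1ℚ) :* b) refl (S k) (u k) ⟩
        S k ℚ.+ 2ℚ ℚ.* u k ∎
        where
        open ℚ.≤-Reasoning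
        k = j ℕ.+ K

      M∞ : ℚ
      M∞ = S K ℚ.+ 2ℚ ℚ.* u K

      S+2u≤M∞ : ∀ j → S (j ℕ.+ K) ℚ.+ 2ℚ ℚ.* u (j ℕ.+ K) ℚ.≤ M∞
      S+2u≤M∞ zero    = ℚ.≤-refl
      S+2u≤M∞ (suc j) = ℚ.≤-trans (S+2u-decreasing j) (S+2u≤M∞ j)

      0≤2u : ∀ k → 0ℚ ℚ.≤ 2ℚ ℚ.* u k
      0≤2u k = *-nonNeg (ℚ.nonNegative⁻¹ 2ℚ) (0≤u k)

      S≤M∞ : ∀ j → S (j ℕ.+ K) ℚ.≤ M∞
      S≤M∞ j = ℚ.≤-trans
        (subst (ℚ._≤ S (j ℕ.+ K) ℚ.+ 2ℚ ℚ.* u (j ℕ.+ K)) (ℚ.+-identityʳ (S (j ℕ.+ K)))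
          (ℚ.+-monoʳ-≤ (S (j ℕ.+ K)) (0≤2u (j ℕ.+ K))))
        (S+2u≤M∞ j)

      ju≤ : ∀ j → ι (suc j) ℚ.* u (j ℕ.+ K) ℚ.≤ u K
      ju≤ zero    = ℚ.≤-reflexive (ℚ.*-identityˡ (u K))
      ju≤ (suc j) = begin
        ι (suc (suc j)) ℚ.* u (suc k)
          ≤⟨ ℚ.*-monoʳ-≤-nonNeg (u (suc k)) {{ℚ.nonNegative (0≤u (suc k))}} ι≤ ⟩
        ι (suc j) ℚ.* 2ℚ ℚ.* u (suc k)
          ≡⟨ ℚ.*-assoc (ι (suc j)) 2ℚ (u (suc k)) ⟩
        ι (suc j) ℚ.* (2ℚ ℚ.* u (suc k))
          ≤⟨ ℚ.*-monoˡ-≤-nonNeg (ι (suc j)) {{ℚ.nonNegative (0≤ι (suc j))}} (2u-step j) ⟩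
        ι (suc j) ℚ.* u k
          ≤⟨ ju≤ j ⟩
        u K ∎
        where
        open ℚ.≤-Reasoning
        k = j ℕ.+ K
        ι≤ : ι (suc (suc j)) ℚ.≤ ι (suc j) ℚ.* 2ℚ
        ι≤ = begin
          ι (suc (suc j))           ≡⟨ ι-suc (suc j) ⟩
          ι (suc j) ℚ.+ 1ℚ          ≤⟨ ℚ.+-monoʳ-≤ (ι (suc j))
                                        (subst (1ℚ ℚ.≤_) (sym (ι-suc j)) (ℚ.+-monoˡ-≤ 1ℚ (0≤ι j))) ⟩
          ι (suc j) ℚ.+ ι (suc j)   ≡⟨ solve 1 (λ a → a :+ a := a :* (con 1ℚ :+ con 1ℚ)) refl (ι (suc j)) ⟩
          ι (suc j) ℚ.* 2ℚ          ∎

      -- Beyond index N = j + K the partial sums at any ∣x∣ ≤ B stay within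
      -- 2 u N of the N-th one.
      tail : ∀ {x} → ℚ.∣ x ∣ ℚ.≤ B → ∀ j i →
        ℚ.∣ expSum x (i ℕ.+ (j ℕ.+ K)) ℚ.- expSum x (j ℕ.+ K) ∣ ℚ.≤ 2ℚ ℚ.* u (j ℕ.+ K)
      tail {x} ∣x∣≤B j i = ℚ.≤-trans (viaB i) (begin
        S (i ℕ.+ N) ℚ.- S N
          ≡⟨ ℚ.+-identityʳ (S (i ℕ.+ N) ℚ.- S N) ⟨
        S (i ℕ.+ N) ℚ.- S N ℚ.+ 0ℚ
          ≤⟨ ℚ.+-monoʳ-≤ (S (i ℕ.+ N) ℚ.- S N) (0≤2u (i ℕ.+ N)) ⟩
        S (i ℕ.+ N) ℚ.- S N ℚ.+ 2ℚ ℚ.* u (i ℕ.+ N)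
          ≡⟨ solve 3 (λ a b c → a :- b :+ c := a :+ c :- b) refl (S (i ℕ.+ N)) (S N) (2ℚ ℚ.* u (i ℕ.+ N)) ⟩
        S (i ℕ.+ N) ℚ.+ 2ℚ ℚ.* u (i ℕ.+ N) ℚ.- S N
          ≤⟨ ℚ.+-monoˡ-≤ (ℚ.- S N) (below i) ⟩
        S N ℚ.+ 2ℚ ℚ.* u N ℚ.- S N
          ≡⟨ solve 2 (λ a b → a :+ b :- a := b) refl (S N) (2ℚ ℚ.* u N) ⟩
        2ℚ ℚ.* u N ∎)
        where
        open ℚ.≤-Reasoning
        N = j ℕ.+ K
        below : ∀ i → S (i ℕ.+ N) ℚ.+ 2ℚ ℚ.* u (i ℕ.+ N) ℚ.≤ S N ℚ.+ 2ℚ ℚ.* u N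
        below zero    = ℚ.≤-refl
        below (suc i) = ℚ.≤-trans
          (subst (λ k → S (suc k) ℚ.+ 2ℚ ℚ.* u (suc k) ℚ.≤ S k ℚ.+ 2ℚ ℚ.* u k)
            (ℕ.+-assoc i j K) (S+2u-decreasing (i ℕ.+ j)))
          (below i)
        viaB : ∀ i → ℚ.∣ expSum x (i ℕ.+ N) ℚ.- expSum x N ∣ ℚ.≤ S (i ℕ.+ N) ℚ.- S N
        viaB zero    = ℚ.≤-reflexive (trans (∣x-x∣≡0 (expSum x N)) (sym (ℚ.+-inverseʳ (S N))))
        viaB (suc i) = begin
          ℚ.∣ a ℚ.+ t ℚ.- b ∣
            ≡⟨ cong ℚ.∣_∣ (solve 3 (λ a t b → a :+ t :- b := (a :- b) :+ t) refl a t b) ⟩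
          ℚ.∣ (a ℚ.- b) ℚ.+ t ∣
            ≤⟨ ℚ.∣p+q∣≤∣p∣+∣q∣ (a ℚ.- b) t ⟩
          ℚ.∣ a ℚ.- b ∣ ℚ.+ ℚ.∣ t ∣
            ≤⟨ ℚ.+-mono-≤ (viaB i) (∣term∣≤ ∣x∣≤B (i ℕ.+ N)) ⟩
          S (i ℕ.+ N) ℚ.- S N ℚ.+ u (i ℕ.+ N)
            ≡⟨ solve 3 (λ a b t → a :- b :+ t := a :+ t :- b) refl (S (i ℕ.+ N)) (S N) (u (i ℕ.+ N)) ⟩
          S (suc i ℕ.+ N) ℚ.- S N ∎
          where
          a = expSum x (i ℕ.+ N)
          b = expSum x N
          t = expTerm x (i ℕ.+ N)

      opaque
        u→0 : ∀ ε → 0ℚ ℚ.< ε → ∃[ j ] u (j ℕ.+ K) ℚ.≤ ε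
        u→0 ε 0<ε with archimedean (u K ℚ.* (ℚ.1/ ε) {{ℚ.pos⇒nonZero ε {{ℚ.positive 0<ε}}}})
        ... | j , q≤j = j , ℚ.*-cancelˡ-≤-pos (ι (suc j)) {{ℚ.positive 0<ιj}} (begin
          ι (suc j) ℚ.* u (j ℕ.+ K)   ≤⟨ ju≤ j ⟩
          u K                         ≡⟨ sym (trans (ℚ.*-assoc (u K) ε⁻¹ ε) (trans (cong (u K ℚ.*_) (ℚ.*-inverseˡ ε)) (ℚ.*-identityʳ (u K)))) ⟩
          u K ℚ.* ε⁻¹ ℚ.* ε           ≤⟨ ℚ.*-monoʳ-≤-nonNeg ε {{ℚ.nonNegative (ℚ.<⇒≤ 0<ε)}} (ℚ.≤-trans q≤j (ι-mono j 1)) ⟩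
          ι (suc j) ℚ.* ε             ∎)
          where
          open ℚ.≤-Reasoning
          instance
            ε≠0 : ℚ.NonZero ε
            ε≠0 = ℚ.pos⇒nonZero ε {{ℚ.positive 0<ε}}
          ε⁻¹ : ℚ
          ε⁻¹ = ℚ.1/ ε
          0<ιj : 0ℚ ℚ.< ι (suc j)
          0<ιj = subst (0ℚ ℚ.<_) (sym (ι-suc j)) (ℚ.+-mono-≤-< (0≤ι j) 0<1)

  opaque
    cauchy-exp : ∀ {x} → IsCauchy x → IsCauchy (λ n → expSum (x n) n)
    cauchy-exp {x} hx with eventuallyBounded {x} hx
    ... | B , 0<B , N₀ , bx with archimedean (2ℚ ℚ.* B)
    ... | K , 2B≤K = rescale {K = L} {x = λ n → expSum (x n) n} 0<L go
      where
      open ExpBounds B (ℚ.<⇒≤ 0<B)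
      open Tail K 2B≤K
      4ℚ L : ℚ
      4ℚ = 2ℚ ℚ.+ 2ℚ
      L  = M∞ ℚ.+ 4ℚ ℚ.+ 1ℚ
      0≤S : ∀ n → 0ℚ ℚ.≤ S n
      0≤S zero    = ℚ.≤-refl
      0≤S (suc n) = ℚ.+-mono-≤ (0≤S n) (0≤u n)
      0≤M∞ : 0ℚ ℚ.≤ M∞
      0≤M∞ = ℚ.+-mono-≤ (0≤S K) (0≤2u K)
      0<L : 0ℚ ℚ.< L
      0<L = ℚ.+-mono-≤-< (ℚ.+-mono-≤ 0≤M∞ (ℚ.nonNegative⁻¹ 4ℚ)) 0<1
      go : IsCauchyUpTo L (λ n → expSum (x n) n)
      go ε 0<ε with hx ε 0<ε | u→0 ε 0<ε
      ... | M , hM | j , uj≤ε = N ℕ.⊔ (N₀ ℕ.⊔ M) , close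
        where
        open ℚ.≤-Reasoning
        N : ℕ
        N = suc j ℕ.+ K
        uN≤ε : u N ℚ.≤ ε
        uN≤ε = begin
          u N                       ≡⟨ ℚ.+-identityʳ (u N) ⟨
          u N ℚ.+ 0ℚ                ≤⟨ ℚ.+-monoʳ-≤ (u N) (0≤u N) ⟩
          u N ℚ.+ u N               ≡⟨ solve 1 (λ a → a :+ a := (con 1ℚ :+ con 1ℚ) :* a) refl (u N) ⟩
          2ℚ ℚ.* u N                ≤⟨ 2u-step j ⟩
          u (j ℕ.+ K)               ≤⟨ uj≤ε ⟩
          ε                         ∎
        tail′ : ∀ m → N ℕ.≤ m → N₀ ℕ.≤ m →
                ℚ.∣ expSum (x m) m ℚ.- expSum (x m) N ∣ ℚ.≤ 2ℚ ℚ.* ε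
        tail′ m N≤m N₀≤m = ℚ.≤-trans
          (subst (λ k → ℚ.∣ expSum (x m) k ℚ.- expSum (x m) N ∣ ℚ.≤ 2ℚ ℚ.* u N)
            (ℕ.m∸n+n≡m N≤m) (tail (bx m N₀≤m) (suc j) (m ℕ.∸ N)))
          (ℚ.*-monoˡ-≤-nonNeg 2ℚ uN≤ε)
        close : ∀ m n → N ℕ.⊔ (N₀ ℕ.⊔ M) ℕ.≤ m → N ℕ.⊔ (N₀ ℕ.⊔ M) ℕ.≤ n →
                ℚ.∣ expSum (x m) m ℚ.- expSum (x n) n ∣ ℚ.< L ℚ.* ε
        close m n ≤m ≤n = begin-strict
          ℚ.∣ a ℚ.- d ∣
            ≡⟨ cong ℚ.∣_∣ (solve 4 (λ a b c d → a :- d := (a :- b) :+ ((b :- c) :+ :- (d :- c))) refl a b c d) ⟩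
          ℚ.∣ (a ℚ.- b) ℚ.+ ((b ℚ.- c) ℚ.+ ℚ.- (d ℚ.- c)) ∣
            ≤⟨ ℚ.∣p+q∣≤∣p∣+∣q∣ (a ℚ.- b) ((b ℚ.- c) ℚ.+ ℚ.- (d ℚ.- c)) ⟩
          ℚ.∣ a ℚ.- b ∣ ℚ.+ ℚ.∣ (b ℚ.- c) ℚ.+ ℚ.- (d ℚ.- c) ∣
            ≤⟨ ℚ.+-monoʳ-≤ ℚ.∣ a ℚ.- b ∣ (ℚ.∣p+q∣≤∣p∣+∣q∣ (b ℚ.- c) (ℚ.- (d ℚ.- c))) ⟩
          ℚ.∣ a ℚ.- b ∣ ℚ.+ (ℚ.∣ b ℚ.- c ∣ ℚ.+ ℚ.∣ ℚ.- (d ℚ.- c) ∣)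
            ≡⟨ cong (λ r → ℚ.∣ a ℚ.- b ∣ ℚ.+ (ℚ.∣ b ℚ.- c ∣ ℚ.+ r)) (ℚ.∣-p∣≡∣p∣ (d ℚ.- c)) ⟩
          ℚ.∣ a ℚ.- b ∣ ℚ.+ (ℚ.∣ b ℚ.- c ∣ ℚ.+ ℚ.∣ d ℚ.- c ∣)
            ≤⟨ ℚ.+-mono-≤ (tail′ m (⊔-≤ˡ (N₀ ℕ.⊔ M) ≤m) N₀≤m)
                 (ℚ.+-mono-≤ middle (tail′ n (⊔-≤ˡ (N₀ ℕ.⊔ M) ≤n) N₀≤n)) ⟩
          2ℚ ℚ.* ε ℚ.+ (ε ℚ.* M∞ ℚ.+ 2ℚ ℚ.* ε)
            ≡⟨ ℚ.+-identityʳ _ ⟨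
          2ℚ ℚ.* ε ℚ.+ (ε ℚ.* M∞ ℚ.+ 2ℚ ℚ.* ε) ℚ.+ 0ℚ
            <⟨ ℚ.+-monoʳ-< (2ℚ ℚ.* ε ℚ.+ (ε ℚ.* M∞ ℚ.+ 2ℚ ℚ.* ε)) 0<ε ⟩
          2ℚ ℚ.* ε ℚ.+ (ε ℚ.* M∞ ℚ.+ 2ℚ ℚ.* ε) ℚ.+ ε
            ≡⟨ solve 3 (λ t c e → t :* e :+ (e :* c :+ t :* e) :+ e := (c :+ (t :+ t) :+ con 1ℚ) :* e) refl 2ℚ M∞ ε ⟩
          L ℚ.* ε ∎
          where
          a b c d : ℚ
          a = expSum (x m) m
          b = expSum (x m) N
          c = expSum (x n) N
          d = expSum (x n) n
          N₀≤m : N₀ ℕ.≤ m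
          N₀≤m = ⊔-≤ˡ M (⊔-≤ʳ N ≤m)
          N₀≤n : N₀ ℕ.≤ n
          N₀≤n = ⊔-≤ˡ M (⊔-≤ʳ N ≤n)
          middle : ℚ.∣ b ℚ.- c ∣ ℚ.≤ ε ℚ.* M∞
          middle = ℚ.≤-trans
            (Lipschitz.sum-lip (bx m N₀≤m) (bx n N₀≤n) (j ℕ.+ K))
            (*-mono-≤ (ℚ.<⇒≤ 0<ε) (0≤S (j ℕ.+ K))
              (ℚ.<⇒≤ (hM m n (⊔-≤ʳ N₀ (⊔-≤ʳ N ≤m)) (⊔-≤ʳ N₀ (⊔-≤ʳ N ≤n)))) (S≤M∞ j))

-- The diagonal sequence n ↦ ∑_{k<n} (x n) ^ k / k ! represents ∑_k x ^ k / k !,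
-- because the partial sums converge uniformly on bounded sets.
exp : ℝ → ℝ
exp x = mkℝ (λ n → expSum (seq x n) n) (cauchy-exp {seq x} (cauchy x))

g : ℕ → ℝ → ℝ
g d x = fromℕ (suc d) * (x + 1ℝ) * exp (- x)
      + x * (1ℝ - exp (- x)) ^ suc d

record IsUniquePositiveSolution (f : ℝ → ℝ) (y x : ℝ) : Set where
  field
    positive : 0ℝ < x
    solution : f x ≈ y
    unique   : ∀ z → 0ℝ < z → f z ≈ y → z ≈ x

open import Data.Nat.Combinatorics using (_C_)
open import Data.Bool using (if_then_else_)
open import Data.Bool.Properties using () renaming (_≟_ to _≟ᵇ_)
open import Data.Fin.Subset using (Subset; inside; outside; ∣_∣)
open import Data.Fin.Subset.Properties using (_⊆?_)
open import Data.List.Membership.DecPropositional using () renaming (_∈?_ to member?)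
open import Data.Nat.ListAction using () renaming (sum to sumℕ)
open import Data.Vec using ([]; _∷_)
open import Data.Vec.Properties using (≡-dec)
open import Level using (0ℓ)
open import Relation.Binary.Definitions using (DecidableEquality)
open import Relation.Nullary.Decidable using (does; _×-dec_)
open import Relation.Unary using (Pred; Decidable)

-- A complex is given by the list of its (nonempty) faces.
Complex : ℕ → Set
Complex n = List (Subset n)

_≟ˢ_ : ∀ {n} → DecidableEquality (Subset n)
_≟ˢ_ = ≡-dec _≟ᵇ_

subsets : ∀ n → List (Subset n)
subsets zero    = [] ∷ []
subsets (suc n) = map (inside ∷_) (subsets n) ++ map (outside ∷_) (subsets n)

sublists : {A : Set} → List A → List (List A)
sublists []       = [] ∷ []
sublists (x ∷ xs) = map (x ∷_) (sublists xs) ++ sublists xs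

-- Δ n is the full simplex on n vertices, that is Δ_{n-1} in the usual
-- indexing by dimension.
Δ : ∀ n → Complex n
Δ n = filter (λ σ → 1 ℕ.≤? ∣ σ ∣) (subsets n)

skeleton : ∀ {n} → ℕ → Complex n → Complex n
skeleton i X = filter (λ σ → ∣ σ ∣ ℕ.≤? suc i) X

-- Dimension k means k + 1 vertices.
simplices : ∀ {n} → ℕ → Complex n → List (Subset n)
simplices k X = filter (λ σ → ∣ σ ∣ ℕ.≟ suc k) X

-- For d ≥ 1, the complexes between the (d-1)- and the d-skeleton of Δ n: the whole
-- (d-1)-skeleton together with an arbitrary set of d-simplices.
𝒴 : ∀ d n → List (Complex n)
𝒴 d n = map (skeleton (ℕ.pred d) (Δ n) ++_) (sublists (simplices d (Δ n)))

-- Independence: a product with one factor per d-simplex of Δ n, included or not.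
weight : ∀ d {n} → ℝ → Complex n → ℝ
weight d {n} p Y =
  ∏ (map (λ σ → if does (member? _≟ˢ_ σ Y) then p else 1ℝ - p)
         (simplices d (Δ n)))

-- No constraint 0 ≤ p ≤ 1 is imposed; for p = c / n it holds once n ≥ c.
Pr : ∀ d n (p : ℝ) {P : Pred (Complex n) 0ℓ} → Decidable P → ℝ
Pr d n p P? = ∑ (map (weight d p) (filter P? (𝒴 d n)))

f : ∀ {n} → ℕ → Complex n → ℕ
f k Y = length (simplices k Y)

degree : ∀ {n} → ℕ → Complex n → Subset n → ℕ
degree d Y τ = length (filter (τ ⊆?_) (simplices d Y))

a : ∀ {n} → ℕ → Complex n → ℕ
a {n} d Y =
  length (filter (λ τ → degree d Y τ ℕ.≟ 0) (simplices (ℕ.pred d) (Δ n)))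

freeFaces : ∀ {n} → ℕ → Complex n → Subset n → List (Subset n)
freeFaces {n} d Y σ =
  filter (λ τ → (τ ⊆? σ) ×-dec (degree d Y τ ℕ.≟ 1)) (simplices (ℕ.pred d) (Δ n))

-- Only used for j ≤ d, where suc d ∸ j does not truncate.
α : ∀ {n} → ℕ → ℕ → Complex n → ℕ
α d j Y =
  length (filter (λ σ → length (freeFaces d Y σ) ℕ.≟ suc d ℕ.∸ j) (simplices d Y))

v : ∀ {n} → ℕ → Complex n → ℤ
v {n} d Y =
  + (f d Y ℕ.+ a d Y ℕ.+ sumℕ (map (λ j → α d j Y ℕ.* (d ℕ.∸ j)) (upTo (suc d))))
  ℤ.- + (n C d)

{-# OPTIONS --safe #-}
module Submission where

-- Put m = d + 1. Grouping the d-simplices of Y by their number of free faces turns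
-- v(Y) + binom(n, d) into the number W of (d-1)-simplices of degree at most 1 plus the
-- number of d-simplices of Y without free faces. Adding a d-simplex changes W by at
-- most m + 1, so the Efron–Stein inequality and Chebyshev's inequality reduce the claim
-- to E W ≥ (1 + δ) binom(n, d). Harris' inequality bounds below the probability that a
-- d-simplex has no free face, and with t = (1 - c/n)ⁿ it follows that m E W / binom(n, d)
-- is at least m + h(c, t) up to O(1/n), where h(x, t) = m (x + 1) t + x (1 - t)ᵐ - m
-- and h(x, exp (- x)) = g_d(x) - m.
--
-- Let X = (1 - x/n)ⁿ. The function h(x, X) / (x (1 - X)) of x is strictly increasing, since
-- x y (X - Y) ≤ (y - x) (1 - X) (1 - Y) for x ≤ y by Chebyshev's sum inequality. As
-- h(c_d, (1 - c_d/n)ⁿ) tends to 0, h(c, (1 - c/n)ⁿ) is bounded away from 0 for large n.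
-- No limit in c is taken: everything holds uniformly for the rational approximations.

-- The function h is not monotone: h(x, exp (- x)) vanishes at 0, behaves like - m x² / 2 nearby and
-- becomes positive only later. So its sign beyond c_d has to come from the quotient by x (1 - X),
-- which is always multiplied out to avoid division. With (1 - x/n)ⁿ in place of exp (- x) the
-- comparison becomes polynomial and can be proved over the rationals by induction on n; the
-- exponential series is needed only at c_d, whose equation is stated with it.
--
-- Operations on reals act termwise on the approximating sequences. Hence the k-th approximation of
-- the probability is itself a probability, for the rational parameter c_k / n, and all
-- probabilistic work takes place in ℚ. The indices k and n are independent, so every threshold has
-- to serve all large pairs.
--
-- `W` is not monotone in Y. Harris' inequality is therefore applied to the events of one fixed
-- simplex, and the deviation of `W` is controlled by a variance bound that retains the factor p: it
-- is then linear in binom(n, d), against a squared deviation that is quadratic.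

import Data.Bool as Bool
import Data.List as List
import Data.Rational as ℚ

-- Inequalities for rationals and their powers

module Rational where

  open import Data.Nat as ℕ using (ℕ; zero; suc)
  import Data.Nat.Properties as ℕₚ
  open import Data.Integer as ℤ using (ℤ; +_; 1ℤ)
  import Data.Integer.Properties as ℤₚ
  open import Data.Rational hiding (truncate)
  open import Data.Rational.Properties
  import Data.Rational.Unnormalised as ℚᵘ
  import Data.Rational.Unnormalised.Properties as ℚᵘₚ
  open import Data.Rational.Solver using (module +-*-Solver)
  open import Algebra.Bundles using (CommutativeRing)
  open import Algebra.Properties.Semiring.Exp (CommutativeRing.semiring +-*-commutativeRing) public
    using (_^_; ^-homo-*; ^-assocʳ)
  open import Data.Product using (∃-syntax; _×_; _,_)
  open import Data.Sum using (inj₁; inj₂)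
  open import Relation.Binary.PropositionalEquality
  open +-*-Solver

  1/suc : ℕ → ℚ
  1/suc k = 1ℤ / suc k

  ι : ℕ → ℚ
  ι k = + k / 1

  private
    ιᵘ : ℕ → ℚᵘ.ℚᵘ
    ιᵘ k = ℚᵘ.mkℚᵘ (+ k) 0

    toℚᵘ-ι : ∀ k → toℚᵘ (ι k) ℚᵘ.≃ ιᵘ k
    toℚᵘ-ι k = toℚᵘ-fromℚᵘ (ιᵘ k)

  opaque
    ι-+ : ∀ j k → ι (j ℕ.+ k) ≡ ι j + ι k
    ι-+ j k = toℚᵘ-injective (begin
      toℚᵘ (ι (j ℕ.+ k))              ≈⟨ toℚᵘ-ι (j ℕ.+ k) ⟩
      ιᵘ (j ℕ.+ k)                    ≈⟨ ℚᵘ.*≡* (cong (ℤ._* + 1) (sym (cong₂ ℤ._+_ (ℤₚ.*-identityʳ (+ j)) (ℤₚ.*-identityʳ (+ k))))) ⟩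
      ιᵘ j ℚᵘ.+ ιᵘ k                  ≈⟨ ℚᵘₚ.+-cong (toℚᵘ-ι j) (toℚᵘ-ι k) ⟨
      toℚᵘ (ι j) ℚᵘ.+ toℚᵘ (ι k)      ≈⟨ toℚᵘ-homo-+ (ι j) (ι k) ⟨
      toℚᵘ (ι j + ι k)                ∎)
      where open ℚᵘₚ.≃-Reasoning

    ι-* : ∀ j k → ι (j ℕ.* k) ≡ ι j * ι k
    ι-* j k = toℚᵘ-injective (begin
      toℚᵘ (ι (j ℕ.* k))              ≈⟨ toℚᵘ-ι (j ℕ.* k) ⟩
      ιᵘ (j ℕ.* k)                    ≈⟨ ℚᵘ.*≡* (cong (ℤ._* + 1) (ℤₚ.pos-* j k)) ⟩
      ιᵘ j ℚᵘ.* ιᵘ k                  ≈⟨ ℚᵘₚ.*-cong (toℚᵘ-ι j) (toℚᵘ-ι k) ⟨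
      toℚᵘ (ι j) ℚᵘ.* toℚᵘ (ι k)      ≈⟨ toℚᵘ-homo-* (ι j) (ι k) ⟨
      toℚᵘ (ι j * ι k)                ∎)
      where open ℚᵘₚ.≃-Reasoning

    0≤ι : ∀ k → 0ℚ ≤ ι k
    0≤ι k = nonNegative⁻¹ (ι k) {{normalize-nonNeg k 1}}

    0≤1/suc : ∀ k → 0ℚ ≤ 1/suc k
    0≤1/suc k = nonNegative⁻¹ (1/suc k) {{normalize-nonNeg 1 (suc k)}}

    ι-1/suc : ∀ k → ι (suc k) * 1/suc k ≡ 1ℚ
    ι-1/suc k = toℚᵘ-injective (begin
      toℚᵘ (ι (suc k) * 1/suc k)               ≈⟨ toℚᵘ-homo-* (ι (suc k)) (1/suc k) ⟩
      toℚᵘ (ι (suc k)) ℚᵘ.* toℚᵘ (1/suc k)     ≈⟨ ℚᵘₚ.*-cong (toℚᵘ-ι (suc k)) (toℚᵘ-fromℚᵘ (ℚᵘ.mkℚᵘ 1ℤ k)) ⟩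
      ιᵘ (suc k) ℚᵘ.* ℚᵘ.mkℚᵘ 1ℤ k             ≈⟨ ℚᵘₚ.*-inverseʳ (ιᵘ (suc k)) ⟩
      toℚᵘ 1ℚ                                  ∎)
      where open ℚᵘₚ.≃-Reasoning

    archimedean : ∀ q → ∃[ k ] q ≤ ι k
    archimedean q@(mkℚ n d _) = ℤ.∣ n ∣ , toℚᵘ-cancel-≤
      (ℚᵘₚ.≤-respʳ-≃ (ℚᵘₚ.≃-sym (toℚᵘ-ι ℤ.∣ n ∣)) (ℚᵘ.*≤* (bound n)))
      where
      bound : ∀ i → i ℤ.* + 1 ℤ.≤ + ℤ.∣ i ∣ ℤ.* + suc d
      bound (+ j)      rewrite ℤₚ.*-identityʳ (+ j) | sym (ℤₚ.pos-* j (suc d)) = ℤ.+≤+ (ℕₚ.m≤m*n j (suc d))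
      bound ℤ.-[1+ j ] = ℤ.-≤+

    ι-suc : ∀ k → ι (suc k) ≡ 1ℚ + ι k
    ι-suc = ι-+ 1

    ≤-by : ∀ {a b} r → 0ℚ ≤ r → b ≡ a + r → a ≤ b
    ≤-by {a} r 0≤r refl = subst (_≤ a + r) (+-identityʳ a) (+-monoʳ-≤ a 0≤r)

    p≤q⇒0≤q-p : ∀ {p q} → p ≤ q → 0ℚ ≤ q - p
    p≤q⇒0≤q-p {p} {q} p≤q = subst (_≤ q - p) (+-inverseʳ p) (+-monoˡ-≤ (- p) p≤q)

    0≤q-p⇒p≤q : ∀ {p q} → 0ℚ ≤ q - p → p ≤ q
    0≤q-p⇒p≤q {p} {q} h = ≤-by (q - p) h (solve 2 (λ p q → q := p :+ (q :- p)) refl p q)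

    0≤+ : ∀ {p q} → 0ℚ ≤ p → 0ℚ ≤ q → 0ℚ ≤ p + q
    0≤+ = +-mono-≤

    0≤* : ∀ {p q} → 0ℚ ≤ p → 0ℚ ≤ q → 0ℚ ≤ p * q
    0≤* {p} {q} 0≤p 0≤q = subst (_≤ p * q) (*-zeroʳ p)
      (*-monoˡ-≤-nonNeg p {{nonNegative 0≤p}} 0≤q)

    0<* : ∀ {p q} → 0ℚ < p → 0ℚ < q → 0ℚ < p * q
    0<* {p} {q} 0<p 0<q = subst (_< p * q) (*-zeroʳ p)
      (*-monoʳ-<-pos p {{positive 0<p}} 0<q)

    0<1 : 0ℚ < 1ℚ
    0<1 = positive⁻¹ 1ℚ

    0≤1 : 0ℚ ≤ 1ℚ
    0≤1 = <⇒≤ 0<1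

    p≤p+q : ∀ {p q} → 0ℚ ≤ q → p ≤ p + q
    p≤p+q {p} {q} 0≤q = ≤-by q 0≤q refl

    *-monoˡ-≤ : ∀ {p q r} → 0ℚ ≤ r → p ≤ q → r * p ≤ r * q
    *-monoˡ-≤ {r = r} 0≤r = *-monoˡ-≤-nonNeg r {{nonNegative 0≤r}}

    *-monoʳ-≤ : ∀ {p q r} → 0ℚ ≤ r → p ≤ q → p * r ≤ q * r
    *-monoʳ-≤ {r = r} 0≤r = *-monoʳ-≤-nonNeg r {{nonNegative 0≤r}}

    *-mono-≤ : ∀ {p q r s} → 0ℚ ≤ q → 0ℚ ≤ r → p ≤ q → r ≤ s → p * r ≤ q * s
    *-mono-≤ 0≤q 0≤r p≤q r≤s = ≤-trans (*-monoʳ-≤ 0≤r p≤q) (*-monoˡ-≤ 0≤q r≤s)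

    *-cancelˡ-≤ : ∀ {p q} r → 0ℚ < r → r * p ≤ r * q → p ≤ q
    *-cancelˡ-≤ r 0<r = *-cancelˡ-≤-pos r {{positive 0<r}}

    ι-mono : ∀ {j k} → j ℕ.≤ k → ι j ≤ ι k
    ι-mono {j} {k} j≤k = subst (λ i → ι j ≤ ι i) (ℕₚ.m+[n∸m]≡n j≤k)
      (subst (ι j ≤_) (sym (ι-+ j (k ℕ.∸ j))) (p≤p+q (0≤ι (k ℕ.∸ j))))

    0<ι : ∀ k → 0ℚ < ι (suc k)
    0<ι k = <-≤-trans {0ℚ} {1ℚ} {ι (suc k)} 0<1 (ι-mono {1} {suc k} (ℕ.s≤s ℕ.z≤n))

    invert : ∀ {p} → 0ℚ < p → ∃[ r ] 0ℚ < r × p * r ≡ 1ℚ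
    invert {p} 0<p = 1/ p , positive⁻¹ (1/ p) {{1/pos⇒pos p}} , *-inverseʳ p
      where
      instance
        p⁺ : Positive p
        p⁺ = positive 0<p
        p≢0 : NonZero p
        p≢0 = pos⇒nonZero p

    ∣p∣≤q : ∀ {p q} → p ≤ q → - p ≤ q → ∣ p ∣ ≤ q
    ∣p∣≤q {p} {q} p≤q -p≤q with ∣p∣≡p∨∣p∣≡-p p
    ... | inj₁ eq = subst (_≤ q) (sym eq) p≤q
    ... | inj₂ eq = subst (_≤ q) (sym eq) -p≤q

    p≤∣p∣ : ∀ p → p ≤ ∣ p ∣
    p≤∣p∣ p with ∣p∣≡p∨∣p∣≡-p p
    ... | inj₁ eq = ≤-reflexive (sym eq)
    ... | inj₂ eq = ≤-by (∣ p ∣ + ∣ p ∣) (0≤+ (0≤∣p∣ p) (0≤∣p∣ p))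
      (subst (λ r → r ≡ p + (r + r)) (sym eq) (solve 1 (λ p → :- p := p :+ (:- p :+ :- p)) refl p))

    -p≤∣p∣ : ∀ p → - p ≤ ∣ p ∣
    -p≤∣p∣ p = subst (- p ≤_) (∣-p∣≡∣p∣ p) (p≤∣p∣ (- p))

    ∣p∣²≡p² : ∀ p → ∣ p ∣ * ∣ p ∣ ≡ p * p
    ∣p∣²≡p² p with ∣p∣≡p∨∣p∣≡-p p
    ... | inj₁ eq rewrite eq = refl
    ... | inj₂ eq rewrite eq = solve 1 (λ p → (:- p) :* (:- p) := p :* p) refl p

    0≤p² : ∀ p → 0ℚ ≤ p * p
    0≤p² p = subst (0ℚ ≤_) (∣p∣²≡p² p) (0≤* (0≤∣p∣ p) (0≤∣p∣ p))

    ∣p∣≤q⇒p²≤q² : ∀ {p q} → ∣ p ∣ ≤ q → p * p ≤ q * q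
    ∣p∣≤q⇒p²≤q² {p} h = subst (_≤ _) (∣p∣²≡p² p)
      (*-mono-≤ (≤-trans (0≤∣p∣ p) h) (0≤∣p∣ p) h h)

    0≤^ : ∀ {x} → 0ℚ ≤ x → ∀ n → 0ℚ ≤ x ^ n
    0≤^ 0≤x zero    = 0≤1
    0≤^ 0≤x (suc n) = 0≤* 0≤x (0≤^ 0≤x n)

    0<^ : ∀ {x} → 0ℚ < x → ∀ n → 0ℚ < x ^ n
    0<^ 0<x zero    = 0<1
    0<^ 0<x (suc n) = 0<* 0<x (0<^ 0<x n)

    ^≤1 : ∀ {x} → 0ℚ ≤ x → x ≤ 1ℚ → ∀ n → x ^ n ≤ 1ℚ
    ^≤1 0≤x x≤1 zero    = ≤-refl
    ^≤1 0≤x x≤1 (suc n) = *-mono-≤ 0≤1 (0≤^ 0≤x n) x≤1 (^≤1 0≤x x≤1 n)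

    ^-monoˡ-≤ : ∀ {x y} → 0ℚ ≤ x → x ≤ y → ∀ n → x ^ n ≤ y ^ n
    ^-monoˡ-≤ 0≤x x≤y zero    = ≤-refl
    ^-monoˡ-≤ 0≤x x≤y (suc n) = *-mono-≤ (≤-trans 0≤x x≤y) (0≤^ 0≤x n) x≤y (^-monoˡ-≤ 0≤x x≤y n)

    ^-antitoneʳ : ∀ {x} → 0ℚ ≤ x → x ≤ 1ℚ → ∀ {m n} → m ℕ.≤ n → x ^ n ≤ x ^ m
    ^-antitoneʳ 0≤x x≤1 {n = n} ℕ.z≤n = ^≤1 0≤x x≤1 n
    ^-antitoneʳ 0≤x x≤1 (ℕ.s≤s m≤n)   = *-monoˡ-≤ 0≤x (^-antitoneʳ 0≤x x≤1 m≤n)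

    1^ : ∀ n → 1ℚ ^ n ≡ 1ℚ
    1^ zero    = refl
    1^ (suc n) = trans (*-identityˡ (1ℚ ^ n)) (1^ n)

    bernoulli : ∀ {e} → 0ℚ ≤ e → e ≤ 1ℚ → ∀ n → 1ℚ - ι n * e ≤ (1ℚ - e) ^ n
    bernoulli {e} 0≤e e≤1 zero = ≤-reflexive (solve 1 (λ e → con 1ℚ :- con 0ℚ :* e := con 1ℚ) refl e)
    bernoulli {e} 0≤e e≤1 (suc n) = ≤-trans
      (≤-by (ι n * (e * e)) (0≤* (0≤ι n) (0≤p² e))
        (subst (λ z → (1ℚ - e) * (1ℚ - ι n * e) ≡ 1ℚ - z * e + ι n * (e * e)) (sym (ι-suc n))
          (solve 2 (λ e k → (con 1ℚ :- e) :* (con 1ℚ :- k :* e) := con 1ℚ :- (con 1ℚ :+ k) :* e :+ k :* (e :* e)) refl e (ι n))))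
      (*-monoˡ-≤ (p≤q⇒0≤q-p e≤1) (bernoulli 0≤e e≤1 n))

    -- The division-free form of (1 - e)ⁿ ≤ 1 / (1 + n e). It keeps 1 - (1 - e)ⁿ away from 0 as soon
    -- as n e is bounded below.
    bernoulli-inverse : ∀ {e} → 0ℚ ≤ e → e ≤ 1ℚ → ∀ n → (1ℚ - e) ^ n * (1ℚ + ι n * e) ≤ 1ℚ
    bernoulli-inverse {e} 0≤e e≤1 zero = ≤-reflexive (solve 1 (λ e → con 1ℚ :* (con 1ℚ :+ con 0ℚ :* e) := con 1ℚ) refl e)
    bernoulli-inverse {e} 0≤e e≤1 (suc n) = ≤-trans
      (≤-by ((1ℚ - e) ^ n * ((1ℚ + ι n) * (e * e)))
        (0≤* (0≤^ (p≤q⇒0≤q-p e≤1) n) (0≤* (0≤+ 0≤1 (0≤ι n)) (0≤p² e)))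
        (subst (λ z → (1ℚ - e) ^ n * (1ℚ + ι n * e) ≡ (1ℚ - e) * (1ℚ - e) ^ n * (1ℚ + z * e) + (1ℚ - e) ^ n * ((1ℚ + ι n) * (e * e))) (sym (ι-suc n))
          (solve 3 (λ e k P → P :* (con 1ℚ :+ k :* e) := (con 1ℚ :- e) :* P :* (con 1ℚ :+ (con 1ℚ :+ k) :* e) :+ P :* ((con 1ℚ :+ k) :* (e :* e))) refl e (ι n) ((1ℚ - e) ^ n))))
      (bernoulli-inverse 0≤e e≤1 n)

    -- The tangent bound xⁿ ≥ yⁿ + n (x - y) yⁿ⁻¹, weakened through y ≤ 1 so that no predecessor of
    -- n occurs.
    ^-gap : ∀ {x y} → 0ℚ ≤ y → y ≤ x → y ≤ 1ℚ → ∀ n → y ^ n + ι n * ((x - y) * y ^ n) ≤ x ^ n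
    ^-gap {x} {y} 0≤y y≤x y≤1 zero = ≤-reflexive (solve 1 (λ z → con 1ℚ :+ con 0ℚ :* z := con 1ℚ) refl ((x - y) * 1ℚ))
    ^-gap {x} {y} 0≤y y≤x y≤1 (suc n) = ≤-trans
      (≤-by ((x - y) * (P * (1ℚ - y)) + ι n * ((x - y) * (x - y) * P))
        (0≤+ (0≤* d (0≤* 0≤P (p≤q⇒0≤q-p y≤1))) (0≤* (0≤ι n) (0≤* (0≤p² (x - y)) 0≤P)))
        (subst (λ z → x * (P + ι n * ((x - y) * P)) ≡ y * P + z * ((x - y) * (y * P)) + ((x - y) * (P * (1ℚ - y)) + ι n * ((x - y) * (x - y) * P))) (sym (ι-suc n))
          (solve 4 (λ x y P k → x :* (P :+ k :* ((x :- y) :* P)) := y :* P :+ (con 1ℚ :+ k) :* ((x :- y) :* (y :* P)) :+ ((x :- y) :* (P :* (con 1ℚ :- y)) :+ k :* ((x :- y) :* (x :- y) :* P))) refl x y P (ι n))))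
      (*-monoˡ-≤ (≤-trans 0≤y y≤x) (^-gap 0≤y y≤x y≤1 n))
      where
      P : ℚ
      P = y ^ n
      0≤P : 0ℚ ≤ P
      0≤P = 0≤^ 0≤y n
      d : 0ℚ ≤ x - y
      d = p≤q⇒0≤q-p y≤x

    ∣^∣≤ : ∀ {x R} → ∣ x ∣ ≤ R → ∀ n → ∣ x ^ n ∣ ≤ R ^ n
    ∣^∣≤ h zero = ≤-refl
    ∣^∣≤ {x} {R} h (suc n) = subst (_≤ R ^ suc n) (sym (∣p*q∣≡∣p∣*∣q∣ x (x ^ n)))
      (*-mono-≤ (≤-trans (0≤∣p∣ x) h) (0≤∣p∣ (x ^ n)) h (∣^∣≤ h n))

    -- The mean value bound with Rⁿ instead of Rⁿ⁻¹, which is where 1 ≤ R enters.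
    ^-lipschitz : ∀ {x y R} → ∣ x ∣ ≤ R → ∣ y ∣ ≤ R → 1ℚ ≤ R → ∀ n →
      ∣ x ^ n - y ^ n ∣ ≤ ι n * R ^ n * ∣ x - y ∣
    ^-lipschitz {x} {y} {R} hx hy 1≤R zero = ≤-reflexive (sym (solve 1 (λ z → con 0ℚ :* con 1ℚ :* z := con 0ℚ) refl ∣ x - y ∣))
    ^-lipschitz {x} {y} {R} hx hy 1≤R (suc n) = begin
      ∣ x * x ^ n - y * y ^ n ∣
        ≡⟨ cong ∣_∣ (solve 4 (λ x y X Y → x :* X :- y :* Y := x :* (X :- Y) :+ (x :- y) :* Y) refl x y (x ^ n) (y ^ n)) ⟩
      ∣ x * (x ^ n - y ^ n) + (x - y) * y ^ n ∣
        ≤⟨ ∣p+q∣≤∣p∣+∣q∣ (x * (x ^ n - y ^ n)) ((x - y) * y ^ n) ⟩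
      ∣ x * (x ^ n - y ^ n) ∣ + ∣ (x - y) * y ^ n ∣
        ≡⟨ cong₂ _+_ (∣p*q∣≡∣p∣*∣q∣ x (x ^ n - y ^ n)) (∣p*q∣≡∣p∣*∣q∣ (x - y) (y ^ n)) ⟩
      ∣ x ∣ * ∣ x ^ n - y ^ n ∣ + ∣ x - y ∣ * ∣ y ^ n ∣
        ≤⟨ +-mono-≤ (*-mono-≤ 0≤R (0≤∣p∣ (x ^ n - y ^ n)) hx (^-lipschitz hx hy 1≤R n))
                    (*-monoˡ-≤ (0≤∣p∣ (x - y)) (≤-trans (∣^∣≤ hy n) R^n≤)) ⟩
      R * (ι n * R ^ n * ∣ x - y ∣) + ∣ x - y ∣ * (R * R ^ n)
        ≡⟨ solve 4 (λ R k P d → R :* (k :* P :* d) :+ d :* (R :* P) := (con 1ℚ :+ k) :* (R :* P) :* d) refl R (ι n) (R ^ n) ∣ x - y ∣ ⟩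
      (1ℚ + ι n) * (R * R ^ n) * ∣ x - y ∣
        ≡⟨ cong (λ z → z * (R * R ^ n) * ∣ x - y ∣) (sym (ι-suc n)) ⟩
      ι (suc n) * (R * R ^ n) * ∣ x - y ∣ ∎
      where
      open ≤-Reasoning
      0≤R : 0ℚ ≤ R
      0≤R = ≤-trans 0≤1 1≤R
      R^n≤ : R ^ n ≤ R * R ^ n
      R^n≤ = subst (_≤ R * R ^ n) (*-identityˡ (R ^ n)) (*-monoʳ-≤ (0≤^ 0≤R n) 1≤R)

-- Finite sums over lists and indicator functions

module ListSum where

  open import Data.Bool using (Bool; true; false; _∧_)
  open import Data.Nat
  open import Data.Nat.Properties
  open import Data.Nat.ListAction using (sum)
  open import Data.List using (List; []; _∷_; _++_; map; filter; length)
  open import Data.List.Membership.Propositional using (_∈_)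
  open import Data.List.Relation.Unary.Any using (here; there)
  open import Data.List.Relation.Binary.Permutation.Propositional using (_↭_; refl; prep; swap; trans)
  open import Algebra.Properties.CommutativeSemigroup +-commutativeSemigroup using (interchange; x∙yz≈y∙xz)
  open import Relation.Binary.PropositionalEquality hiding (trans)
  open import Relation.Nullary.Decidable using (does; _because_)
  open import Relation.Unary using (Pred; Decidable)
  open import Level using (0ℓ)
  open import Function using (_∘_)

  𝟙 : Bool → ℕ
  𝟙 true  = 1
  𝟙 false = 0

  Σ : {A : Set} → List A → (A → ℕ) → ℕ
  Σ []       φ = 0
  Σ (x ∷ xs) φ = φ x + Σ xs φ

  module _ {A : Set} where

    Σ-cong : ∀ {φ ψ : A → ℕ} xs → (∀ {x} → x ∈ xs → φ x ≡ ψ x) → Σ xs φ ≡ Σ xs ψ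
    Σ-cong []       h = refl
    Σ-cong (x ∷ xs) h = cong₂ _+_ (h (here refl)) (Σ-cong xs (h ∘ there))

    Σ-mono : ∀ {φ ψ : A → ℕ} xs → (∀ {x} → x ∈ xs → φ x ≤ ψ x) → Σ xs φ ≤ Σ xs ψ
    Σ-mono []       h = z≤n
    Σ-mono (x ∷ xs) h = +-mono-≤ (h (here refl)) (Σ-mono xs (h ∘ there))

    Σ-+ : ∀ (φ ψ : A → ℕ) xs → Σ xs (λ x → φ x + ψ x) ≡ Σ xs φ + Σ xs ψ
    Σ-+ φ ψ []       = refl
    Σ-+ φ ψ (x ∷ xs) = begin
      φ x + ψ x + Σ xs (λ x → φ x + ψ x)   ≡⟨ cong (φ x + ψ x +_) (Σ-+ φ ψ xs) ⟩
      φ x + ψ x + (Σ xs φ + Σ xs ψ)        ≡⟨ interchange (φ x) (ψ x) (Σ xs φ) (Σ xs ψ) ⟩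
      φ x + Σ xs φ + (ψ x + Σ xs ψ)        ∎
      where open ≡-Reasoning

    Σ-const : ∀ k (xs : List A) → Σ xs (λ _ → k) ≡ length xs * k
    Σ-const k []       = refl
    Σ-const k (x ∷ xs) = cong (k +_) (Σ-const k xs)

    Σ-zero : ∀ {φ : A → ℕ} xs → (∀ {x} → x ∈ xs → φ x ≡ 0) → Σ xs φ ≡ 0
    Σ-zero []       h = refl
    Σ-zero (x ∷ xs) h = cong₂ _+_ (h (here refl)) (Σ-zero xs (h ∘ there))

    Σ-*ˡ : ∀ k (φ : A → ℕ) xs → Σ xs (λ x → k * φ x) ≡ k * Σ xs φ
    Σ-*ˡ k φ []       = sym (*-zeroʳ k)
    Σ-*ˡ k φ (x ∷ xs) = begin
      k * φ x + Σ xs (λ x → k * φ x)   ≡⟨ cong (k * φ x +_) (Σ-*ˡ k φ xs) ⟩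
      k * φ x + k * Σ xs φ             ≡⟨ *-distribˡ-+ k (φ x) (Σ xs φ) ⟨
      k * (φ x + Σ xs φ)               ∎
      where open ≡-Reasoning

    Σ-*ʳ : ∀ k (φ : A → ℕ) xs → Σ xs (λ x → φ x * k) ≡ Σ xs φ * k
    Σ-*ʳ k φ []       = refl
    Σ-*ʳ k φ (x ∷ xs) = begin
      φ x * k + Σ xs (λ x → φ x * k)   ≡⟨ cong (φ x * k +_) (Σ-*ʳ k φ xs) ⟩
      φ x * k + Σ xs φ * k             ≡⟨ *-distribʳ-+ k (φ x) (Σ xs φ) ⟨
      (φ x + Σ xs φ) * k               ∎
      where open ≡-Reasoning

    Σ-++ : ∀ (φ : A → ℕ) xs ys → Σ (xs ++ ys) φ ≡ Σ xs φ + Σ ys φ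
    Σ-++ φ []       ys = refl
    Σ-++ φ (x ∷ xs) ys rewrite Σ-++ φ xs ys = sym (+-assoc (φ x) (Σ xs φ) (Σ ys φ))

    Σ-map : ∀ {B : Set} (φ : B → ℕ) (f : A → B) xs → Σ (map f xs) φ ≡ Σ xs (φ ∘ f)
    Σ-map φ f []       = refl
    Σ-map φ f (x ∷ xs) = cong (φ (f x) +_) (Σ-map φ f xs)

    Σ-filter : ∀ {P : Pred A 0ℓ} (P? : Decidable P) φ xs →
      Σ (filter P? xs) φ ≡ Σ xs (λ x → 𝟙 (does (P? x)) * φ x)
    Σ-filter P? φ []       = refl
    Σ-filter P? φ (x ∷ xs) with P? x
    ... | true  because _ = cong₂ _+_ (sym (+-identityʳ (φ x))) (Σ-filter P? φ xs)
    ... | false because _ = Σ-filter P? φ xs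

    length-filter≡Σ : ∀ {P : Pred A 0ℓ} (P? : Decidable P) xs →
      length (filter P? xs) ≡ Σ xs (λ x → 𝟙 (does (P? x)))
    length-filter≡Σ P? []       = refl
    length-filter≡Σ P? (x ∷ xs) with P? x
    ... | true  because _ = cong suc (length-filter≡Σ P? xs)
    ... | false because _ = length-filter≡Σ P? xs

    sum-map≡Σ : ∀ (φ : A → ℕ) xs → sum (map φ xs) ≡ Σ xs φ
    sum-map≡Σ φ []       = refl
    sum-map≡Σ φ (x ∷ xs) = cong (φ x +_) (sum-map≡Σ φ xs)

    Σ-↭ : ∀ (φ : A → ℕ) {xs ys} → xs ↭ ys → Σ xs φ ≡ Σ ys φ
    Σ-↭ φ refl         = refl
    Σ-↭ φ (prep x p)   = cong (φ x +_) (Σ-↭ φ p)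
    Σ-↭ φ (swap x y p) rewrite Σ-↭ φ p = x∙yz≈y∙xz (φ x) (φ y) _
    Σ-↭ φ (trans p p′) = ≡.trans (Σ-↭ φ p) (Σ-↭ φ p′)
      where import Relation.Binary.PropositionalEquality as ≡

  Σ-swap : ∀ {A B : Set} (φ : A → B → ℕ) xs ys →
    Σ xs (λ x → Σ ys (φ x)) ≡ Σ ys (λ y → Σ xs (λ x → φ x y))
  Σ-swap φ []       ys = sym (Σ-zero ys (λ _ → refl))
  Σ-swap φ (x ∷ xs) ys rewrite Σ-swap φ xs ys = sym (Σ-+ (φ x) (λ y → Σ xs (λ x → φ x y)) ys)

  𝟙-∧ : ∀ b c → 𝟙 (b ∧ c) ≡ 𝟙 b * 𝟙 c
  𝟙-∧ true  true  = refl
  𝟙-∧ true  false = refl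
  𝟙-∧ false c     = refl

  𝟙≤1 : ∀ b → 𝟙 b ≤ 1
  𝟙≤1 true  = ≤-refl
  𝟙≤1 false = z≤n

-- The product measure on sublists: variance, correlation and basic events

module Bernoulli {A : Set} (p : ℚ.ℚ) (0≤p : ℚ.0ℚ ℚ.≤ p) (p≤1 : p ℚ.≤ ℚ.1ℚ) where

  open import Data.Rational using (ℚ; 0ℚ; 1ℚ; _≤_)
  open import Data.Nat as ℕ using (ℕ; suc)
  import Data.Nat.Properties as ℕₚ
  open import Data.Rational using (_+_; _*_; _-_; -_; ∣_∣)
  open import Data.Rational.Properties
  open import Data.Rational.Solver using (module +-*-Solver)
  open +-*-Solver
  open import Data.Bool using (Bool; true; false; _∧_; _∨_)
  open import Data.Bool.ListAction using (any; all)
  open import Data.List using (List; []; _∷_; _++_; length; map; foldr)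
  open import Data.List.Membership.Propositional using (_∈_)
  open import Data.List.Relation.Unary.Any using (here; there)
  open import Data.List.Relation.Binary.Sublist.Propositional using (_⊆_; []; _∷_; _∷ʳ_; ⊆-refl)
  open import Relation.Binary.PropositionalEquality
  open import Function using (_∘_)
  open Rational
  open ListSum

  q : ℚ
  q = 1ℚ - p

  0≤q : 0ℚ ≤ q
  0≤q = p≤q⇒0≤q-p p≤1

  q≤1 : q ≤ 1ℚ
  q≤1 = ≤-by p 0≤p (solve 1 (λ p → con 1ℚ := con 1ℚ :- p :+ p) refl p)

  -- The expectation of X over a random sublist of D that keeps each entry
  -- independently with probability p.
  E : List A → (List A → ℚ) → ℚ
  E []      X = X []
  E (b ∷ D) X = p * E D (X ∘ (b ∷_)) + q * E D X

  E-mono : ∀ D {X Y} → (∀ {S} → S ⊆ D → X S ≤ Y S) → E D X ≤ E D Y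
  E-mono []      h = h []
  E-mono (b ∷ D) h = +-mono-≤
    (*-monoˡ-≤ 0≤p (E-mono D (λ S⊆D → h (refl ∷ S⊆D))))
    (*-monoˡ-≤ 0≤q (E-mono D (λ S⊆D → h (b ∷ʳ S⊆D))))

  E-cong : ∀ D {X Y} → (∀ {S} → S ⊆ D → X S ≡ Y S) → E D X ≡ E D Y
  E-cong D h = ≤-antisym (E-mono D (≤-reflexive ∘ h)) (E-mono D (≤-reflexive ∘ sym ∘ h))

  E-const : ∀ D k → E D (λ _ → k) ≡ k
  E-const []      k = refl
  E-const (b ∷ D) k rewrite E-const D k = solve 2 (λ p k → p :* k :+ (con 1ℚ :- p) :* k := k) refl p k

  E-+ : ∀ D X Y → E D (λ S → X S + Y S) ≡ E D X + E D Y
  E-+ []      X Y = refl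
  E-+ (b ∷ D) X Y rewrite E-+ D (X ∘ (b ∷_)) (Y ∘ (b ∷_)) | E-+ D X Y =
    solve 5 (λ p x₁ y₁ x₀ y₀ → p :* (x₁ :+ y₁) :+ (con 1ℚ :- p) :* (x₀ :+ y₀) := p :* x₁ :+ (con 1ℚ :- p) :* x₀ :+ (p :* y₁ :+ (con 1ℚ :- p) :* y₀)) refl
      p (E D (X ∘ (b ∷_))) (E D (Y ∘ (b ∷_))) (E D X) (E D Y)

  E-*ˡ : ∀ D k X → E D (λ S → k * X S) ≡ k * E D X
  E-*ˡ []      k X = refl
  E-*ˡ (b ∷ D) k X rewrite E-*ˡ D k (X ∘ (b ∷_)) | E-*ˡ D k X =
    solve 4 (λ p k x₁ x₀ → p :* (k :* x₁) :+ (con 1ℚ :- p) :* (k :* x₀) := k :* (p :* x₁ :+ (con 1ℚ :- p) :* x₀)) refl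
      p k (E D (X ∘ (b ∷_))) (E D X)

  E-Σ : ∀ {B : Set} D c (φ : B → List A → ℕ) xs →
    (∀ {x} → x ∈ xs → c ≤ E D (λ S → ι (φ x S))) →
    ι (length xs) * c ≤ E D (λ S → ι (Σ xs (λ x → φ x S)))
  E-Σ D c φ []       h = ≤-reflexive (trans (*-zeroˡ c) (sym (E-const D 0ℚ)))
  E-Σ D c φ (x ∷ xs) h = begin
    ι (suc (length xs)) * c
      ≡⟨ cong (_* c) (ι-suc (length xs)) ⟩
    (1ℚ + ι (length xs)) * c
      ≡⟨ solve 2 (λ l c → (con 1ℚ :+ l) :* c := c :+ l :* c) refl (ι (length xs)) c ⟩
    c + ι (length xs) * c
      ≤⟨ +-mono-≤ (h (here refl)) (E-Σ D c φ xs (h ∘ there)) ⟩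
    E D (λ S → ι (φ x S)) + E D (λ S → ι (Σ xs (λ x → φ x S)))
      ≡⟨ E-+ D (λ S → ι (φ x S)) (λ S → ι (Σ xs (λ x → φ x S))) ⟨
    E D (λ S → ι (φ x S) + ι (Σ xs (λ x → φ x S)))
      ≡⟨ E-cong D (λ {S} _ → sym (ι-+ (φ x S) (Σ xs (λ x → φ x S)))) ⟩
    E D (λ S → ι (φ x S ℕ.+ Σ xs (λ x → φ x S))) ∎
    where open ≤-Reasoning

  -- Law of total variance: conditioning on the first entry b leaves the average of the two
  -- conditional variances plus p q (x₁ - x₀)², and ∣x₁ - x₀∣ ≤ L. Of the factor p q only q is
  -- estimated by 1. Differences are bounded for arbitrary prefixes S₁ because in the recursive call
  -- the entries already decided form the prefix.
  efron-stein : ∀ D X {L} →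
    (∀ {b} → b ∈ D → ∀ S₁ S₂ → ∣ X (S₁ ++ b ∷ S₂) - X (S₁ ++ S₂) ∣ ≤ L) →
    E D (λ S → X S * X S) ≤ E D X * E D X + ι (length D) * (p * (L * L))
  efron-stein [] X {L} h = ≤-reflexive (solve 2 (λ x l → x := x :+ con 0ℚ :* l) refl (X [] * X []) (p * (L * L)))
  efron-stein (b ∷ D) X {L} h = begin
    p * E D (λ S → X₁ S * X₁ S) + q * E D (λ S → X S * X S)
      ≤⟨ +-mono-≤ (*-monoˡ-≤ 0≤p (efron-stein D X₁ (λ c∈D S₁ → h (there c∈D) (b ∷ S₁))))
                  (*-monoˡ-≤ 0≤q (efron-stein D X (h ∘ there))) ⟩
    p * (x₁ * x₁ + ι (length D) * V) + q * (x₀ * x₀ + ι (length D) * V)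
      ≡⟨ solve 5 (λ p x₁ x₀ l V → p :* (x₁ :* x₁ :+ l :* V) :+ (con 1ℚ :- p) :* (x₀ :* x₀ :+ l :* V) := (p :* x₁ :+ (con 1ℚ :- p) :* x₀) :* (p :* x₁ :+ (con 1ℚ :- p) :* x₀) :+ l :* V :+ (con 1ℚ :- p) :* (p :* ((x₁ :- x₀) :* (x₁ :- x₀)))) refl
           p x₁ x₀ (ι (length D)) V ⟩
    μ * μ + ι (length D) * V + q * (p * ((x₁ - x₀) * (x₁ - x₀)))
      ≤⟨ +-monoʳ-≤ (μ * μ + ι (length D) * V)
           (≤-trans (*-monoʳ-≤ (0≤* 0≤p (0≤p² (x₁ - x₀))) q≤1)
                    (*-monoˡ-≤ 0≤1 (*-monoˡ-≤ 0≤p (∣p∣≤q⇒p²≤q² (∣p∣≤q {x₁ - x₀} up down))))) ⟩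
    μ * μ + ι (length D) * V + 1ℚ * V
      ≡⟨ solve 3 (λ m l V → m :+ l :* V :+ con 1ℚ :* V := m :+ (con 1ℚ :+ l) :* V) refl (μ * μ) (ι (length D)) V ⟩
    μ * μ + (1ℚ + ι (length D)) * V
      ≡⟨ cong (λ z → μ * μ + z * V) (sym (ι-suc (length D))) ⟩
    μ * μ + ι (suc (length D)) * V ∎
    where
    open ≤-Reasoning
    X₁ : List A → ℚ
    X₁ = X ∘ (b ∷_)
    x₁ x₀ μ V : ℚ
    x₁ = E D X₁
    x₀ = E D X
    μ = p * x₁ + q * x₀
    V = p * (L * L)
    diff : ∀ S → ∣ X₁ S - X S ∣ ≤ L
    diff S = h (here refl) [] S
    shifted : ∀ Y → (∀ S → Y S ≤ L) → E D Y ≤ L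
    shifted Y Y≤L = subst (E D Y ≤_) (E-const D L) (E-mono D (λ {S} _ → Y≤L S))
    E-diff : E D (λ S → X₁ S + (- 1ℚ) * X S) ≡ x₁ + (- 1ℚ) * x₀
    E-diff = trans (E-+ D X₁ (λ S → (- 1ℚ) * X S)) (cong (x₁ +_) (E-*ˡ D (- 1ℚ) X))
    E-diff′ : E D (λ S → X S + (- 1ℚ) * X₁ S) ≡ x₀ + (- 1ℚ) * x₁
    E-diff′ = trans (E-+ D X (λ S → (- 1ℚ) * X₁ S)) (cong (x₀ +_) (E-*ˡ D (- 1ℚ) X₁))
    up : x₁ - x₀ ≤ L
    up = subst (_≤ L) (trans E-diff (solve 2 (λ x y → x :+ (:- con 1ℚ) :* y := x :- y) refl x₁ x₀))
      (shifted _ (λ S → subst (_≤ L) (solve 2 (λ x y → x :- y := x :+ (:- con 1ℚ) :* y) refl (X₁ S) (X S))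
        (≤-trans (p≤∣p∣ (X₁ S - X S)) (diff S))))
    down : - (x₁ - x₀) ≤ L
    down = subst (_≤ L) (trans E-diff′ (solve 2 (λ x y → y :+ (:- con 1ℚ) :* x := :- (x :- y)) refl x₁ x₀))
      (shifted _ (λ S → subst (_≤ L) (solve 2 (λ x y → :- (x :- y) := y :+ (:- con 1ℚ) :* x) refl (X₁ S) (X S))
        (≤-trans (-p≤∣p∣ (X₁ S - X S)) (diff S))))

  -- Markov's inequality for (μ - X)²: on the event X ≤ C ≤ μ this square is at least (μ - C)², and
  -- elsewhere it is at least 0. The bound stays multiplied out, so C = μ is allowed.
  chebyshev : ∀ D X {L} C (B : List A → Bool) →
    (∀ {b} → b ∈ D → ∀ S₁ S₂ → ∣ X (S₁ ++ b ∷ S₂) - X (S₁ ++ S₂) ∣ ≤ L) →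
    (∀ {S} → S ⊆ D → B S ≡ true → X S ≤ C) → C ≤ E D X →
    (E D X - C) * (E D X - C) * E D (ι ∘ 𝟙 ∘ B) ≤ ι (length D) * (p * (L * L))
  chebyshev D X {L} C B bd below C≤μ = begin
    (μ - C) * (μ - C) * E D (ι ∘ 𝟙 ∘ B)
      ≡⟨ E-*ˡ D ((μ - C) * (μ - C)) (ι ∘ 𝟙 ∘ B) ⟨
    E D (λ S → (μ - C) * (μ - C) * ι (𝟙 (B S)))
      ≤⟨ E-mono D pointwise ⟩
    E D (λ S → X S * X S + (- (μ + μ) * X S + μ * μ))
      ≡⟨ E-+ D (λ S → X S * X S) (λ S → - (μ + μ) * X S + μ * μ) ⟩
    E D (λ S → X S * X S) + E D (λ S → - (μ + μ) * X S + μ * μ)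
      ≡⟨ cong (E D (λ S → X S * X S) +_) (trans (E-+ D (λ S → - (μ + μ) * X S) (λ _ → μ * μ))
           (cong₂ _+_ (E-*ˡ D (- (μ + μ)) X) (E-const D (μ * μ)))) ⟩
    E D (λ S → X S * X S) + (- (μ + μ) * μ + μ * μ)
      ≤⟨ +-monoˡ-≤ (- (μ + μ) * μ + μ * μ) (efron-stein D X bd) ⟩
    μ * μ + ι (length D) * (p * (L * L)) + (- (μ + μ) * μ + μ * μ)
      ≡⟨ solve 2 (λ m V → m :* m :+ V :+ (:- (m :+ m) :* m :+ m :* m) := V) refl μ (ι (length D) * (p * (L * L))) ⟩
    ι (length D) * (p * (L * L)) ∎
    where
    open ≤-Reasoning
    μ : ℚ
    μ = E D X
    square : ∀ S → (μ - X S) * (μ - X S) ≡ X S * X S + (- (μ + μ) * X S + μ * μ)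
    square S = solve 2 (λ m x → (m :- x) :* (m :- x) := x :* x :+ (:- (m :+ m) :* x :+ m :* m)) refl μ (X S)
    pointwise : ∀ {S} → S ⊆ D → (μ - C) * (μ - C) * ι (𝟙 (B S)) ≤ X S * X S + (- (μ + μ) * X S + μ * μ)
    pointwise {S} S⊆D with B S in eq
    ... | false = subst₂ _≤_ (sym (*-zeroʳ ((μ - C) * (μ - C)))) (square S) (0≤p² (μ - X S))
    ... | true  = subst₂ _≤_ (sym (*-identityʳ ((μ - C) * (μ - C)))) (square S)
      (*-mono-≤ (≤-trans 0≤μ-C ≤μ-X) 0≤μ-C ≤μ-X ≤μ-X)
      where
      0≤μ-C : 0ℚ ≤ μ - C
      0≤μ-C = p≤q⇒0≤q-p C≤μ
      ≤μ-X : μ - C ≤ μ - X S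
      ≤μ-X = +-monoʳ-≤ μ (neg-antimono-≤ (below S⊆D eq))

  Increasing : (List A → ℚ) → Set
  Increasing X = ∀ {S S′} → S ⊆ S′ → X S ≤ X S′

  -- Conditioning on the first entry splits the covariance into the average of two conditional
  -- covariances, nonnegative by induction, and p q (x₁ - x₀) (y₁ - y₀), where both differences are
  -- nonnegative because inserting b cannot lower an increasing function.
  harris : ∀ D {X Y} → Increasing X → Increasing Y →
    E D X * E D Y ≤ E D (λ S → X S * Y S)
  harris []      incX incY = ≤-refl
  harris (b ∷ D) {X} {Y} incX incY = begin
    (p * x₁ + q * x₀) * (p * y₁ + q * y₀)
      ≤⟨ ≤-by (p * (q * ((x₁ - x₀) * (y₁ - y₀)))) (0≤* 0≤p (0≤* 0≤q (0≤* (p≤q⇒0≤q-p x₀≤x₁) (p≤q⇒0≤q-p y₀≤y₁))))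
           (solve 5 (λ p x₁ x₀ y₁ y₀ → p :* (x₁ :* y₁) :+ (con 1ℚ :- p) :* (x₀ :* y₀) := (p :* x₁ :+ (con 1ℚ :- p) :* x₀) :* (p :* y₁ :+ (con 1ℚ :- p) :* y₀) :+ p :* ((con 1ℚ :- p) :* ((x₁ :- x₀) :* (y₁ :- y₀)))) refl
              p x₁ x₀ y₁ y₀) ⟩
    p * (x₁ * y₁) + q * (x₀ * y₀)
      ≤⟨ +-mono-≤ (*-monoˡ-≤ 0≤p (harris D (λ s → incX (refl ∷ s)) (λ s → incY (refl ∷ s))))
                  (*-monoˡ-≤ 0≤q (harris D incX incY)) ⟩
    p * E D (λ S → X (b ∷ S) * Y (b ∷ S)) + q * E D (λ S → X S * Y S) ∎
    where
    open ≤-Reasoning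
    x₁ x₀ y₁ y₀ : ℚ
    x₁ = E D (X ∘ (b ∷_))
    x₀ = E D X
    y₁ = E D (Y ∘ (b ∷_))
    y₀ = E D Y
    x₀≤x₁ : x₀ ≤ x₁
    x₀≤x₁ = E-mono D (λ _ → incX (b ∷ʳ ⊆-refl))
    y₀≤y₁ : y₀ ≤ y₁
    y₀≤y₁ = E-mono D (λ _ → incY (b ∷ʳ ⊆-refl))

  count : (A → Bool) → List A → ℕ
  count P S = Σ S (𝟙 ∘ P)

  hits : List (A → Bool) → List A → Bool
  hits Ps S = all (λ P → any P S) Ps

  ∨-monoʳ : ∀ b {c d} → 𝟙 c ℕ.≤ 𝟙 d → 𝟙 (b ∨ c) ℕ.≤ 𝟙 (b ∨ d)
  ∨-monoʳ true  h = ℕₚ.≤-refl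
  ∨-monoʳ false h = h

  ∨-increasing : ∀ b c → 𝟙 c ℕ.≤ 𝟙 (b ∨ c)
  ∨-increasing true  c = 𝟙≤1 c
  ∨-increasing false c = ℕₚ.≤-refl

  any-increasing : ∀ (P : A → Bool) {S S′} → S ⊆ S′ → 𝟙 (any P S) ℕ.≤ 𝟙 (any P S′)
  any-increasing P []                     = ℕ.z≤n
  any-increasing P {S′ = b ∷ bs} (.b ∷ʳ s) = ℕₚ.≤-trans (any-increasing P s) (∨-increasing (P b) (any P bs))
  any-increasing P {b ∷ _} (refl ∷ s)      = ∨-monoʳ (P b) (any-increasing P s)

  hits-increasing : ∀ Ps {S S′} → S ⊆ S′ → 𝟙 (hits Ps S) ℕ.≤ 𝟙 (hits Ps S′)
  hits-increasing []       s = ℕₚ.≤-refl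
  hits-increasing (P ∷ Ps) {S} {S′} s
    rewrite 𝟙-∧ (any P S) (hits Ps S) | 𝟙-∧ (any P S′) (hits Ps S′) =
    ℕₚ.*-mono-≤ (any-increasing P s) (hits-increasing Ps s)

  E-any : ∀ P D → E D (λ S → ι (𝟙 (any P S))) ≡ 1ℚ - q ^ count P D
  E-any P [] = refl
  E-any P (b ∷ D) with P b
  ... | true  rewrite E-any P D | E-const D 1ℚ =
    solve 2 (λ p Q → p :* con 1ℚ :+ (con 1ℚ :- p) :* (con 1ℚ :- Q) := con 1ℚ :- (con 1ℚ :- p) :* Q) refl p (q ^ count P D)
  ... | false rewrite E-any P D =
    solve 2 (λ p Q → p :* (con 1ℚ :- Q) :+ (con 1ℚ :- p) :* (con 1ℚ :- Q) := con 1ℚ :- Q) refl p (q ^ count P D)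

  ∏ : List ℚ → ℚ
  ∏ = foldr _*_ 1ℚ

  0≤1-q^ : ∀ k → 0ℚ ≤ 1ℚ - q ^ k
  0≤1-q^ k = p≤q⇒0≤q-p (^≤1 0≤q q≤1 k)

  -- With Harris' inequality in the role of independence the predicates may overlap; the entries
  -- that they select need not be shown to be disjoint.
  E-hits : ∀ Ps D → ∏ (map (λ P → 1ℚ - q ^ count P D) Ps) ≤ E D (λ S → ι (𝟙 (hits Ps S)))
  E-hits []       D = ≤-reflexive (sym (E-const D 1ℚ))
  E-hits (P ∷ Ps) D = begin
    (1ℚ - q ^ count P D) * ∏ (map (λ P → 1ℚ - q ^ count P D) Ps)
      ≤⟨ *-monoˡ-≤ (0≤1-q^ (count P D)) (E-hits Ps D) ⟩
    (1ℚ - q ^ count P D) * E D (λ S → ι (𝟙 (hits Ps S)))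
      ≡⟨ cong (_* E D (λ S → ι (𝟙 (hits Ps S)))) (E-any P D) ⟨
    E D (λ S → ι (𝟙 (any P S))) * E D (λ S → ι (𝟙 (hits Ps S)))
      ≤⟨ harris D (ι-mono ∘ any-increasing P) (ι-mono ∘ hits-increasing Ps) ⟩
    E D (λ S → ι (𝟙 (any P S)) * ι (𝟙 (hits Ps S)))
      ≡⟨ E-cong D (λ {S} _ → trans (sym (ι-* (𝟙 (any P S)) (𝟙 (hits Ps S))))
           (cong ι (sym (𝟙-∧ (any P S) (hits Ps S))))) ⟩
    E D (λ S → ι (𝟙 (any P S ∧ hits Ps S))) ∎
    where open ≤-Reasoning

  -- Stated with `<ᵇ 1` since `suc m ≤ᵇ 1` computes to `m <ᵇ 1`, the event that remains in `E-few`
  -- once one entry has been found.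
  E-none : ∀ P D → E D (λ S → ι (𝟙 (count P S ℕ.<ᵇ 1))) ≡ q ^ count P D
  E-none P [] = refl
  E-none P (b ∷ D) with P b
  ... | true  rewrite E-none P D | E-const D 0ℚ =
    solve 2 (λ p Q → p :* con 0ℚ :+ (con 1ℚ :- p) :* Q := (con 1ℚ :- p) :* Q) refl p (q ^ count P D)
  ... | false rewrite E-none P D = solve 2 (λ p Q → p :* Q :+ (con 1ℚ :- p) :* Q := Q) refl p (q ^ count P D)

  -- For k selected entries the exact value is qᵏ + k p qᵏ⁻¹. Replacing qᵏ⁻¹ by qᵏ avoids a
  -- predecessor and changes the value only by a factor q in the second term.
  E-few : ∀ P D → q ^ count P D * (1ℚ + ι (count P D) * p) ≤ E D (λ S → ι (𝟙 (count P S ℕ.≤ᵇ 1)))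
  E-few P [] = ≤-reflexive (solve 1 (λ p → con 1ℚ :* (con 1ℚ :+ con 0ℚ :* p) := con 1ℚ) refl p)
  E-few P (b ∷ D) with P b
  ... | false = ≤-trans (E-few P D) (≤-reflexive (solve 2 (λ p Q → Q := p :* Q :+ (con 1ℚ :- p) :* Q) refl p (E D (λ S → ι (𝟙 (count P S ℕ.≤ᵇ 1))))))
  ... | true  = begin
    q * Q * (1ℚ + ι (suc k) * p)
      ≡⟨ cong (λ z → q * Q * (1ℚ + z * p)) (ι-suc k) ⟩
    q * Q * (1ℚ + (1ℚ + ι k) * p)
      ≤⟨ ≤-by (p * p * Q) (0≤* (0≤p² p) (0≤^ 0≤q k))
           (solve 3 (λ p Q k → p :* Q :+ (con 1ℚ :- p) :* (Q :* (con 1ℚ :+ k :* p)) := (con 1ℚ :- p) :* Q :* (con 1ℚ :+ (con 1ℚ :+ k) :* p) :+ p :* p :* Q) refl p Q (ι k)) ⟩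
    p * Q + q * (Q * (1ℚ + ι k * p))
      ≤⟨ +-mono-≤ (≤-reflexive (cong (p *_) (sym (E-none P D)))) (*-monoˡ-≤ 0≤q (E-few P D)) ⟩
    p * E D (λ S → ι (𝟙 (count P S ℕ.<ᵇ 1))) + q * E D (λ S → ι (𝟙 (count P S ℕ.≤ᵇ 1))) ∎
    where
    open ≤-Reasoning
    k : ℕ
    k = count P D
    Q : ℚ
    Q = q ^ k

-- The functional W on an abstract incidence structure

module Incidence {A B : Set} (inc : A → B → Bool.Bool) (T : List.List A) where

  open import Data.Bool using (Bool; true; false; _∧_; _∨_; not)
  open import Data.List using (List; []; _∷_; _++_; length; map; filterᵇ; upTo; applyUpTo)
  open import Data.Bool.ListAction using (any; all)
  open import Data.Nat
  open import Data.Nat.Properties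
  open import Data.List.Properties using (map-upTo)
  open import Data.List.Membership.Propositional using (_∈_)
  open import Data.List.Membership.Propositional.Properties using (∈-map⁺)
  open import Data.List.Relation.Unary.Any using (here; there)
  open import Data.List.Relation.Unary.All as All using ()
  open import Data.List.Relation.Unary.AllPairs using (_∷_)
  open import Data.List.Relation.Unary.Unique.Propositional using (Unique)
  open import Data.List.Relation.Binary.Sublist.Propositional using (_⊆_; []; _∷_; _∷ʳ_; lookup)
  open import Data.List.Relation.Binary.Permutation.Propositional using (_↭_)
  open import Data.List.Relation.Binary.Permutation.Propositional.Properties using (shift)
  open import Data.Sum using (_⊎_; inj₁; inj₂)
  open import Data.Empty using (⊥)
  open import Relation.Nullary.Decidable using (does; yes; no; dec-true; dec-false)
  open import Relation.Binary.Definitions using (DecidableEquality)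
  open import Relation.Binary.PropositionalEquality
  open import Function using (_∘_)
  open ListSum

  deg : List B → A → ℕ
  deg S τ = Σ S (λ σ → 𝟙 (inc τ σ))

  free : List B → B → ℕ
  free S σ = Σ T (λ τ → 𝟙 (inc τ σ ∧ (deg S τ ≡ᵇ 1)))

  faces : B → ℕ
  faces σ = Σ T (λ τ → 𝟙 (inc τ σ))

  -- This is v(Y) + binom(n, d), rewritten so that f_d(Y) cancels.
  W : List B → ℕ
  W S = Σ T (λ τ → 𝟙 (deg S τ ≤ᵇ 1)) + Σ S (λ σ → 𝟙 (free S σ ≡ᵇ 0))

  private
    ≢⇒≡ᵇ≡false : ∀ {m n} → m ≢ n → (m ≡ᵇ n) ≡ false
    ≢⇒≡ᵇ≡false {m} {n} = dec-false (m ≟ n)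

    ≡ᵇ-refl : ∀ n → (n ≡ᵇ n) ≡ true
    ≡ᵇ-refl n = dec-true (n ≟ n) refl

    Σ-applyUpTo : ∀ (φ : ℕ → ℕ) f n → Σ (applyUpTo f n) φ ≡ Σ (upTo n) (φ ∘ f)
    Σ-applyUpTo φ f n = trans (cong (λ xs → Σ xs φ) (sym (map-upTo f n))) (Σ-map φ f (upTo n))

    window-empty : ∀ d {k} → suc d < k → Σ (upTo (suc d)) (λ j → 𝟙 (k ≡ᵇ suc d ∸ j) * (d ∸ j)) ≡ 0
    window-empty d {k} d<k = Σ-zero (upTo (suc d)) (λ {j} _ →
      cong (λ b → 𝟙 b * (d ∸ j)) (≢⇒≡ᵇ≡false {k} (λ k≡ → <⇒≱ d<k (≤-trans (≤-reflexive k≡) (m∸n≤m (suc d) j)))))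

    -- Only j = d + 1 - k can contribute, with weight d - j = k - 1. For k = 0 this index lies
    -- beyond the range and the sum is 0, in agreement with truncated subtraction.
    window : ∀ d {k} → k ≤ suc d → Σ (upTo (suc d)) (λ j → 𝟙 (k ≡ᵇ suc d ∸ j) * (d ∸ j)) ≡ k ∸ 1
    window zero    {zero}        k≤ = refl
    window zero    {suc zero}    k≤ = refl
    window zero    {suc (suc k)} (s≤s ())
    window (suc d) {k} k≤ = trans
      (cong (𝟙 (k ≡ᵇ suc (suc d)) * suc d +_) (Σ-applyUpTo (λ j → 𝟙 (k ≡ᵇ suc (suc d) ∸ j) * (suc d ∸ j)) suc (suc d)))
      (split (m≤n⇒m<n∨m≡n k≤))
      where
      split : ∀ {k} → k < suc (suc d) ⊎ k ≡ suc (suc d) →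
        𝟙 (k ≡ᵇ suc (suc d)) * suc d + Σ (upTo (suc d)) (λ j → 𝟙 (k ≡ᵇ suc d ∸ j) * (d ∸ j)) ≡ k ∸ 1
      split {k} (inj₁ k<) = cong₂ _+_ (cong (λ b → 𝟙 b * suc d) (≢⇒≡ᵇ≡false (<⇒≢ k<))) (window d (s≤s⁻¹ k<))
      split (inj₂ refl)   = trans (cong₂ _+_ (cong (λ b → 𝟙 b * suc d) (≡ᵇ-refl (suc (suc d)))) (window-empty d ≤-refl))
        (trans (+-identityʳ (1 * suc d)) (*-identityˡ (suc d)))

    𝟙[1]*≡ : ∀ c → 𝟙 (c ≡ᵇ 1) * c ≡ 𝟙 (c ≡ᵇ 1)
    𝟙[1]*≡ 0             = refl
    𝟙[1]*≡ 1             = refl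
    𝟙[1]*≡ (suc (suc c)) = refl

    𝟙[0]+𝟙[1] : ∀ c → 𝟙 (c ≡ᵇ 0) + 𝟙 (c ≡ᵇ 1) ≡ 𝟙 (c ≤ᵇ 1)
    𝟙[0]+𝟙[1] 0             = refl
    𝟙[0]+𝟙[1] 1             = refl
    𝟙[0]+𝟙[1] (suc (suc c)) = refl

    -- The source of the simplices without free faces in `W`: truncation makes k ∸ 1 too large by
    -- one exactly at k = 0.
    1+[k∸1] : ∀ k → 1 + (k ∸ 1) ≡ k + 𝟙 (k ≡ᵇ 0)
    1+[k∸1] zero    = refl
    1+[k∸1] (suc k) = cong suc (sym (+-identityʳ k))

    Σ-inc-∧ : ∀ S τ b → Σ S (λ σ → 𝟙 (inc τ σ ∧ b)) ≡ 𝟙 b * deg S τ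
    Σ-inc-∧ S τ b = begin
      Σ S (λ σ → 𝟙 (inc τ σ ∧ b))     ≡⟨ Σ-cong S (λ {σ} _ → 𝟙-∧ (inc τ σ) b) ⟩
      Σ S (λ σ → 𝟙 (inc τ σ) * 𝟙 b)   ≡⟨ Σ-*ʳ (𝟙 b) (λ σ → 𝟙 (inc τ σ)) S ⟩
      deg S τ * 𝟙 b                   ≡⟨ *-comm (deg S τ) (𝟙 b) ⟩
      𝟙 b * deg S τ                   ∎
      where open ≡-Reasoning

    -- Double counting of incidences: a τ of degree 1 is a free face of exactly one σ, and no other
    -- τ is a free face of any.
    Σ-free : ∀ S → Σ S (free S) ≡ Σ T (λ τ → 𝟙 (deg S τ ≡ᵇ 1))
    Σ-free S = trans (Σ-swap (λ σ τ → 𝟙 (inc τ σ ∧ (deg S τ ≡ᵇ 1))) S T)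
      (Σ-cong T (λ {τ} _ → trans (Σ-inc-∧ S τ (deg S τ ≡ᵇ 1)) (𝟙[1]*≡ (deg S τ))))

    free≤faces : ∀ S σ → free S σ ≤ faces σ
    free≤faces S σ = Σ-mono T (λ {τ} _ → helper (inc τ σ) (deg S τ ≡ᵇ 1))
      where
      helper : ∀ b c → 𝟙 (b ∧ c) ≤ 𝟙 b
      helper true  c = 𝟙≤1 c
      helper false c = z≤n

  -- Summing the contributions j ↦ d - j groups the σ by the number k of their free
  -- faces, each contributing k ∸ 1; the free faces cancel against the τ of degree 1.
  W-formula : ∀ d S → (∀ {σ} → σ ∈ S → faces σ ≤ suc d) →
    length S + Σ T (λ τ → 𝟙 (deg S τ ≡ᵇ 0))
      + Σ (upTo (suc d)) (λ j → Σ S (λ σ → 𝟙 (free S σ ≡ᵇ suc d ∸ j)) * (d ∸ j))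
    ≡ W S
  W-formula d S bound = begin
    length S + T₀ + Σ (upTo (suc d)) (λ j → Σ S (λ σ → 𝟙 (free S σ ≡ᵇ suc d ∸ j)) * (d ∸ j))
      ≡⟨ cong (length S + T₀ +_) (Σ-cong (upTo (suc d)) (λ {j} _ → sym (Σ-*ʳ (d ∸ j) (λ σ → 𝟙 (free S σ ≡ᵇ suc d ∸ j)) S))) ⟩
    length S + T₀ + Σ (upTo (suc d)) (λ j → Σ S (λ σ → 𝟙 (free S σ ≡ᵇ suc d ∸ j) * (d ∸ j)))
      ≡⟨ cong (length S + T₀ +_) (Σ-swap (λ j σ → 𝟙 (free S σ ≡ᵇ suc d ∸ j) * (d ∸ j)) (upTo (suc d)) S) ⟩
    length S + T₀ + Σ S (λ σ → Σ (upTo (suc d)) (λ j → 𝟙 (free S σ ≡ᵇ suc d ∸ j) * (d ∸ j)))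
      ≡⟨ cong (length S + T₀ +_) (Σ-cong S (λ {σ} σ∈S → window d (≤-trans (free≤faces S σ) (bound σ∈S)))) ⟩
    length S + T₀ + Σ S (λ σ → free S σ ∸ 1)
      ≡⟨ cong (_+ Σ S (λ σ → free S σ ∸ 1)) (trans (+-comm (length S) T₀) (cong (T₀ +_) (sym (trans (Σ-const 1 S) (*-identityʳ (length S)))))) ⟩
    T₀ + Σ S (λ σ → 1) + Σ S (λ σ → free S σ ∸ 1)
      ≡⟨ trans (+-assoc T₀ (Σ S (λ σ → 1)) (Σ S (λ σ → free S σ ∸ 1))) (cong (T₀ +_) (sym (Σ-+ (λ σ → 1) (λ σ → free S σ ∸ 1) S))) ⟩
    T₀ + Σ S (λ σ → 1 + (free S σ ∸ 1))
      ≡⟨ cong (T₀ +_) (trans (Σ-cong S (λ {σ} _ → 1+[k∸1] (free S σ))) (Σ-+ (free S) (λ σ → 𝟙 (free S σ ≡ᵇ 0)) S)) ⟩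
    T₀ + (Σ S (free S) + Σ S (λ σ → 𝟙 (free S σ ≡ᵇ 0)))
      ≡⟨ sym (+-assoc T₀ (Σ S (free S)) (Σ S (λ σ → 𝟙 (free S σ ≡ᵇ 0)))) ⟩
    T₀ + Σ S (free S) + Σ S (λ σ → 𝟙 (free S σ ≡ᵇ 0))
      ≡⟨ cong (_+ Σ S (λ σ → 𝟙 (free S σ ≡ᵇ 0))) (trans (cong (T₀ +_) (Σ-free S))
           (trans (sym (Σ-+ (λ τ → 𝟙 (deg S τ ≡ᵇ 0)) (λ τ → 𝟙 (deg S τ ≡ᵇ 1)) T)) (Σ-cong T (λ {τ} _ → 𝟙[0]+𝟙[1] (deg S τ))))) ⟩
    W S ∎
    where
    open ≡-Reasoning
    T₀ : ℕ
    T₀ = Σ T (λ τ → 𝟙 (deg S τ ≡ᵇ 0))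

  private
    deg≥1 : ∀ {S σ} τ → σ ∈ S → inc τ σ ≡ true → 1 ≤ deg S τ
    deg≥1 {σ ∷ S} τ (here refl) eq rewrite eq = s≤s z≤n
    deg≥1 {σ ∷ S} τ (there σ∈S) eq = ≤-trans (deg≥1 τ σ∈S eq) (m≤n+m (deg S τ) (𝟙 (inc τ σ)))

    𝟙[0]-antitone : ∀ {m n} → m ≤ n → 𝟙 (n ≡ᵇ 0) ≤ 𝟙 (m ≡ᵇ 0)
    𝟙[0]-antitone {n = n} z≤n = 𝟙≤1 (n ≡ᵇ 0)
    𝟙[0]-antitone (s≤s m≤n)   = z≤n

    𝟙[0]-subadditive : ∀ x y z → x ≤ y + z → 𝟙 (y ≡ᵇ 0) ≤ 𝟙 (x ≡ᵇ 0) + z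
    𝟙[0]-subadditive x       (suc y) z h = z≤n
    𝟙[0]-subadditive zero    zero    z h = s≤s z≤n
    𝟙[0]-subadditive (suc x) zero    z h = ≤-trans (s≤s z≤n) h

    -- Since σ is present, its faces already have degree at least 1; a further simplex can raise
    -- such a degree above 1 but never bring it to 1.
    free-antitone : ∀ b {S σ} → σ ∈ S → free (b ∷ S) σ ≤ free S σ
    free-antitone b {S} {σ} σ∈S = Σ-mono T pointwise
      where
      small : ∀ x c → 1 ≤ c → 𝟙 (𝟙 x + c ≡ᵇ 1) ≤ 𝟙 (c ≡ᵇ 1)
      small false c       h = ≤-refl
      small true  (suc c) h = z≤n
      pointwise : ∀ {τ} → τ ∈ T → 𝟙 (inc τ σ ∧ (𝟙 (inc τ b) + deg S τ ≡ᵇ 1)) ≤ 𝟙 (inc τ σ ∧ (deg S τ ≡ᵇ 1))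
      pointwise {τ} _ with inc τ σ in eq
      ... | false = z≤n
      ... | true  = small (inc τ b) (deg S τ) (deg≥1 τ σ∈S eq)

  -- Only faces of b change their degree, so at most that many τ leave the first sum. By
  -- `free-antitone` no σ in S leaves the second sum, and the new summand of b is nonnegative.
  W-lower : ∀ b S → W S ≤ W (b ∷ S) + faces b
  W-lower b S = begin
    Σ T (λ τ → 𝟙 (deg S τ ≤ᵇ 1)) + Z
      ≤⟨ +-mono-≤ (Σ-mono T (λ {τ} _ → step (inc τ b) (deg S τ))) (Σ-mono S (λ σ∈S → 𝟙[0]-antitone (free-antitone b σ∈S))) ⟩
    Σ T (λ τ → 𝟙 (deg (b ∷ S) τ ≤ᵇ 1) + 𝟙 (inc τ b)) + Z′
      ≡⟨ cong (_+ Z′) (Σ-+ (λ τ → 𝟙 (deg (b ∷ S) τ ≤ᵇ 1)) (λ τ → 𝟙 (inc τ b)) T) ⟩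
    X′ + faces b + Z′
      ≡⟨ trans (+-assoc X′ (faces b) Z′) (trans (cong (X′ +_) (+-comm (faces b) Z′)) (sym (+-assoc X′ Z′ (faces b)))) ⟩
    X′ + Z′ + faces b
      ≤⟨ +-monoˡ-≤ (faces b) (+-monoʳ-≤ X′ (m≤n+m Z′ (𝟙 (free (b ∷ S) b ≡ᵇ 0)))) ⟩
    W (b ∷ S) + faces b ∎
    where
    open ≤-Reasoning
    Z Z′ X′ : ℕ
    Z = Σ S (λ σ → 𝟙 (free S σ ≡ᵇ 0))
    Z′ = Σ S (λ σ → 𝟙 (free (b ∷ S) σ ≡ᵇ 0))
    X′ = Σ T (λ τ → 𝟙 (deg (b ∷ S) τ ≤ᵇ 1))
    step : ∀ x c → 𝟙 (c ≤ᵇ 1) ≤ 𝟙 (𝟙 x + c ≤ᵇ 1) + 𝟙 x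
    step false c = m≤m+n (𝟙 (c ≤ᵇ 1)) 0
    step true  c = ≤-trans (𝟙≤1 (c ≤ᵇ 1)) (m≤n+m 1 (𝟙 (c <ᵇ 1)))

  -- Adding b can only create a σ ∈ S without free faces if b contains one of the
  -- free faces of σ, and each face of b is a free face of at most one σ ∈ S.
  W-upper : ∀ b S → W (b ∷ S) ≤ W S + (faces b + 1)
  W-upper b S = begin
    X′ + (𝟙 (free (b ∷ S) b ≡ᵇ 0) + Z′)
      ≤⟨ +-mono-≤ (Σ-mono T (λ {τ} _ → step (inc τ b) (deg S τ))) (+-mono-≤ (𝟙≤1 (free (b ∷ S) b ≡ᵇ 0)) Z′≤) ⟩
    X + (1 + (Z + faces b))
      ≡⟨ cong (X +_) (+-comm 1 (Z + faces b)) ⟩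
    X + (Z + faces b + 1)
      ≡⟨ cong (X +_) (+-assoc Z (faces b) 1) ⟩
    X + (Z + (faces b + 1))
      ≡⟨ sym (+-assoc X Z (faces b + 1)) ⟩
    W S + (faces b + 1) ∎
    where
    open ≤-Reasoning
    X Z X′ Z′ : ℕ
    X = Σ T (λ τ → 𝟙 (deg S τ ≤ᵇ 1))
    Z = Σ S (λ σ → 𝟙 (free S σ ≡ᵇ 0))
    X′ = Σ T (λ τ → 𝟙 (deg (b ∷ S) τ ≤ᵇ 1))
    Z′ = Σ S (λ σ → 𝟙 (free (b ∷ S) σ ≡ᵇ 0))
    step : ∀ x c → 𝟙 (𝟙 x + c ≤ᵇ 1) ≤ 𝟙 (c ≤ᵇ 1)
    step false c       = ≤-refl
    step true  zero    = ≤-refl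
    step true  (suc c) = z≤n
    e : A → Bool
    e τ = inc τ b ∧ (deg S τ ≡ᵇ 1)
    shared : B → ℕ
    shared σ = Σ T (λ τ → 𝟙 (inc τ σ ∧ e τ))
    lose : ∀ x y c → 𝟙 (y ∧ (c ≡ᵇ 1)) ≤ 𝟙 (y ∧ (𝟙 x + c ≡ᵇ 1)) + 𝟙 (y ∧ (x ∧ (c ≡ᵇ 1)))
    lose false y     c = m≤m+n (𝟙 (y ∧ (c ≡ᵇ 1))) _
    lose true  false c = z≤n
    lose true  true  c = m≤n+m (𝟙 (c ≡ᵇ 1)) _
    free≤ : ∀ σ → free S σ ≤ free (b ∷ S) σ + shared σ
    free≤ σ = ≤-trans (Σ-mono T (λ {τ} _ → lose (inc τ b) (inc τ σ) (deg S τ)))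
      (≤-reflexive (Σ-+ (λ τ → 𝟙 (inc τ σ ∧ (deg (b ∷ S) τ ≡ᵇ 1))) (λ τ → 𝟙 (inc τ σ ∧ e τ)) T))
    once : ∀ x c → 𝟙 (x ∧ (c ≡ᵇ 1)) * c ≤ 𝟙 x
    once false c             = z≤n
    once true  zero          = z≤n
    once true  (suc zero)    = ≤-refl
    once true  (suc (suc c)) = z≤n
    Σ-shared : Σ S shared ≤ faces b
    Σ-shared = begin
      Σ S shared                                  ≡⟨ Σ-swap (λ σ τ → 𝟙 (inc τ σ ∧ e τ)) S T ⟩
      Σ T (λ τ → Σ S (λ σ → 𝟙 (inc τ σ ∧ e τ)))   ≡⟨ Σ-cong T (λ {τ} _ → Σ-inc-∧ S τ (e τ)) ⟩
      Σ T (λ τ → 𝟙 (e τ) * deg S τ)               ≤⟨ Σ-mono T (λ {τ} _ → once (inc τ b) (deg S τ)) ⟩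
      faces b                                     ∎
    Z′≤ : Z′ ≤ Z + faces b
    Z′≤ = begin
      Z′                                              ≤⟨ Σ-mono S (λ {σ} _ → 𝟙[0]-subadditive (free S σ) (free (b ∷ S) σ) (shared σ) (free≤ σ)) ⟩
      Σ S (λ σ → 𝟙 (free S σ ≡ᵇ 0) + shared σ)        ≡⟨ Σ-+ (λ σ → 𝟙 (free S σ ≡ᵇ 0)) shared S ⟩
      Z + Σ S shared                                  ≤⟨ +-monoʳ-≤ Z Σ-shared ⟩
      Z + faces b                                     ∎

  W-↭ : ∀ {S S′} → S ↭ S′ → W S ≡ W S′
  W-↭ {S} {S′} S↭S′ = cong₂ _+_
    (Σ-cong T (λ {τ} _ → cong (λ k → 𝟙 (k ≤ᵇ 1)) (deg-↭ τ)))
    (trans (Σ-cong S (λ {σ} _ → cong (λ k → 𝟙 (k ≡ᵇ 0)) (Σ-cong T (λ {τ} _ → cong (λ k → 𝟙 (inc τ σ ∧ (k ≡ᵇ 1))) (deg-↭ τ)))))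
           (Σ-↭ (λ σ → 𝟙 (free S′ σ ≡ᵇ 0)) S↭S′))
    where
    deg-↭ : ∀ τ → deg S τ ≡ deg S′ τ
    deg-↭ τ = Σ-↭ (λ σ → 𝟙 (inc τ σ)) S↭S′

  -- The difference bounds for the variance concern insertion at any position, whereas `W-lower` and
  -- `W-upper` insert at the front.
  W-insert : ∀ b S₁ S₂ → W (S₁ ++ b ∷ S₂) ≡ W (b ∷ S₁ ++ S₂)
  W-insert b S₁ S₂ = W-↭ (shift b S₁ S₂)

  module _ (_≟ᴮ_ : DecidableEquality B) where

    is : B → B → Bool
    is σ σ′ = does (σ′ ≟ᴮ σ)

    other : B → A → B → Bool
    other σ τ σ′ = inc τ σ′ ∧ not (is σ σ′)

    -- Increasing events, hence within the scope of Harris' inequality, which together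
    -- force σ to be present without free faces.
    witnesses : B → List (B → Bool)
    witnesses σ = is σ ∷ map (other σ) (filterᵇ (λ τ → inc τ σ) T)

    private
      is-refl : ∀ σ → is σ σ ≡ true
      is-refl σ = dec-true (σ ≟ᴮ σ) refl

      ∨-𝟙 : ∀ b c → 𝟙 (b ∨ c) ≤ 𝟙 b + 𝟙 c
      ∨-𝟙 true  c = s≤s z≤n
      ∨-𝟙 false c = ≤-refl

      𝟙-any≤Σ : ∀ (P : B → Bool) S → 𝟙 (any P S) ≤ Σ S (𝟙 ∘ P)
      𝟙-any≤Σ P []      = z≤n
      𝟙-any≤Σ P (σ ∷ S) = ≤-trans (∨-𝟙 (P σ) (any P S)) (+-monoʳ-≤ (𝟙 (P σ)) (𝟙-any≤Σ P S))

      all⇒∈ : ∀ {C : Set} (f : C → Bool) xs {x} → all f xs ≡ true → x ∈ xs → f x ≡ true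
      all⇒∈ f (x ∷ xs) h (here refl) with f x
      ... | true = refl
      all⇒∈ f (x ∷ xs) h (there x∈xs) with f x
      ... | true = all⇒∈ f xs h x∈xs

      ∈-filterᵇ : ∀ {C : Set} (f : C → Bool) xs {x} → x ∈ xs → f x ≡ true → x ∈ filterᵇ f xs
      ∈-filterᵇ f (x ∷ xs) (here refl) eq rewrite eq = here refl
      ∈-filterᵇ f (x ∷ xs) (there x∈xs) eq with f x
      ... | true  = there (∈-filterᵇ f xs x∈xs eq)
      ... | false = ∈-filterᵇ f xs x∈xs eq

    -- Because `other σ τ` excludes σ, the two events are realised by different entries of S, each
    -- of which contributes to the degree of τ.
    deg≥2 : ∀ S σ τ → inc τ σ ≡ true → 𝟙 (any (other σ τ) S) + 𝟙 (any (is σ) S) ≤ deg S τ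
    deg≥2 S σ τ eq = begin
      𝟙 (any (other σ τ) S) + 𝟙 (any (is σ) S)                 ≤⟨ +-mono-≤ (𝟙-any≤Σ (other σ τ) S) (𝟙-any≤Σ (is σ) S) ⟩
      Σ S (𝟙 ∘ other σ τ) + Σ S (𝟙 ∘ is σ)                     ≡⟨ Σ-+ (𝟙 ∘ other σ τ) (𝟙 ∘ is σ) S ⟨
      Σ S (λ σ′ → 𝟙 (other σ τ σ′) + 𝟙 (is σ σ′))              ≤⟨ Σ-mono S (λ {σ′} _ → pointwise σ′) ⟩
      deg S τ                                                  ∎
      where
      open ≤-Reasoning
      ∧-true : ∀ b → 𝟙 (b ∧ true) + 0 ≤ 𝟙 b
      ∧-true true  = ≤-refl
      ∧-true false = ≤-refl
      pointwise : ∀ σ′ → 𝟙 (other σ τ σ′) + 𝟙 (is σ σ′) ≤ 𝟙 (inc τ σ′)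
      pointwise σ′ with σ′ ≟ᴮ σ
      ... | yes refl rewrite eq = ≤-refl
      ... | no  _    = ∧-true (inc τ σ′)

    hits⇒free≡0 : ∀ S σ → all (λ P → any P S) (witnesses σ) ≡ true → free S σ ≡ 0
    hits⇒free≡0 S σ h = Σ-zero T vanish
      where
      present : any (is σ) S ≡ true
      present = all⇒∈ (λ P → any P S) (witnesses σ) h (here refl)
      two : ∀ {k} → 2 ≤ k → 𝟙 (k ≡ᵇ 1) ≡ 0
      two (s≤s (s≤s _)) = refl
      vanish : ∀ {τ} → τ ∈ T → 𝟙 (inc τ σ ∧ (deg S τ ≡ᵇ 1)) ≡ 0
      vanish {τ} τ∈T with inc τ σ in eq
      ... | false = refl
      ... | true  = two (subst₂ (λ b c → 𝟙 b + 𝟙 c ≤ deg S τ)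
        (all⇒∈ (λ P → any P S) (witnesses σ) h (there (∈-map⁺ (other σ) (∈-filterᵇ (λ τ → inc τ σ) T τ∈T eq))))
        present (deg≥2 S σ τ eq))

    -- The right side has the shape of a summand in `Σ-sublist`: presence of σ times its indicator.
    hits≤ : ∀ S σ → 𝟙 (all (λ P → any P S) (witnesses σ)) ≤ 𝟙 (any (is σ) S) * 𝟙 (free S σ ≡ᵇ 0)
    hits≤ S σ with all (λ P → any P S) (witnesses σ) in eq
    ... | false = z≤n
    ... | true rewrite hits⇒free≡0 S σ eq | all⇒∈ (λ P → any P S) (witnesses σ) eq (here refl) = ≤-refl

    -- This moves the randomness from the range of summation into the summands, so that linearity of
    -- expectation applies to a sum over the fixed list D. Without uniqueness a repeated entry of D
    -- would be counted as present more than once.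
    Σ-sublist : ∀ (φ : B → ℕ) {S D} → Unique D → S ⊆ D → Σ S φ ≡ Σ D (λ σ → 𝟙 (any (is σ) S) * φ σ)
    Σ-sublist φ u [] = refl
    Σ-sublist φ {S} {y ∷ D} (y∉ ∷ u) (.y ∷ʳ s) =
      trans (Σ-sublist φ u s) (cong (λ b → 𝟙 b * φ y + Σ D (λ σ → 𝟙 (any (is σ) S) * φ σ)) (sym (absent S (λ y∈S → All.lookup y∉ (lookup s y∈S) refl))))
      where
      absent : ∀ S {y} → (y ∈ S → ⊥) → any (is y) S ≡ false
      absent []      h = refl
      absent (x ∷ S) {y} h rewrite dec-false (x ≟ᴮ y) (λ eq → h (here (sym eq))) = absent S (h ∘ there)
    Σ-sublist φ {y ∷ S} {.y ∷ D} (y∉ ∷ u) (refl ∷ s) rewrite is-refl y = cong₂ _+_ (sym (+-identityʳ (φ y)))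
      (trans (Σ-sublist φ u s) (Σ-cong D step))
      where
      step : ∀ {σ} → σ ∈ D → 𝟙 (any (is σ) S) * φ σ ≡ 𝟙 (is σ y ∨ any (is σ) S) * φ σ
      step {σ} σ∈D rewrite dec-false (y ≟ᴮ σ) (All.lookup y∉ σ∈D) = refl

    count-is : ∀ {D σ} → Unique D → σ ∈ D → Σ D (𝟙 ∘ is σ) ≡ 1
    count-is {D = _ ∷ D} {σ} (y∉ ∷ u) (here refl) rewrite is-refl σ =
      cong suc (Σ-zero D (λ {σ′} σ′∈D → cong 𝟙 (dec-false (σ′ ≟ᴮ σ) (λ eq → All.lookup y∉ σ′∈D (sym eq)))))
    count-is {D = y ∷ D} {σ} (y∉ ∷ u) (there σ∈D) rewrite dec-false (y ≟ᴮ σ) (All.lookup y∉ σ∈D) = count-is u σ∈D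

    -- Removing σ costs at most one coface of τ. This turns k + 1 cofaces into at least k chances
    -- for a second simplex on τ.
    count-other : ∀ {D σ} τ → Unique D → σ ∈ D → deg D τ ≤ suc (Σ D (𝟙 ∘ other σ τ))
    count-other {D} {σ} τ u σ∈D = begin
      deg D τ                                           ≤⟨ Σ-mono D (λ {σ′} _ → pointwise (inc τ σ′) (is σ σ′)) ⟩
      Σ D (λ σ′ → 𝟙 (is σ σ′) + 𝟙 (other σ τ σ′))       ≡⟨ Σ-+ (𝟙 ∘ is σ) (𝟙 ∘ other σ τ) D ⟩
      Σ D (𝟙 ∘ is σ) + Σ D (𝟙 ∘ other σ τ)              ≡⟨ cong (_+ Σ D (𝟙 ∘ other σ τ)) (count-is u σ∈D) ⟩
      suc (Σ D (𝟙 ∘ other σ τ))                         ∎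
      where
      open ≤-Reasoning
      pointwise : ∀ x y → 𝟙 x ≤ 𝟙 y + 𝟙 (x ∧ not y)
      pointwise x     true  = ≤-trans (𝟙≤1 x) (s≤s z≤n)
      pointwise true  false = ≤-refl
      pointwise false false = ≤-refl

-- Counting faces and cofaces in the full simplex

module SubsetCount where

  open import Data.Bool using (Bool)
  open import Data.Nat
  open import Data.Nat.Properties
  open import Data.Nat.Combinatorics using (_C_; nCk≡nC[n∸k]; nCn≡1; nC1≡n; k>n⇒nCk≡0; nCk+nC[k+1]≡[n+1]C[k+1])
  open import Data.List using (List; []; _∷_; map; length)
  open import Data.List.Membership.Propositional using (_∈_)
  open import Data.List.Membership.Propositional.Properties using (∈-filter⁻; ∈-map⁻)
  open import Data.List.Relation.Unary.All using ([]; _∷_)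
  open import Data.List.Relation.Unary.AllPairs using ([]; _∷_)
  open import Data.List.Relation.Unary.Unique.Propositional using (Unique)
  open import Data.List.Relation.Unary.Unique.Propositional.Properties using (map⁺; ++⁺; filter⁺)
  open import Data.Vec using ([]; _∷_)
  open import Data.Vec.Properties using (∷-injectiveʳ)
  open import Data.Fin.Subset using (Subset; inside; outside; ∣_∣; ⊤)
  open import Data.Fin.Subset.Properties using (_⊆?_; ∣p∣≤n; p⊆q⇒∣p∣≤∣q∣; ∣⊤∣≡n; ⊆⊤)
  open import Data.Product using (_×_; _,_; proj₂)
  open import Data.Empty using (⊥)
  open import Relation.Nullary using (yes; no)
  open import Relation.Nullary.Decidable using (does; dec-true; dec-false)
  open import Relation.Binary.PropositionalEquality
  open import Function using (_∘_)
  open import Defs using (subsets; simplices; Δ)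
  open ListSum

  nC0≡1 : ∀ n → n C 0 ≡ 1
  nC0≡1 n = trans (nCk≡nC[n∸k] {k = 0} {n = n} z≤n) (nCn≡1 n)

  1≤nCk : ∀ {n k} → k ≤ n → 1 ≤ n C k
  1≤nCk {n} z≤n = ≤-reflexive (sym (nC0≡1 n))
  1≤nCk {suc n} {suc k} (s≤s k≤n) = ≤-trans (1≤nCk k≤n)
    (≤-trans (m≤m+n (n C k) (n C suc k)) (≤-reflexive (nCk+nC[k+1]≡[n+1]C[k+1] n k)))

  -- Once k ≤ n, Pascal's rule adds at least 1 at each step. This linear bound suffices because only
  -- the divergence of binom(n, d) matters.
  n≤nC[1+k]+[1+k] : ∀ n k → n ≤ n C suc k + suc k
  n≤nC[1+k]+[1+k] zero    k = z≤n
  n≤nC[1+k]+[1+k] (suc n) k with k ≤? n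
  ... | no  k≰n = ≤-trans (≰⇒> k≰n) (≤-trans (n≤1+n k) (m≤n+m (suc k) _))
  ... | yes k≤n = ≤-trans (+-mono-≤ (1≤nCk k≤n) (n≤nC[1+k]+[1+k] n k))
    (≤-reflexive (trans (sym (+-assoc (n C k) (n C suc k) (suc k))) (cong (_+ suc k) (nCk+nC[k+1]≡[n+1]C[k+1] n k))))

  _⊆ᵇ_ : ∀ {n} → Subset n → Subset n → Bool
  τ ⊆ᵇ σ = does (τ ⊆? σ)

  Σ-subsets : ∀ n (φ : Subset (suc n) → ℕ) →
    Σ (subsets (suc n)) φ ≡ Σ (subsets n) (φ ∘ (inside ∷_)) + Σ (subsets n) (φ ∘ (outside ∷_))
  Σ-subsets n φ = trans (Σ-++ φ (map (inside ∷_) (subsets n)) (map (outside ∷_) (subsets n)))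
    (cong₂ _+_ (Σ-map φ (inside ∷_) (subsets n)) (Σ-map φ (outside ∷_) (subsets n)))

  count-faces : ∀ {n} (σ : Subset n) k →
    Σ (subsets n) (λ τ → 𝟙 (∣ τ ∣ ≡ᵇ k) * 𝟙 (τ ⊆ᵇ σ)) ≡ ∣ σ ∣ C k
  count-faces []            zero    = refl
  count-faces []            (suc k) = sym (k>n⇒nCk≡0 {0} {suc k} (s≤s z≤n))
  count-faces {suc n} (outside ∷ σ) k = trans (Σ-subsets n _)
    (cong₂ _+_ (Σ-zero (subsets n) (λ {τ} _ → *-zeroʳ (𝟙 (suc ∣ τ ∣ ≡ᵇ k)))) (count-faces σ k))
  count-faces {suc n} (inside ∷ σ) zero = trans (Σ-subsets n _)
    (trans (cong₂ _+_ (Σ-zero (subsets n) (λ _ → refl)) (count-faces σ 0)) (trans (nC0≡1 ∣ σ ∣) (sym (nC0≡1 (suc ∣ σ ∣)))))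
  count-faces {suc n} (inside ∷ σ) (suc k) = trans (Σ-subsets n _)
    (trans (cong₂ _+_ (count-faces σ k) (count-faces σ (suc k))) (nCk+nC[k+1]≡[n+1]C[k+1] ∣ σ ∣ k))

  -- Only j = 1 is used later, but a vertex outside τ may be taken or left, so the induction follows
  -- Pascal's rule and needs all j.
  count-cofaces : ∀ {n} (τ : Subset n) j →
    Σ (subsets n) (λ σ → 𝟙 (∣ σ ∣ ≡ᵇ j + ∣ τ ∣) * 𝟙 (τ ⊆ᵇ σ)) ≡ (n ∸ ∣ τ ∣) C j
  count-cofaces []      zero    = refl
  count-cofaces []      (suc j) = sym (k>n⇒nCk≡0 {0} {suc j} (s≤s z≤n))
  count-cofaces {suc n} (inside ∷ τ) j = trans (Σ-subsets n _) (begin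
    Σ (subsets n) (λ σ → 𝟙 (suc ∣ σ ∣ ≡ᵇ j + suc ∣ τ ∣) * 𝟙 (τ ⊆ᵇ σ)) + Σ (subsets n) (λ σ → 𝟙 (∣ σ ∣ ≡ᵇ j + suc ∣ τ ∣) * 0)
      ≡⟨ cong₂ _+_ (cong (λ m → Σ (subsets n) (λ σ → 𝟙 (suc ∣ σ ∣ ≡ᵇ m) * 𝟙 (τ ⊆ᵇ σ))) (+-suc j ∣ τ ∣))
                   (Σ-zero (subsets n) (λ {σ} _ → *-zeroʳ (𝟙 (∣ σ ∣ ≡ᵇ j + suc ∣ τ ∣)))) ⟩
    Σ (subsets n) (λ σ → 𝟙 (∣ σ ∣ ≡ᵇ j + ∣ τ ∣) * 𝟙 (τ ⊆ᵇ σ)) + 0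
      ≡⟨ trans (+-identityʳ _) (count-cofaces τ j) ⟩
    (n ∸ ∣ τ ∣) C j ∎)
    where open ≡-Reasoning
  count-cofaces {suc n} (outside ∷ τ) zero = trans (Σ-subsets n _)
    (trans (cong₂ _+_ (Σ-zero (subsets n) (λ {σ} _ → too-small σ)) (count-cofaces τ 0))
           (trans (nC0≡1 (n ∸ ∣ τ ∣)) (sym (nC0≡1 (suc n ∸ ∣ τ ∣)))))
    where
    too-small : ∀ σ → 𝟙 (suc ∣ σ ∣ ≡ᵇ ∣ τ ∣) * 𝟙 (τ ⊆ᵇ σ) ≡ 0
    too-small σ with τ ⊆? σ
    ... | no  _   = *-zeroʳ (𝟙 (suc ∣ σ ∣ ≡ᵇ ∣ τ ∣))
    ... | yes τ⊆σ = cong (λ b → 𝟙 b * 1) (dec-false (suc ∣ σ ∣ ≟ ∣ τ ∣) (λ eq → <⇒≢ (s≤s (p⊆q⇒∣p∣≤∣q∣ τ⊆σ)) (sym eq)))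
  count-cofaces {suc n} (outside ∷ τ) (suc j) = trans (Σ-subsets n _)
    (trans (cong₂ _+_ (count-cofaces τ j) (count-cofaces τ (suc j)))
           (trans (nCk+nC[k+1]≡[n+1]C[k+1] (n ∸ ∣ τ ∣) j) (cong (_C suc j) (sym (+-∸-assoc 1 (∣p∣≤n τ))))))

  Σ-simplices : ∀ {n} k (φ : Subset n → ℕ) →
    Σ (simplices k (Δ n)) φ ≡ Σ (subsets n) (λ σ → 𝟙 (∣ σ ∣ ≡ᵇ suc k) * φ σ)
  Σ-simplices {n} k φ = begin
    Σ (simplices k (Δ n)) φ
      ≡⟨ Σ-filter (λ σ → ∣ σ ∣ ≟ suc k) φ (Δ n) ⟩
    Σ (Δ n) (λ σ → 𝟙 (∣ σ ∣ ≡ᵇ suc k) * φ σ)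
      ≡⟨ Σ-filter (λ σ → 1 ≤? ∣ σ ∣) (λ σ → 𝟙 (∣ σ ∣ ≡ᵇ suc k) * φ σ) (subsets n) ⟩
    Σ (subsets n) (λ σ → 𝟙 (1 ≤ᵇ ∣ σ ∣) * (𝟙 (∣ σ ∣ ≡ᵇ suc k) * φ σ))
      ≡⟨ Σ-cong (subsets n) (λ {σ} _ → nonempty ∣ σ ∣ (φ σ)) ⟩
    Σ (subsets n) (λ σ → 𝟙 (∣ σ ∣ ≡ᵇ suc k) * φ σ) ∎
    where
    open ≡-Reasoning
    nonempty : ∀ m x → 𝟙 (1 ≤ᵇ m) * (𝟙 (m ≡ᵇ suc k) * x) ≡ 𝟙 (m ≡ᵇ suc k) * x
    nonempty zero    x = refl
    nonempty (suc m) x = +-identityʳ _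

  ∈-simplices : ∀ {n} k {X : List (Subset n)} {σ} → σ ∈ simplices k X → ∣ σ ∣ ≡ suc k
  ∈-simplices k {X} σ∈ = proj₂ (∈-filter⁻ (λ σ → ∣ σ ∣ ≟ suc k) {xs = X} σ∈)

  length-simplices : ∀ n k → length (simplices k (Δ n)) ≡ n C suc k
  length-simplices n k = begin
    length (simplices k (Δ n))
      ≡⟨ sym (trans (Σ-const 1 (simplices k (Δ n))) (*-identityʳ _)) ⟩
    Σ (simplices k (Δ n)) (λ _ → 1)
      ≡⟨ Σ-simplices {n} k (λ _ → 1) ⟩
    Σ (subsets n) (λ σ → 𝟙 (∣ σ ∣ ≡ᵇ suc k) * 1)
      ≡⟨ Σ-cong (subsets n) (λ {σ} _ → cong (λ b → 𝟙 (∣ σ ∣ ≡ᵇ suc k) * 𝟙 b) (sym (dec-true (σ ⊆? ⊤) ⊆⊤))) ⟩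
    Σ (subsets n) (λ σ → 𝟙 (∣ σ ∣ ≡ᵇ suc k) * 𝟙 (σ ⊆ᵇ ⊤))
      ≡⟨ count-faces (⊤ {n}) (suc k) ⟩
    ∣ ⊤ {n} ∣ C suc k
      ≡⟨ cong (_C suc k) (∣⊤∣≡n n) ⟩
    n C suc k ∎
    where open ≡-Reasoning

  faces-simplex : ∀ {n} k {σ : Subset n} → ∣ σ ∣ ≡ suc (suc k) →
    Σ (simplices k (Δ n)) (λ τ → 𝟙 (τ ⊆ᵇ σ)) ≡ suc (suc k)
  faces-simplex {n} k {σ} eq = begin
    Σ (simplices k (Δ n)) (λ τ → 𝟙 (τ ⊆ᵇ σ))   ≡⟨ Σ-simplices k (λ τ → 𝟙 (τ ⊆ᵇ σ)) ⟩
    Σ (subsets n) (λ τ → 𝟙 (∣ τ ∣ ≡ᵇ suc k) * 𝟙 (τ ⊆ᵇ σ))   ≡⟨ count-faces σ (suc k) ⟩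
    ∣ σ ∣ C suc k                     ≡⟨ cong (_C suc k) eq ⟩
    suc (suc k) C suc k               ≡⟨ nCk≡nC[n∸k] (n≤1+n (suc k)) ⟩
    suc (suc k) C (suc k ∸ k)         ≡⟨ cong (suc (suc k) C_) (m+n∸n≡m 1 k) ⟩
    suc (suc k) C 1                   ≡⟨ nC1≡n (suc (suc k)) ⟩
    suc (suc k)                       ∎
    where open ≡-Reasoning

  cofaces-simplex : ∀ {n} k {τ : Subset n} → ∣ τ ∣ ≡ suc k →
    Σ (simplices (suc k) (Δ n)) (λ σ → 𝟙 (τ ⊆ᵇ σ)) ≡ n ∸ suc k
  cofaces-simplex {n} k {τ} eq = begin
    Σ (simplices (suc k) (Δ n)) (λ σ → 𝟙 (τ ⊆ᵇ σ))                 ≡⟨ Σ-simplices (suc k) (λ σ → 𝟙 (τ ⊆ᵇ σ)) ⟩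
    Σ (subsets n) (λ σ → 𝟙 (∣ σ ∣ ≡ᵇ suc (suc k)) * 𝟙 (τ ⊆ᵇ σ))    ≡⟨ cong (λ m → Σ (subsets n) (λ σ → 𝟙 (∣ σ ∣ ≡ᵇ suc m) * 𝟙 (τ ⊆ᵇ σ))) (sym eq) ⟩
    Σ (subsets n) (λ σ → 𝟙 (∣ σ ∣ ≡ᵇ 1 + ∣ τ ∣) * 𝟙 (τ ⊆ᵇ σ))      ≡⟨ count-cofaces τ 1 ⟩
    (n ∸ ∣ τ ∣) C 1                                                ≡⟨ nC1≡n (n ∸ ∣ τ ∣) ⟩
    n ∸ ∣ τ ∣                                                      ≡⟨ cong (n ∸_) eq ⟩
    n ∸ suc k                                                      ∎
    where open ≡-Reasoning

  subsets-unique : ∀ n → Unique (subsets n)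
  subsets-unique zero    = [] ∷ []
  subsets-unique (suc n) = ++⁺ (map⁺ ∷-injectiveʳ (subsets-unique n)) (map⁺ ∷-injectiveʳ (subsets-unique n)) disjoint
    where
    disjoint : ∀ {σ} → σ ∈ map (inside ∷_) (subsets n) × σ ∈ map (outside ∷_) (subsets n) → ⊥
    disjoint (σ∈ , σ∈′) with ∈-map⁻ (inside ∷_) σ∈ | ∈-map⁻ (outside ∷_) σ∈′
    ... | _ , _ , refl | _ , _ , ()

  simplices-unique : ∀ n k → Unique (simplices k (Δ n))
  simplices-unique n k = filter⁺ (λ σ → ∣ σ ∣ ≟ suc k) (filter⁺ (λ σ → 1 ≤? ∣ σ ∣) (subsets-unique n))

-- Monotone comparison of h at two arguments

module Growth where

  open import Data.Nat as ℕ using (ℕ; zero; suc)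
  import Data.Nat.Properties as ℕₚ
  open import Data.Nat.DivMod using (m≡m%n+[m/n]*n; m%n<n; m/n*n≤m)
  open import Data.Rational using (ℚ; 0ℚ; 1ℚ; ½; _+_; _*_; _-_; -_; _≤_; _<_)
  open import Data.Rational.Properties
  open import Data.Rational.Solver using (module +-*-Solver)
  open import Data.Product using (∃-syntax; _×_; _,_)
  open import Relation.Binary.PropositionalEquality
  open Rational
  open +-*-Solver

  -- With α = 1 - a and β = 1 - b this is Chebyshev's sum inequality
  -- n ∑ αⁱ βⁿ⁻¹⁻ⁱ ≤ (∑ αⁱ) (∑ βⁱ), multiplied by a b (b - a).
  module ChebyshevSum {a b : ℚ} (0≤a : 0ℚ ≤ a) (a≤b : a ≤ b) (b≤1 : b ≤ 1ℚ) where

    private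
      -- `C` is the defect of the inequality with X, Y, ν for the two powers and the exponent, and
      -- `R` its difference in the exponent, twisted by 1 - a. The sign of `R` is not visible
      -- either, but its difference twisted by 1 - b is a product of nonnegative factors. So two
      -- nested inductions, first on `R` and then on `C`, give the result.
      C R : ℚ → ℚ → ℚ → ℚ
      C X Y ν = (b - a) * ((1ℚ - X) * (1ℚ - Y)) - ν * (a * b * (X - Y))
      R X Y ν = C ((1ℚ - a) * X) ((1ℚ - b) * Y) (1ℚ + ν) - (1ℚ - a) * C X Y ν

      0≤b : 0ℚ ≤ b
      0≤b = ≤-trans 0≤a a≤b
      a≤1 : a ≤ 1ℚ
      a≤1 = ≤-trans a≤b b≤1

      R-step : ∀ X Y ν → R ((1ℚ - a) * X) ((1ℚ - b) * Y) (1ℚ + ν) ≡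
        a * b * (b - a) * ((1ℚ - (1ℚ - a) * X) * (1ℚ - (1ℚ - b) * Y)) + (1ℚ - b) * R X Y ν
      R-step = solve 5 (λ a b X Y ν → (b :- a) :* ((con 1ℚ :- (con 1ℚ :- a) :* ((con 1ℚ :- a) :* X)) :* (con 1ℚ :- (con 1ℚ :- b) :* ((con 1ℚ :- b) :* Y))) :- (con 1ℚ :+ (con 1ℚ :+ ν)) :* (a :* b :* ((con 1ℚ :- a) :* ((con 1ℚ :- a) :* X) :- (con 1ℚ :- b) :* ((con 1ℚ :- b) :* Y)))
         :- (con 1ℚ :- a) :* ((b :- a) :* ((con 1ℚ :- (con 1ℚ :- a) :* X) :* (con 1ℚ :- (con 1ℚ :- b) :* Y)) :- (con 1ℚ :+ ν) :* (a :* b :* ((con 1ℚ :- a) :* X :- (con 1ℚ :- b) :* Y))) := a :* b :* (b :- a) :* ((con 1ℚ :- (con 1ℚ :- a) :* X) :* (con 1ℚ :- (con 1ℚ :- b) :* Y))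
         :+ (con 1ℚ :- b) :* ((b :- a) :* ((con 1ℚ :- (con 1ℚ :- a) :* X) :* (con 1ℚ :- (con 1ℚ :- b) :* Y)) :- (con 1ℚ :+ ν) :* (a :* b :* ((con 1ℚ :- a) :* X :- (con 1ℚ :- b) :* Y))
         :- (con 1ℚ :- a) :* ((b :- a) :* ((con 1ℚ :- X) :* (con 1ℚ :- Y)) :- ν :* (a :* b :* (X :- Y))))) refl a b

      opaque
        0≤R : ∀ n → 0ℚ ≤ R ((1ℚ - a) ^ n) ((1ℚ - b) ^ n) (ι n)
        0≤R zero = ≤-reflexive (solve 2 (λ a b → con 0ℚ := (b :- a) :* ((con 1ℚ :- (con 1ℚ :- a) :* con 1ℚ) :* (con 1ℚ :- (con 1ℚ :- b) :* con 1ℚ)) :- (con 1ℚ :+ con 0ℚ) :* (a :* b :* ((con 1ℚ :- a) :* con 1ℚ :- (con 1ℚ :- b) :* con 1ℚ))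
          :- (con 1ℚ :- a) :* ((b :- a) :* ((con 1ℚ :- con 1ℚ) :* (con 1ℚ :- con 1ℚ)) :- con 0ℚ :* (a :* b :* (con 1ℚ :- con 1ℚ)))) refl a b)
        0≤R (suc n) = subst (0ℚ ≤_)
          (trans (sym (R-step X Y (ι n))) (cong (R ((1ℚ - a) * X) ((1ℚ - b) * Y)) (sym (ι-suc n))))
          (0≤+ (0≤* (0≤* (0≤* 0≤a 0≤b) (p≤q⇒0≤q-p a≤b))
                    (0≤* (p≤q⇒0≤q-p (^≤1 (p≤q⇒0≤q-p a≤1) (1-≤1 0≤a) (suc n)))
                         (p≤q⇒0≤q-p (^≤1 (p≤q⇒0≤q-p b≤1) (1-≤1 0≤b) (suc n)))))
               (0≤* (p≤q⇒0≤q-p b≤1) (0≤R n)))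
          where
          X Y : ℚ
          X = (1ℚ - a) ^ n
          Y = (1ℚ - b) ^ n
          1-≤1 : ∀ {c} → 0ℚ ≤ c → 1ℚ - c ≤ 1ℚ
          1-≤1 {c} 0≤c = ≤-by c 0≤c (solve 1 (λ c → con 1ℚ := con 1ℚ :- c :+ c) refl c)

        0≤C : ∀ n → 0ℚ ≤ C ((1ℚ - a) ^ n) ((1ℚ - b) ^ n) (ι n)
        0≤C zero = ≤-reflexive (solve 2 (λ a b → con 0ℚ := (b :- a) :* ((con 1ℚ :- con 1ℚ) :* (con 1ℚ :- con 1ℚ)) :- con 0ℚ :* (a :* b :* (con 1ℚ :- con 1ℚ))) refl a b)
        0≤C (suc n) = subst (0ℚ ≤_)
          (trans (solve 2 (λ r c → r :- c :+ c := r) refl (C ((1ℚ - a) * X) ((1ℚ - b) * Y) (1ℚ + ι n)) ((1ℚ - a) * C X Y (ι n)))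
                 (cong (C ((1ℚ - a) * X) ((1ℚ - b) * Y)) (sym (ι-suc n))))
          (0≤+ (0≤R n) (0≤* (p≤q⇒0≤q-p a≤1) (0≤C n)))
          where
          X Y : ℚ
          X = (1ℚ - a) ^ n
          Y = (1ℚ - b) ^ n

    opaque
      chebyshev-sum : ∀ n → ι n * (a * b * ((1ℚ - a) ^ n - (1ℚ - b) ^ n)) ≤
        (b - a) * ((1ℚ - (1ℚ - a) ^ n) * (1ℚ - (1ℚ - b) ^ n))
      chebyshev-sum n = 0≤q-p⇒p≤q (0≤C n)

  h : ℕ → ℚ → ℚ → ℚ
  h m x t = ι m * (x + 1ℚ) * t + x * (1ℚ - t) ^ m - ι m

  opaque
    -- h x X / (x (1 - X)) - (1 - X) ^ d is monotone: for X = exp (- x) it is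
    -- (d + 1) (1 / (exp x - 1) - 1 / x).
    h-compare : ∀ d {x y X Y} → x * y * (X - Y) ≤ (y - x) * ((1ℚ - X) * (1ℚ - Y)) →
      y * (1ℚ - Y) * (h (suc d) x X + x * (1ℚ - X) * ((1ℚ - Y) ^ d - (1ℚ - X) ^ d)) ≤
      x * (1ℚ - X) * h (suc d) y Y
    h-compare d {x} {y} {X} {Y} hyp = ≤-by
      (ι (suc d) * ((y - x) * ((1ℚ - X) * (1ℚ - Y)) - x * y * (X - Y)))
      (0≤* (0≤ι (suc d)) (p≤q⇒0≤q-p hyp))
      (solve 7 (λ m x y X Y P Q → x :* (con 1ℚ :- X) :* (m :* (y :+ con 1ℚ) :* Y :+ y :* ((con 1ℚ :- Y) :* Q) :- m) := y :* (con 1ℚ :- Y) :* (m :* (x :+ con 1ℚ) :* X :+ x :* ((con 1ℚ :- X) :* P) :- m :+ x :* (con 1ℚ :- X) :* (Q :- P))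
         :+ m :* ((y :- x) :* ((con 1ℚ :- X) :* (con 1ℚ :- Y)) :- x :* y :* (X :- Y))) refl
         (ι (suc d)) x y X Y ((1ℚ - X) ^ d) ((1ℚ - Y) ^ d))

  -- Here n a and n b play the roles of c_d and c. All remaining parameters are bounds independent
  -- of n: γ separates the two arguments, η bounds Y from below and κ bounds 1 - X from below.
  module Gap (d : ℕ) (1≤d : 1 ℕ.≤ d) (n : ℕ) (0<n : 0ℚ < ι n)
    {a b l B γ η κ : ℚ} (0<l : 0ℚ < l) (l≤na : l ≤ ι n * a) (na≤B : ι n * a ≤ B)
    (0≤γ : 0ℚ ≤ γ) (γ≤ : ι n * a + γ ≤ ι n * b) (b≤1 : b ≤ 1ℚ)
    (0<η : 0ℚ < η) (η≤ : η ≤ (1ℚ - b) ^ n)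
    (0<κ : 0ℚ < κ) (κ≤ : κ * (1ℚ + B) ≤ l) where

    private
      x y X Y : ℚ
      x = ι n * a
      y = ι n * b
      X = (1ℚ - a) ^ n
      Y = (1ℚ - b) ^ n

      opaque
        x≤y : x ≤ y
        x≤y = ≤-trans (p≤p+q 0≤γ) γ≤
        a≤b : a ≤ b
        a≤b = *-cancelˡ-≤ (ι n) 0<n x≤y
        0≤x : 0ℚ ≤ x
        0≤x = ≤-trans (<⇒≤ 0<l) l≤na
        0≤a : 0ℚ ≤ a
        0≤a = *-cancelˡ-≤ (ι n) 0<n (subst (_≤ x) (sym (*-zeroʳ (ι n))) 0≤x)
        a≤1 : a ≤ 1ℚ
        a≤1 = ≤-trans a≤b b≤1
        0≤1-b : 0ℚ ≤ 1ℚ - b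
        0≤1-b = p≤q⇒0≤q-p b≤1
        1-b≤1-a : 1ℚ - b ≤ 1ℚ - a
        1-b≤1-a = +-monoʳ-≤ 1ℚ (neg-antimono-≤ a≤b)
        1-a≤1 : 1ℚ - a ≤ 1ℚ
        1-a≤1 = ≤-by a 0≤a (solve 1 (λ a → con 1ℚ := con 1ℚ :- a :+ a) refl a)

        -- from X (1 + x) ≤ 1
        κ≤1-X : κ ≤ 1ℚ - X
        κ≤1-X = *-cancelˡ-≤ (1ℚ + B) (<-≤-trans 0<1 (p≤p+q 0≤B)) (begin
          (1ℚ + B) * κ            ≡⟨ *-comm (1ℚ + B) κ ⟩
          κ * (1ℚ + B)            ≤⟨ κ≤ ⟩
          l                       ≤⟨ l≤na ⟩
          x                       ≤⟨ ≤-by (1ℚ - X * (1ℚ + x)) (p≤q⇒0≤q-p (bernoulli-inverse 0≤a a≤1 n))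
                                       (solve 2 (λ x X → (con 1ℚ :+ x) :* (con 1ℚ :- X) := x :+ (con 1ℚ :- X :* (con 1ℚ :+ x))) refl x X) ⟩
          (1ℚ + x) * (1ℚ - X)     ≤⟨ *-monoʳ-≤ (p≤q⇒0≤q-p (^≤1 (≤-trans 0≤1-b 1-b≤1-a) 1-a≤1 n)) (+-monoʳ-≤ 1ℚ na≤B) ⟩
          (1ℚ + B) * (1ℚ - X)     ∎)
          where
          open ≤-Reasoning
          0≤B : 0ℚ ≤ B
          0≤B = ≤-trans 0≤x na≤B

        0≤Y : 0ℚ ≤ Y
        0≤Y = 0≤^ 0≤1-b n
        X≤1 : X ≤ 1ℚ
        X≤1 = ^≤1 (≤-trans 0≤1-b 1-b≤1-a) 1-a≤1 n
        -- The factor n of `^-gap` combines with b - a to y - x, which keeps the bound uniform in n.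
        γη≤X-Y : γ * η ≤ X - Y
        γη≤X-Y = begin
          γ * η                                     ≤⟨ *-mono-≤ 0≤y-x (<⇒≤ 0<η) γ≤y-x η≤ ⟩
          (y - x) * Y                               ≡⟨ solve 4 (λ n a b Y → (n :* b :- n :* a) :* Y := Y :+ n :* ((con 1ℚ :- a :- (con 1ℚ :- b)) :* Y) :- Y) refl (ι n) a b Y ⟩
          Y + ι n * ((1ℚ - a - (1ℚ - b)) * Y) - Y   ≤⟨ +-monoˡ-≤ (- Y) (^-gap 0≤1-b 1-b≤1-a (≤-trans 1-b≤1-a 1-a≤1) n) ⟩
          X - Y                                     ∎
          where
          open ≤-Reasoning
          γ≤y-x : γ ≤ y - x
          γ≤y-x = subst (_≤ y - x) (solve 2 (λ x g → x :+ g :- x := g) refl x γ) (+-monoˡ-≤ (- x) γ≤)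
          0≤y-x : 0ℚ ≤ y - x
          0≤y-x = ≤-trans 0≤γ γ≤y-x

        Y≤X : Y ≤ X
        Y≤X = ^-monoˡ-≤ 0≤1-b 1-b≤1-a n

        -- `^-gap` for the bases 1 - Y ≥ 1 - X yields d (X - Y) (1 - X)ᵈ, from which the factor d ≥
        -- 1 is dropped.
        difference : γ * η * κ ^ d ≤ (1ℚ - Y) ^ d - (1ℚ - X) ^ d
        difference = begin
          γ * η * κ ^ d
            ≤⟨ *-mono-≤ 0≤X-Y (0≤^ (<⇒≤ 0<κ) d) γη≤X-Y (^-monoˡ-≤ (<⇒≤ 0<κ) κ≤1-X d) ⟩
          (X - Y) * U
            ≡⟨ *-identityˡ ((X - Y) * U) ⟨
          1ℚ * ((X - Y) * U)
            ≤⟨ *-monoʳ-≤ {1ℚ} {ι d} 0≤U′ (ι-mono 1≤d) ⟩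
          ι d * ((X - Y) * U)
            ≡⟨ solve 4 (λ k X Y U → k :* ((X :- Y) :* U) := U :+ k :* ((con 1ℚ :- Y :- (con 1ℚ :- X)) :* U) :- U) refl (ι d) X Y U ⟩
          U + ι d * ((1ℚ - Y - (1ℚ - X)) * U) - U
            ≤⟨ +-monoˡ-≤ (- U) (^-gap (p≤q⇒0≤q-p X≤1) (+-monoʳ-≤ 1ℚ (neg-antimono-≤ Y≤X)) 1-X≤1 d) ⟩
          (1ℚ - Y) ^ d - U ∎
          where
          open ≤-Reasoning
          U : ℚ
          U = (1ℚ - X) ^ d
          0≤X-Y : 0ℚ ≤ X - Y
          0≤X-Y = p≤q⇒0≤q-p Y≤X
          0≤U′ : 0ℚ ≤ (X - Y) * U
          0≤U′ = 0≤* 0≤X-Y (0≤^ (p≤q⇒0≤q-p X≤1) d)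
          1-X≤1 : 1ℚ - X ≤ 1ℚ
          1-X≤1 = ≤-by X (≤-trans 0≤Y Y≤X) (solve 1 (λ c → con 1ℚ := con 1ℚ :- c :+ c) refl X)

        product : x * y * (X - Y) ≤ (y - x) * ((1ℚ - X) * (1ℚ - Y))
        product = subst₂ _≤_
          (solve 4 (λ n a b Z → n :* (n :* (a :* b :* Z)) := n :* a :* (n :* b) :* Z) refl (ι n) a b (X - Y))
          (solve 4 (λ n a b Z → n :* ((b :- a) :* Z) := (n :* b :- n :* a) :* Z) refl (ι n) a b ((1ℚ - X) * (1ℚ - Y)))
          (*-monoˡ-≤ (<⇒≤ 0<n) (ChebyshevSum.chebyshev-sum 0≤a a≤b b≤1 n))

    opaque
      -- In `h-compare` the bracket next to y (1 - Y) is at least ε ≥ 0, so this factor may be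
      -- lowered to A = x (1 - X), which then cancels.
      gap : ∀ {ε} → 0ℚ ≤ ε → ε + ε ≤ l * κ * (γ * η * κ ^ d) → - ε ≤ h (suc d) x X → ε ≤ h (suc d) y Y
      gap {ε} 0≤ε 2ε≤ -ε≤h = *-cancelˡ-≤ A 0<A (begin
        A * ε
          ≤⟨ *-mono-≤ 0≤bY 0≤ε A≤bY ε≤ ⟩
        bY * (h (suc d) x X + A * ((1ℚ - Y) ^ d - (1ℚ - X) ^ d))
          ≤⟨ h-compare d {x} {y} {X} {Y} product ⟩
        A * h (suc d) y Y ∎)
        where
        open ≤-Reasoning
        A bY : ℚ
        A = x * (1ℚ - X)
        bY = y * (1ℚ - Y)
        lκ≤A : l * κ ≤ A
        lκ≤A = *-mono-≤ 0≤x (<⇒≤ 0<κ) l≤na κ≤1-X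
        0<A : 0ℚ < A
        0<A = <-≤-trans (0<* 0<l 0<κ) lκ≤A
        A≤bY : A ≤ bY
        A≤bY = *-mono-≤ (≤-trans 0≤x x≤y) (p≤q⇒0≤q-p X≤1) x≤y (+-monoʳ-≤ 1ℚ (neg-antimono-≤ Y≤X))
        0≤bY : 0ℚ ≤ bY
        0≤bY = ≤-trans (<⇒≤ 0<A) A≤bY
        -- Of the two copies of ε granted by the difference term, one compensates for h possibly
        -- being as low as - ε at x, and the other is what remains.
        ε≤ : ε ≤ h (suc d) x X + A * ((1ℚ - Y) ^ d - (1ℚ - X) ^ d)
        ε≤ = begin
          ε                        ≡⟨ solve 1 (λ e → e := :- e :+ (e :+ e)) refl ε ⟩
          - ε + (ε + ε)            ≤⟨ +-mono-≤ -ε≤h (≤-trans 2ε≤ (*-mono-≤ (<⇒≤ 0<A) (0≤* (0≤* 0≤γ (<⇒≤ 0<η)) (0≤^ (<⇒≤ 0<κ) d)) lκ≤A difference)) ⟩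
          h (suc d) x X + A * ((1ℚ - Y) ^ d - (1ℚ - X) ^ d) ∎

  opaque
    -- Splitting the exponent into at most K blocks of length n / K + 1, each of which
    -- contributes at least 1 / 2.
    power-lower-bound : ∀ B → 0ℚ ≤ B → ∃[ η ] 0ℚ < η × ∃[ N ] ∀ n {e} → N ℕ.≤ n →
      0ℚ ≤ e → e ≤ 1ℚ → ι n * e ≤ B → η ≤ (1ℚ - e) ^ n
    -- With K = k + 1 and block length j = n / K + 1 one has K j ≤ 2 n for n ≥ K. Hence 2 K (j e) ≤
    -- 4 B ≤ K, so j e ≤ 1/2 and Bernoulli's inequality leaves at least 1/2 for each block.
    power-lower-bound B 0≤B with archimedean (B + B + (B + B))
    ... | k , 4B≤k = ½ ^ K , 0<^ (positive⁻¹ ½) K , K , bound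
      where
      open ≤-Reasoning
      K : ℕ
      K = suc k
      bound : ∀ n {e} → K ℕ.≤ n → 0ℚ ≤ e → e ≤ 1ℚ → ι n * e ≤ B → ½ ^ K ≤ (1ℚ - e) ^ n
      bound n {e} K≤n 0≤e e≤1 ne≤B = begin
        ½ ^ K                     ≤⟨ ^-monoˡ-≤ (<⇒≤ (positive⁻¹ ½)) (≤-trans half (bernoulli 0≤e e≤1 j)) K ⟩
        ((1ℚ - e) ^ j) ^ K        ≡⟨ ^-assocʳ (1ℚ - e) j K ⟩
        (1ℚ - e) ^ (j ℕ.* K)      ≤⟨ ^-antitoneʳ (p≤q⇒0≤q-p e≤1) (≤-by e 0≤e (solve 1 (λ e → con 1ℚ := con 1ℚ :- e :+ e) refl e)) n≤jK ⟩
        (1ℚ - e) ^ n              ∎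
        where
        j : ℕ
        j = suc (n ℕ./ K)
        n≤jK : n ℕ.≤ j ℕ.* K
        n≤jK = ℕₚ.≤-trans (ℕₚ.≤-reflexive (m≡m%n+[m/n]*n n K)) (ℕₚ.+-monoˡ-≤ (n ℕ./ K ℕ.* K) (ℕₚ.<⇒≤ (m%n<n n K)))
        Kj≤ : K ℕ.* j ℕ.≤ n ℕ.+ n
        Kj≤ = ℕₚ.≤-trans (ℕₚ.≤-reflexive (ℕₚ.*-comm K j)) (ℕₚ.+-mono-≤ K≤n (m/n*n≤m n K))
        double : ι K * (ι j * e + ι j * e) ≤ ι K * 1ℚ
        double = begin
          ι K * (ι j * e + ι j * e)         ≡⟨ solve 3 (λ K j e → K :* (j :* e :+ j :* e) := K :* j :* e :+ K :* j :* e) refl (ι K) (ι j) e ⟩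
          ι K * ι j * e + ι K * ι j * e     ≡⟨ cong (λ z → z * e + z * e) (sym (ι-* K j)) ⟩
          ι (K ℕ.* j) * e + ι (K ℕ.* j) * e ≤⟨ +-mono-≤ one one ⟩
          (B + B) + (B + B)                 ≤⟨ 4B≤k ⟩
          ι k                               ≤⟨ ι-mono (ℕₚ.n≤1+n k) ⟩
          ι K                               ≡⟨ *-identityʳ (ι K) ⟨
          ι K * 1ℚ                          ∎
          where
          one : ι (K ℕ.* j) * e ≤ B + B
          one = begin
            ι (K ℕ.* j) * e       ≤⟨ *-monoʳ-≤ 0≤e (ι-mono Kj≤) ⟩
            ι (n ℕ.+ n) * e       ≡⟨ cong (_* e) (ι-+ n n) ⟩
            (ι n + ι n) * e       ≡⟨ *-distribʳ-+ e (ι n) (ι n) ⟩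
            ι n * e + ι n * e     ≤⟨ +-mono-≤ ne≤B ne≤B ⟩
            B + B                 ∎
        half : ½ ≤ 1ℚ - ι j * e
        half = ≤-by (½ * (1ℚ - (ι j * e + ι j * e)))
          (0≤* (<⇒≤ (positive⁻¹ ½)) (p≤q⇒0≤q-p (*-cancelˡ-≤ (ι K) (0<ι k) double)))
          (solve 1 (λ z → con 1ℚ :- z := con ½ :+ con ½ :* (con 1ℚ :- (z :+ z))) refl (ι j * e))

-- Partial sums of the exponential series against powers of 1 - e

module Exponential where

  open import Data.Nat as ℕ using (ℕ; zero; suc)
  import Data.Nat.Properties as ℕₚ
  open import Data.Rational using (ℚ; 0ℚ; 1ℚ; ½; _+_; _*_; _-_; -_; _≤_; _<_; ∣_∣)
  open import Data.Rational.Properties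
  open import Data.Rational.Solver using (module +-*-Solver)
  open import Data.Product using (∃-syntax; _,_)
  open import Relation.Binary.PropositionalEquality
  open import Defs using (expTerm; expSum; cauchy; exp; fromℚ)
  open Rational
  open +-*-Solver

  private
    -- the derivative of the k-th term
    D : ℚ → ℕ → ℚ
    D z zero    = 0ℚ
    D z (suc k) = expTerm z k

    D*z : ∀ z k → D z k * z ≡ ι k * expTerm z k
    D*z z zero    = trans (*-zeroˡ z) (sym (*-zeroˡ 1ℚ))
    D*z z (suc k) = begin
      expTerm z k * z                                ≡⟨ sym (*-identityʳ (expTerm z k * z)) ⟩
      expTerm z k * z * 1ℚ                           ≡⟨ cong (expTerm z k * z *_) (sym (ι-1/suc k)) ⟩
      expTerm z k * z * (ι (suc k) * 1/suc k)        ≡⟨ solve 4 (λ t z i j → t :* z :* (i :* j) := i :* (t :* (z :* j))) refl (expTerm z k) z (ι (suc k)) (1/suc k) ⟩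
      ι (suc k) * (expTerm z k * (z * 1/suc k))      ∎
      where open ≡-Reasoning

    D-step : ∀ z k → (expTerm z k + D z k * z) * 1/suc k ≡ expTerm z k
    D-step z k = begin
      (expTerm z k + D z k * z) * 1/suc k              ≡⟨ cong (λ w → (expTerm z k + w) * 1/suc k) (D*z z k) ⟩
      (expTerm z k + ι k * expTerm z k) * 1/suc k      ≡⟨ solve 3 (λ t i j → (t :+ i :* t) :* j := t :* ((con 1ℚ :+ i) :* j)) refl (expTerm z k) (ι k) (1/suc k) ⟩
      expTerm z k * ((1ℚ + ι k) * 1/suc k)             ≡⟨ cong (λ w → expTerm z k * (w * 1/suc k)) (sym (ι-suc k)) ⟩
      expTerm z k * (ι (suc k) * 1/suc k)              ≡⟨ cong (expTerm z k *_) (ι-1/suc k) ⟩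
      expTerm z k * 1ℚ                                 ≡⟨ *-identityʳ (expTerm z k) ⟩
      expTerm z k                                      ∎
      where open ≡-Reasoning

    expTerm-0 : ∀ k → expTerm 0ℚ (suc k) ≡ 0ℚ
    expTerm-0 k = trans (cong (expTerm 0ℚ k *_) (*-zeroˡ (1/suc k))) (*-zeroʳ (expTerm 0ℚ k))

    expSum-0 : ∀ k → expSum 0ℚ (suc k) ≡ 1ℚ
    expSum-0 zero    = refl
    expSum-0 (suc k) = trans (cong₂ _+_ (expSum-0 k) (expTerm-0 k)) (+-identityʳ 1ℚ)

  module Bounds (B : ℚ) (0≤B : 0ℚ ≤ B) where

    u : ℕ → ℚ
    u = expTerm B

    opaque
      0≤u : ∀ k → 0ℚ ≤ u k
      0≤u zero    = 0≤1
      0≤u (suc k) = 0≤* (0≤u k) (0≤* 0≤B (0≤1/suc k))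

      ∣term∣≤ : ∀ {z} → ∣ z ∣ ≤ B → ∀ k → ∣ expTerm z k ∣ ≤ u k
      ∣term∣≤ ∣z∣≤B zero = ≤-refl
      ∣term∣≤ {z} ∣z∣≤B (suc k) = begin
        ∣ expTerm z k * (z * 1/suc k) ∣            ≡⟨ ∣p*q∣≡∣p∣*∣q∣ (expTerm z k) (z * 1/suc k) ⟩
        ∣ expTerm z k ∣ * ∣ z * 1/suc k ∣          ≡⟨ cong (∣ expTerm z k ∣ *_) (∣p*q∣≡∣p∣*∣q∣ z (1/suc k)) ⟩
        ∣ expTerm z k ∣ * (∣ z ∣ * ∣ 1/suc k ∣)    ≡⟨ cong (λ w → ∣ expTerm z k ∣ * (∣ z ∣ * w)) (0≤p⇒∣p∣≡p (0≤1/suc k)) ⟩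
        ∣ expTerm z k ∣ * (∣ z ∣ * 1/suc k)        ≤⟨ *-mono-≤ (0≤u k) (0≤* (0≤∣p∣ z) (0≤1/suc k)) (∣term∣≤ ∣z∣≤B k) (*-monoʳ-≤ (0≤1/suc k) ∣z∣≤B) ⟩
        u k * (B * 1/suc k)                        ∎
        where open ≤-Reasoning

    private
      -- The second derivative of the k-th term at B; it dominates the Taylor remainders below.
      V : ℕ → ℚ
      V zero    = 0ℚ
      V (suc k) = D B k

      opaque
        V*B≤ : ∀ k → V k * B ≤ ι k * D B k
        V*B≤ zero    = ≤-reflexive (trans (*-zeroˡ B) (sym (*-zeroˡ 0ℚ)))
        V*B≤ (suc k) = ≤-trans (≤-reflexive (D*z B k)) (*-monoʳ-≤ (0≤u k) (ι-mono (ℕₚ.n≤1+n k)))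

    module Increment {z s : ℚ} (∣z∣≤B : ∣ z ∣ ≤ B) (∣z+s∣≤B : ∣ z + s ∣ ≤ B) where

      private
        r : ℕ → ℚ
        r k = expTerm (z + s) k - expTerm z k - s * D z k

        r-suc : ∀ k → r (suc k) ≡ (s * s * D z k + r k * (z + s)) * 1/suc k
        r-suc k = begin
          t′ * ((z + s) * j) - t * (z * j) - s * t
            ≡⟨ cong (λ w → t′ * ((z + s) * j) - t * (z * j) - s * w) (sym (D-step z k)) ⟩
          t′ * ((z + s) * j) - t * (z * j) - s * ((t + D z k * z) * j)
            ≡⟨ solve 6 (λ z s j t t′ d → t′ :* ((z :+ s) :* j) :- t :* (z :* j) :- s :* ((t :+ d :* z) :* j) := (s :* s :* d :+ (t′ :- t :- s :* d) :* (z :+ s)) :* j) refl z s j t t′ (D z k) ⟩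
          (s * s * D z k + r k * (z + s)) * j ∎
          where
          open ≡-Reasoning
          j t t′ : ℚ
          j = 1/suc k
          t = expTerm z k
          t′ = expTerm (z + s) k

        opaque
          ∣D∣≤ : ∀ k → ∣ D z k ∣ ≤ D B k
          ∣D∣≤ zero    = ≤-refl
          ∣D∣≤ (suc k) = ∣term∣≤ ∣z∣≤B k

          -- `r` is the first-order Taylor remainder of a single term. By its recurrence the error
          -- is at most s² (D + V B) / (k + 1), and `V*B≤` bounds the bracket by (1 + k) D. The
          -- factor 1/2 of Taylor's theorem is given away.
          ∣r∣≤ : ∀ k → ∣ r k ∣ ≤ s * s * V k
          ∣r∣≤ zero = ≤-reflexive (trans (cong ∣_∣ (solve 1 (λ s → con 1ℚ :- con 1ℚ :- s :* con 0ℚ := con 0ℚ) refl s)) (sym (*-zeroʳ (s * s))))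
          ∣r∣≤ (suc k) = begin
            ∣ r (suc k) ∣
              ≡⟨ cong ∣_∣ (r-suc k) ⟩
            ∣ (s * s * D z k + r k * (z + s)) * j ∣
              ≡⟨ trans (∣p*q∣≡∣p∣*∣q∣ (s * s * D z k + r k * (z + s)) j) (cong (∣ s * s * D z k + r k * (z + s) ∣ *_) (0≤p⇒∣p∣≡p (0≤1/suc k))) ⟩
            ∣ s * s * D z k + r k * (z + s) ∣ * j
              ≤⟨ *-monoʳ-≤ (0≤1/suc k) (∣p+q∣≤∣p∣+∣q∣ (s * s * D z k) (r k * (z + s))) ⟩
            (∣ s * s * D z k ∣ + ∣ r k * (z + s) ∣) * j
              ≡⟨ cong (_* j) (cong₂ _+_ (trans (∣p*q∣≡∣p∣*∣q∣ (s * s) (D z k)) (cong (_* ∣ D z k ∣) (0≤p⇒∣p∣≡p (0≤p² s)))) (∣p*q∣≡∣p∣*∣q∣ (r k) (z + s))) ⟩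
            (s * s * ∣ D z k ∣ + ∣ r k ∣ * ∣ z + s ∣) * j
              ≤⟨ *-monoʳ-≤ (0≤1/suc k) (+-mono-≤ (*-monoˡ-≤ (0≤p² s) (∣D∣≤ k))
                   (*-mono-≤ (≤-trans (0≤∣p∣ (r k)) (∣r∣≤ k)) (0≤∣p∣ (z + s)) (∣r∣≤ k) ∣z+s∣≤B)) ⟩
            (s * s * D B k + s * s * V k * B) * j
              ≡⟨ solve 5 (λ q d v B j → (q :* d :+ q :* v :* B) :* j := q :* (d :+ v :* B) :* j) refl (s * s) (D B k) (V k) B j ⟩
            s * s * (D B k + V k * B) * j
              ≤⟨ *-monoʳ-≤ (0≤1/suc k) (*-monoˡ-≤ (0≤p² s) (+-monoʳ-≤ (D B k) (V*B≤ k))) ⟩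
            s * s * (D B k + ι k * D B k) * j
              ≡⟨ solve 4 (λ q d i j → q :* (d :+ i :* d) :* j := q :* d :* ((con 1ℚ :+ i) :* j)) refl (s * s) (D B k) (ι k) j ⟩
            s * s * D B k * ((1ℚ + ι k) * j)
              ≡⟨ cong (s * s * D B k *_) (trans (cong (_* j) (sym (ι-suc k))) (ι-1/suc k)) ⟩
            s * s * D B k * 1ℚ
              ≡⟨ *-identityʳ (s * s * D B k) ⟩
            s * s * D B k ∎
            where
            open ≤-Reasoning
            j : ℚ
            j = 1/suc k

          -- Each differentiation removes one term, hence the lengths 2 + N, 1 + N and N.
          expSum-taylor : ∀ N → ∣ expSum (z + s) (2 ℕ.+ N) - expSum z (2 ℕ.+ N) - s * expSum z (1 ℕ.+ N) ∣ ≤ s * s * expSum B N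
          expSum-taylor zero = ≤-reflexive (trans
            (cong ∣_∣ (solve 2 (λ z s → con 0ℚ :+ con 1ℚ :+ con 1ℚ :* ((z :+ s) :* con 1ℚ) :- (con 0ℚ :+ con 1ℚ :+ con 1ℚ :* (z :* con 1ℚ)) :- s :* (con 0ℚ :+ con 1ℚ) := con 0ℚ) refl z s))
            (sym (*-zeroʳ (s * s))))
          expSum-taylor (suc N) = begin
            ∣ F′ + T′ - (F + T) - s * (G + U) ∣
              ≡⟨ cong ∣_∣ (solve 7 (λ F′ T′ F T s G U → F′ :+ T′ :- (F :+ T) :- s :* (G :+ U) := (F′ :- F :- s :* G) :+ (T′ :- T :- s :* U)) refl F′ T′ F T s G U) ⟩
            ∣ (F′ - F - s * G) + r (2 ℕ.+ N) ∣
              ≤⟨ ∣p+q∣≤∣p∣+∣q∣ (F′ - F - s * G) (r (2 ℕ.+ N)) ⟩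
            ∣ F′ - F - s * G ∣ + ∣ r (2 ℕ.+ N) ∣
              ≤⟨ +-mono-≤ (expSum-taylor N) (∣r∣≤ (2 ℕ.+ N)) ⟩
            s * s * expSum B N + s * s * u N
              ≡⟨ sym (*-distribˡ-+ (s * s) (expSum B N) (u N)) ⟩
            s * s * (expSum B N + u N) ∎
            where
            open ≤-Reasoning
            F′ F T′ T G U : ℚ
            F′ = expSum (z + s) (2 ℕ.+ N)
            F = expSum z (2 ℕ.+ N)
            T′ = expTerm (z + s) (2 ℕ.+ N)
            T = expTerm z (2 ℕ.+ N)
            G = expSum z (1 ℕ.+ N)
            U = expTerm z (1 ℕ.+ N)

      opaque
        -- The approximate form of exp (z + s) = (1 + s) exp z. A partial sum lacks its last term to
        -- be its own derivative, and that term accounts for the part linear in s.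
        expSum-step : ∀ N → ∣ expSum (z + s) (2 ℕ.+ N) - (1ℚ + s) * expSum z (2 ℕ.+ N) ∣ ≤
          s * s * expSum B N + ∣ s ∣ * u (1 ℕ.+ N)
        expSum-step N = begin
          ∣ F′ - (1ℚ + s) * (G + U) ∣
            ≡⟨ cong ∣_∣ (solve 4 (λ F′ s G U → F′ :- (con 1ℚ :+ s) :* (G :+ U) := (F′ :- (G :+ U) :- s :* G) :+ (:- (s :* U))) refl F′ s G U) ⟩
          ∣ (F′ - (G + U) - s * G) + (- (s * U)) ∣
            ≤⟨ ∣p+q∣≤∣p∣+∣q∣ (F′ - (G + U) - s * G) (- (s * U)) ⟩
          ∣ F′ - (G + U) - s * G ∣ + ∣ - (s * U) ∣
            ≡⟨ cong (∣ F′ - (G + U) - s * G ∣ +_) (trans (∣-p∣≡∣p∣ (s * U)) (∣p*q∣≡∣p∣*∣q∣ s U)) ⟩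
          ∣ F′ - (G + U) - s * G ∣ + ∣ s ∣ * ∣ U ∣
            ≤⟨ +-mono-≤ (expSum-taylor N) (*-monoˡ-≤ (0≤∣p∣ s) (∣term∣≤ ∣z∣≤B (1 ℕ.+ N))) ⟩
          s * s * expSum B N + ∣ s ∣ * u (1 ℕ.+ N) ∎
          where
          open ≤-Reasoning
          F′ G U : ℚ
          F′ = expSum (z + s) (2 ℕ.+ N)
          G = expSum z (1 ℕ.+ N)
          U = expTerm z (1 ℕ.+ N)

    opaque
      -- Taking i steps of length - e from 0: errors made earlier are multiplied by 1 - e ≤ 1, so
      -- they merely add up.
      expSum-power : ∀ N {e} → 0ℚ ≤ e → e ≤ 1ℚ → ∀ i → ι i * e ≤ B →
        ∣ expSum (- (ι i * e)) (2 ℕ.+ N) - (1ℚ - e) ^ i ∣ ≤ ι i * (e * e * expSum B N + e * u (1 ℕ.+ N))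
      expSum-power N {e} 0≤e e≤1 zero ie≤B = ≤-reflexive (begin
        ∣ expSum (- (0ℚ * e)) (2 ℕ.+ N) - 1ℚ ∣         ≡⟨ cong (λ w → ∣ expSum (- w) (2 ℕ.+ N) - 1ℚ ∣) (*-zeroˡ e) ⟩
        ∣ expSum 0ℚ (2 ℕ.+ N) - 1ℚ ∣                   ≡⟨ cong (λ w → ∣ w - 1ℚ ∣) (expSum-0 (1 ℕ.+ N)) ⟩
        0ℚ                                             ≡⟨ *-zeroˡ (e * e * expSum B N + e * u (1 ℕ.+ N)) ⟨
        0ℚ * (e * e * expSum B N + e * u (1 ℕ.+ N))    ∎)
        where open ≡-Reasoning
      expSum-power N {e} 0≤e e≤1 (suc i) ie≤B = begin
        ∣ expSum (- (ι (suc i) * e)) (2 ℕ.+ N) - (1ℚ - e) * P ∣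
          ≡⟨ cong (λ w → ∣ expSum w (2 ℕ.+ N) - (1ℚ - e) * P ∣) z-step ⟩
        ∣ F′ - (1ℚ - e) * P ∣
          ≡⟨ cong ∣_∣ (solve 4 (λ F′ F e P → F′ :- (con 1ℚ :- e) :* P := (F′ :- (con 1ℚ :+ (:- e)) :* F) :+ (con 1ℚ :- e) :* (F :- P)) refl F′ F e P) ⟩
        ∣ (F′ - (1ℚ + (- e)) * F) + (1ℚ - e) * (F - P) ∣
          ≤⟨ ∣p+q∣≤∣p∣+∣q∣ (F′ - (1ℚ + (- e)) * F) ((1ℚ - e) * (F - P)) ⟩
        ∣ F′ - (1ℚ + (- e)) * F ∣ + ∣ (1ℚ - e) * (F - P) ∣
          ≤⟨ +-mono-≤ (Increment.expSum-step {z} { - e} (∣-ie∣≤B i (≤-trans i≤ ie≤B)) (subst (λ w → ∣ w ∣ ≤ B) z-step (∣-ie∣≤B (suc i) ie≤B)) N) shrink ⟩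
        (- e) * (- e) * S + ∣ - e ∣ * U + ι i * (e * e * S + e * U)
          ≡⟨ cong (λ w → (- e) * (- e) * S + w * U + ι i * (e * e * S + e * U)) (trans (∣-p∣≡∣p∣ e) (0≤p⇒∣p∣≡p 0≤e)) ⟩
        (- e) * (- e) * S + e * U + ι i * (e * e * S + e * U)
          ≡⟨ solve 4 (λ e S U i → (:- e) :* (:- e) :* S :+ e :* U :+ i :* (e :* e :* S :+ e :* U) := (con 1ℚ :+ i) :* (e :* e :* S :+ e :* U)) refl e S U (ι i) ⟩
        (1ℚ + ι i) * (e * e * S + e * U)
          ≡⟨ cong (_* (e * e * S + e * U)) (sym (ι-suc i)) ⟩
        ι (suc i) * (e * e * S + e * U) ∎
        where
        open ≤-Reasoning
        z P F′ F S U : ℚ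
        z = - (ι i * e)
        P = (1ℚ - e) ^ i
        F′ = expSum (z + (- e)) (2 ℕ.+ N)
        F = expSum z (2 ℕ.+ N)
        S = expSum B N
        U = u (1 ℕ.+ N)
        z-step : - (ι (suc i) * e) ≡ z + (- e)
        z-step = trans (cong (λ w → - (w * e)) (ι-suc i)) (solve 2 (λ i e → :- ((con 1ℚ :+ i) :* e) := :- (i :* e) :+ (:- e)) refl (ι i) e)
        i≤ : ι i * e ≤ ι (suc i) * e
        i≤ = *-monoʳ-≤ 0≤e (ι-mono (ℕₚ.n≤1+n i))
        ∣-ie∣≤B : ∀ j → ι j * e ≤ B → ∣ - (ι j * e) ∣ ≤ B
        ∣-ie∣≤B j h = subst (_≤ B) (sym (trans (∣-p∣≡∣p∣ (ι j * e)) (0≤p⇒∣p∣≡p (0≤* (0≤ι j) 0≤e)))) h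
        shrink : ∣ (1ℚ - e) * (F - P) ∣ ≤ ι i * (e * e * S + e * U)
        shrink = begin
          ∣ (1ℚ - e) * (F - P) ∣     ≡⟨ ∣p*q∣≡∣p∣*∣q∣ (1ℚ - e) (F - P) ⟩
          ∣ 1ℚ - e ∣ * ∣ F - P ∣     ≡⟨ cong (_* ∣ F - P ∣) (0≤p⇒∣p∣≡p (p≤q⇒0≤q-p e≤1)) ⟩
          (1ℚ - e) * ∣ F - P ∣       ≤⟨ *-monoʳ-≤ {1ℚ - e} {1ℚ} (0≤∣p∣ (F - P)) (≤-by e 0≤e (solve 1 (λ e → con 1ℚ := con 1ℚ :- e :+ e) refl e)) ⟩
          1ℚ * ∣ F - P ∣             ≡⟨ *-identityˡ ∣ F - P ∣ ⟩
          ∣ F - P ∣                  ≤⟨ expSum-power N 0≤e e≤1 i (≤-trans i≤ ie≤B) ⟩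
          ι i * (e * e * S + e * U)  ∎

  opaque
    -- The boundedness of the partial sums and the decay of the terms are read off
    -- from the Cauchy property that is part of the real number exp B.
    expSum≈power : ∀ B → 0ℚ ≤ B → ∀ ε → 0ℚ < ε → ∃[ K ] ∀ k n {e} → K ℕ.≤ k → K ℕ.≤ n →
      0ℚ ≤ e → e ≤ 1ℚ → ι n * e ≤ B → ∣ expSum (- (ι n * e)) k - (1ℚ - e) ^ n ∣ ≤ ε
    -- The choice w = 1 / (1 + 2 B) makes the contribution n e w ε of the last term at most ε / 2.
    -- The contribution n e² M = (n e)² M / n of the quadratic error is at most ε / 2 once n ≥ 2 B²
    -- M / ε, which is the purpose of N₃.
    expSum≈power B 0≤B ε 0<ε with invert (<-≤-trans 0<1 (p≤p+q {1ℚ} (0≤+ 0≤B 0≤B)))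
    ... | w , 0<w , Bw≡1 with cauchy (exp (fromℚ B)) 1ℚ 0<1 | cauchy (exp (fromℚ B)) (w * ε) (0<* 0<w 0<ε)
    ... | N₁ , bounded | N₂ , small with invert 0<ε
    ... | ε⁻¹ , 0<ε⁻¹ , εε⁻¹≡1 with archimedean (B * (B * (expSum B N₁ + 1ℚ)) * (1ℚ + 1ℚ) * ε⁻¹)
    ... | N₃ , large = K , bound
      where
      open ≤-Reasoning
      open Bounds B 0≤B
      M : ℚ
      M = expSum B N₁ + 1ℚ
      K : ℕ
      K = 2 ℕ.+ (N₁ ℕ.+ N₂ ℕ.+ N₃)
      bound : ∀ k n {e} → K ℕ.≤ k → K ℕ.≤ n → 0ℚ ≤ e → e ≤ 1ℚ → ι n * e ≤ B →
        ∣ expSum (- (ι n * e)) k - (1ℚ - e) ^ n ∣ ≤ ε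
      bound (suc (suc k)) n@(suc n-1) {e} (ℕ.s≤s (ℕ.s≤s K≤k)) K≤n 0≤e e≤1 ne≤B = begin
        ∣ expSum (- (ι n * e)) (2 ℕ.+ k) - (1ℚ - e) ^ n ∣
          ≤⟨ expSum-power k 0≤e e≤1 n ne≤B ⟩
        ι n * (e * e * expSum B k + e * u (1 ℕ.+ k))
          ≤⟨ *-monoˡ-≤ (0≤ι n) (+-mono-≤ (*-monoˡ-≤ (0≤p² e) S≤M) (*-monoˡ-≤ 0≤e U≤)) ⟩
        ι n * (e * e * M + e * (w * ε))
          ≡⟨ solve 4 (λ n e M W → n :* (e :* e :* M :+ e :* W) := n :* e :* M :* e :+ n :* e :* W) refl (ι n) e M (w * ε) ⟩
        ι n * e * M * e + ι n * e * (w * ε)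
          ≤⟨ +-mono-≤ first second ⟩
        ½ * ε + ½ * ε
          ≡⟨ solve 1 (λ e → con ½ :* e :+ con ½ :* e := e) refl ε ⟩
        ε ∎
        where
        N₁≤k : N₁ ℕ.≤ k
        N₁≤k = ℕₚ.≤-trans (ℕₚ.≤-trans (ℕₚ.m≤m+n N₁ N₂) (ℕₚ.m≤m+n (N₁ ℕ.+ N₂) N₃)) K≤k
        N₂≤k : N₂ ℕ.≤ k
        N₂≤k = ℕₚ.≤-trans (ℕₚ.≤-trans (ℕₚ.m≤n+m N₂ N₁) (ℕₚ.m≤m+n (N₁ ℕ.+ N₂) N₃)) K≤k
        N₃≤n : N₃ ℕ.≤ n
        N₃≤n = ℕₚ.≤-trans (ℕₚ.≤-trans (ℕₚ.m≤n+m N₃ (N₁ ℕ.+ N₂)) (ℕₚ.m≤n+m (N₁ ℕ.+ N₂ ℕ.+ N₃) 2)) K≤n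
        S≤M : expSum B k ≤ M
        S≤M = begin
          expSum B k                               ≡⟨ solve 2 (λ a b → a := b :+ (a :- b)) refl (expSum B k) (expSum B N₁) ⟩
          expSum B N₁ + (expSum B k - expSum B N₁) ≤⟨ +-monoʳ-≤ (expSum B N₁) (≤-trans (p≤∣p∣ (expSum B k - expSum B N₁)) (<⇒≤ (bounded k N₁ N₁≤k ℕₚ.≤-refl))) ⟩
          M                                        ∎
        0≤M : 0ℚ ≤ M
        0≤M = 0≤+ (0≤S N₁) 0≤1
          where
          0≤S : ∀ j → 0ℚ ≤ expSum B j
          0≤S zero    = ≤-refl
          0≤S (suc j) = 0≤+ (0≤S j) (0≤u j)
        U≤ : u (1 ℕ.+ k) ≤ w * ε
        U≤ = begin
          u (1 ℕ.+ k)                                  ≡⟨ solve 2 (λ a b → a := b :+ a :- b) refl (u (1 ℕ.+ k)) (expSum B (1 ℕ.+ k)) ⟩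
          expSum B (2 ℕ.+ k) - expSum B (1 ℕ.+ k)      ≤⟨ p≤∣p∣ (expSum B (2 ℕ.+ k) - expSum B (1 ℕ.+ k)) ⟩
          ∣ expSum B (2 ℕ.+ k) - expSum B (1 ℕ.+ k) ∣  ≤⟨ <⇒≤ (small (2 ℕ.+ k) (1 ℕ.+ k) (ℕₚ.m≤n⇒m≤1+n (ℕₚ.m≤n⇒m≤1+n N₂≤k)) (ℕₚ.m≤n⇒m≤1+n N₂≤k)) ⟩
          w * ε                                        ∎
        first : ι n * e * M * e ≤ ½ * ε
        first = *-cancelˡ-≤ (ι n) (0<ι n-1) (begin
          ι n * (ι n * e * M * e)              ≡⟨ solve 3 (λ n e M → n :* (n :* e :* M :* e) := n :* e :* (n :* e :* M)) refl (ι n) e M ⟩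
          ι n * e * (ι n * e * M)              ≤⟨ *-mono-≤ 0≤B (0≤* (0≤* (0≤ι n) 0≤e) 0≤M) ne≤B (*-monoʳ-≤ 0≤M ne≤B) ⟩
          B * (B * M)                          ≡⟨ solve 1 (λ x → x := con ½ :* (x :* (con 1ℚ :+ con 1ℚ)) :* con 1ℚ) refl (B * (B * M)) ⟩
          ½ * (B * (B * M) * (1ℚ + 1ℚ)) * 1ℚ   ≡⟨ cong (½ * (B * (B * M) * (1ℚ + 1ℚ)) *_) (sym εε⁻¹≡1) ⟩
          ½ * (B * (B * M) * (1ℚ + 1ℚ)) * (ε * ε⁻¹)
            ≡⟨ solve 4 (λ h b e i → h :* b :* (e :* i) := h :* e :* (b :* i)) refl ½ (B * (B * M) * (1ℚ + 1ℚ)) ε ε⁻¹ ⟩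
          ½ * ε * (B * (B * M) * (1ℚ + 1ℚ) * ε⁻¹)
            ≤⟨ *-monoˡ-≤ (0≤* (<⇒≤ (positive⁻¹ ½)) (<⇒≤ 0<ε)) (≤-trans large (ι-mono N₃≤n)) ⟩
          ½ * ε * ι n                          ≡⟨ *-comm (½ * ε) (ι n) ⟩
          ι n * (½ * ε)                        ∎)
        second : ι n * e * (w * ε) ≤ ½ * ε
        second = begin
          ι n * e * (w * ε)                    ≤⟨ *-monoʳ-≤ (<⇒≤ (0<* 0<w 0<ε)) ne≤B ⟩
          B * (w * ε)                          ≤⟨ ≤-by (½ * (w * ε)) (0≤* (<⇒≤ (positive⁻¹ ½)) (<⇒≤ (0<* 0<w 0<ε)))
                                                    (solve 3 (λ B w e → con ½ :* ((con 1ℚ :+ (B :+ B)) :* w) :* e := B :* (w :* e) :+ con ½ :* (w :* e)) refl B w ε) ⟩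
          ½ * ((1ℚ + (B + B)) * w) * ε         ≡⟨ cong (λ x → ½ * x * ε) Bw≡1 ⟩
          ½ * 1ℚ * ε                           ≡⟨ cong (_* ε) (*-identityʳ ½) ⟩
          ½ * ε                                ∎

-- From the equation for c_d to a uniform positive bound at c

module Drift where

  open import Data.Nat as ℕ using (ℕ; zero; suc)
  import Data.Nat.Properties as ℕₚ
  open import Data.Rational using (ℚ; 0ℚ; 1ℚ; ½; _+_; _*_; _-_; -_; _≤_; _<_; ∣_∣)
  open import Data.Rational.Properties
  open import Data.Rational.Solver using (module +-*-Solver)
  open import Data.Product using (∃-syntax; _×_; _,_; proj₁; proj₂)
  open import Relation.Binary.PropositionalEquality
  open import Defs using (ℝ; seq; cauchy; 0ℝ; 1ℝ; fromℕ; exp; expSum; g)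
    renaming (_<_ to _<ʳ_; _≈_ to _≈ʳ_; _^_ to _^ʳ_; _-_ to _-ʳ_; -_ to -ʳ_)
  open Rational
  open Growth
  open Exponential
  open +-*-Solver

  opaque
    -- The partial sum E may lie outside [0, 1], but ∣X - E∣ ≤ 1 still gives ∣1 - E∣ ≤ 2; this
    -- explains the power of 2 in the constant.
    h-lipschitz : ∀ m {x B X E} → 0ℚ ≤ x → x ≤ B → 0ℚ ≤ X → X ≤ 1ℚ → ∣ X - E ∣ ≤ 1ℚ →
      h m x E - (ι m * (B + 1ℚ) + B * (ι m * (1ℚ + 1ℚ) ^ m)) * ∣ X - E ∣ ≤ h m x X
    h-lipschitz m {x} {B} {X} {E} 0≤x x≤B 0≤X X≤1 near = begin
      h m x E - (ι m * (B + 1ℚ) + B * K) * δ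
        ≡⟨ solve 4 (λ H a b d → H :- (a :+ b) :* d := H :- (a :* d :+ b :* d)) refl (h m x E) (ι m * (B + 1ℚ)) (B * K) δ ⟩
      h m x E - (ι m * (B + 1ℚ) * δ + B * K * δ)
        ≤⟨ +-monoʳ-≤ (h m x E) (neg-antimono-≤ (+-mono-≤ linear power)) ⟩
      h m x E - (- (ι m * (x + 1ℚ) * (X - E)) + - (x * (P - Q)))
        ≡⟨ solve 6 (λ m x X E P Q → m :* (x :+ con 1ℚ) :* E :+ x :* Q :- m :- (:- (m :* (x :+ con 1ℚ) :* (X :- E)) :+ :- (x :* (P :- Q))) := m :* (x :+ con 1ℚ) :* X :+ x :* P :- m) refl (ι m) x X E P Q ⟩
      h m x X ∎
      where
      open ≤-Reasoning
      δ K P Q : ℚ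
      δ = ∣ X - E ∣
      K = ι m * (1ℚ + 1ℚ) ^ m
      P = (1ℚ - X) ^ m
      Q = (1ℚ - E) ^ m
      linear : - (ι m * (x + 1ℚ) * (X - E)) ≤ ι m * (B + 1ℚ) * δ
      linear = begin
        - (ι m * (x + 1ℚ) * (X - E))     ≤⟨ -p≤∣p∣ (ι m * (x + 1ℚ) * (X - E)) ⟩
        ∣ ι m * (x + 1ℚ) * (X - E) ∣     ≡⟨ ∣p*q∣≡∣p∣*∣q∣ (ι m * (x + 1ℚ)) (X - E) ⟩
        ∣ ι m * (x + 1ℚ) ∣ * δ           ≡⟨ cong (_* δ) (0≤p⇒∣p∣≡p (0≤* (0≤ι m) (0≤+ 0≤x 0≤1))) ⟩
        ι m * (x + 1ℚ) * δ               ≤⟨ *-monoʳ-≤ (0≤∣p∣ (X - E)) (*-monoˡ-≤ (0≤ι m) (+-monoˡ-≤ 1ℚ x≤B)) ⟩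
        ι m * (B + 1ℚ) * δ               ∎
      ∣1-X∣≤2 : ∣ 1ℚ - X ∣ ≤ 1ℚ + 1ℚ
      ∣1-X∣≤2 = ≤-trans (≤-reflexive (0≤p⇒∣p∣≡p (p≤q⇒0≤q-p X≤1)))
        (≤-by (1ℚ + X) (0≤+ 0≤1 0≤X) (solve 1 (λ X → con 1ℚ :+ con 1ℚ := con 1ℚ :- X :+ (con 1ℚ :+ X)) refl X))
      ∣1-E∣≤2 : ∣ 1ℚ - E ∣ ≤ 1ℚ + 1ℚ
      ∣1-E∣≤2 = begin
        ∣ 1ℚ - E ∣                   ≡⟨ cong ∣_∣ (solve 2 (λ X E → con 1ℚ :- E := (con 1ℚ :- X) :+ (X :- E)) refl X E) ⟩
        ∣ (1ℚ - X) + (X - E) ∣       ≤⟨ ∣p+q∣≤∣p∣+∣q∣ (1ℚ - X) (X - E) ⟩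
        ∣ 1ℚ - X ∣ + ∣ X - E ∣       ≤⟨ +-mono-≤ (≤-trans (≤-reflexive (0≤p⇒∣p∣≡p (p≤q⇒0≤q-p X≤1)))
                                         (≤-by X 0≤X (solve 1 (λ X → con 1ℚ := con 1ℚ :- X :+ X) refl X))) near ⟩
        1ℚ + 1ℚ                      ∎
      power : - (x * (P - Q)) ≤ B * K * δ
      power = begin
        - (x * (P - Q))                           ≤⟨ -p≤∣p∣ (x * (P - Q)) ⟩
        ∣ x * (P - Q) ∣                           ≡⟨ ∣p*q∣≡∣p∣*∣q∣ x (P - Q) ⟩
        ∣ x ∣ * ∣ P - Q ∣                         ≡⟨ cong (_* ∣ P - Q ∣) (0≤p⇒∣p∣≡p 0≤x) ⟩
        x * ∣ P - Q ∣                             ≤⟨ *-mono-≤ (≤-trans 0≤x x≤B) (0≤∣p∣ (P - Q)) x≤B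
                                                       (^-lipschitz ∣1-X∣≤2 ∣1-E∣≤2 (p≤p+q 0≤1) m) ⟩
        B * (K * ∣ (1ℚ - X) - (1ℚ - E) ∣)         ≡⟨ cong (λ z → B * (K * z)) (trans (cong ∣_∣ (solve 2 (λ X E → (con 1ℚ :- X) :- (con 1ℚ :- E) := :- (X :- E)) refl X E)) (∣-p∣≡∣p∣ (X - E))) ⟩
        B * (K * δ)                               ≡⟨ sym (*-assoc B K δ) ⟩
        B * K * δ                                 ∎

  seq-^ : ∀ (x : ℝ) n k → seq (x ^ʳ n) k ≡ seq x k ^ n
  seq-^ x zero    k = refl
  seq-^ x (suc n) k = cong (seq x k *_) (seq-^ x n k)

  seq-g : ∀ d (x : ℝ) k → seq (g d x) k - seq (fromℕ (suc d)) k ≡ h (suc d) (seq x k) (expSum (- seq x k) k)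
  seq-g d x k = cong (λ z → ι (suc d) * (seq x k + 1ℚ) * E + seq x k * ((1ℚ - E) * z) - ι (suc d)) (seq-^ (1ℝ -ʳ exp (-ʳ x)) d k)
    where
    E : ℚ
    E = expSum (- seq x k) k

  -- Here k indexes the rational approximations of c, n + 1 is the number of vertices
  -- and e = c / (n + 1) is the inclusion probability.
  UniformDrift : ℕ → ℝ → Set
  UniformDrift d c = ∃[ δ ] 0ℚ < δ × ∃[ B ] 0ℚ ≤ B × ∃[ K ] ∀ k n → K ℕ.≤ k → K ℕ.≤ suc n →
    let e = seq c k * 1/suc n in
    0ℚ ≤ e × e ≤ 1ℚ × ι (suc n) * e ≤ B × δ ≤ h (suc d) (ι (suc n) * e) ((1ℚ - e) ^ suc n)

  module Step (d : ℕ) (1≤d : 1 ℕ.≤ d) (n : ℕ) {x y E B l γ η κ ε : ℚ}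
    (0<l : 0ℚ < l) (l≤x : l ≤ x) (0≤γ : 0ℚ ≤ γ) (x+γ≤y : x + γ ≤ y) (y≤B : y ≤ B) (B≤n : B ≤ ι (suc n)) where

    private
      a b X : ℚ
      a = x * 1/suc n
      b = y * 1/suc n
      X = (1ℚ - a) ^ suc n

    opaque
      n* : ∀ z → ι (suc n) * (z * 1/suc n) ≡ z
      n* z = trans (solve 3 (λ i z j → i :* (z :* j) := z :* (i :* j)) refl (ι (suc n)) z (1/suc n)) (trans (cong (z *_) (ι-1/suc n)) (*-identityʳ z))
      x≤y : x ≤ y
      x≤y = ≤-trans (p≤p+q 0≤γ) x+γ≤y
      0≤x : 0ℚ ≤ x
      0≤x = ≤-trans (<⇒≤ 0<l) l≤x
      scale : ∀ {z} → z ≤ B → z * 1/suc n ≤ 1ℚ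
      scale {z} z≤B = ≤-trans (*-monoʳ-≤ (0≤1/suc n) (≤-trans z≤B B≤n)) (≤-reflexive (ι-1/suc n))
      0≤a : 0ℚ ≤ a
      0≤a = 0≤* 0≤x (0≤1/suc n)
      a≤1 : a ≤ 1ℚ
      a≤1 = scale (≤-trans x≤y y≤B)
      0≤b : 0ℚ ≤ b
      0≤b = 0≤* (≤-trans 0≤x x≤y) (0≤1/suc n)
      b≤1 : b ≤ 1ℚ
      b≤1 = scale y≤B
      na≤B : ι (suc n) * a ≤ B
      na≤B = subst (_≤ B) (sym (n* x)) (≤-trans x≤y y≤B)
      nb≤B : ι (suc n) * b ≤ B
      nb≤B = subst (_≤ B) (sym (n* y)) y≤B

      step : 0ℚ < η → η ≤ (1ℚ - b) ^ suc n → 0ℚ < κ → κ * (1ℚ + B) ≤ l →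
        0ℚ ≤ ε → ε + ε ≤ l * κ * (γ * η * κ ^ d) →
        ∣ E - X ∣ ≤ 1ℚ →
        (ι (suc d) * (B + 1ℚ) + B * (ι (suc d) * (1ℚ + 1ℚ) ^ suc d)) * ∣ E - X ∣ ≤ ½ * ε →
        - (½ * ε) ≤ h (suc d) x E →
        ε ≤ h (suc d) (ι (suc n) * b) ((1ℚ - b) ^ suc n)
      step 0<η η≤ 0<κ κ≤ 0≤ε 2ε≤ near close small =
        Gap.gap d 1≤d (suc n) (0<ι n) 0<l (subst (l ≤_) (sym (n* x)) l≤x) na≤B 0≤γ
          (subst₂ (λ u v → u + γ ≤ v) (sym (n* x)) (sym (n* y)) x+γ≤y) b≤1 0<η η≤ 0<κ κ≤ 0≤ε 2ε≤
          (subst (λ z → - ε ≤ h (suc d) z X) (sym (n* x)) -ε≤h)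
        where
        open ≤-Reasoning
        L : ℚ
        L = ι (suc d) * (B + 1ℚ) + B * (ι (suc d) * (1ℚ + 1ℚ) ^ suc d)
        0≤1-a : 0ℚ ≤ 1ℚ - a
        0≤1-a = p≤q⇒0≤q-p a≤1
        ∣X-E∣≡ : ∣ E - X ∣ ≡ ∣ X - E ∣
        ∣X-E∣≡ = trans (sym (∣-p∣≡∣p∣ (E - X))) (cong ∣_∣ (solve 2 (λ E X → :- (E :- X) := X :- E) refl E X))
        -- One half of ε covers the error of c_d's equation at a finite index, the other the
        -- replacement of the partial sum E by the power X.
        -ε≤h : - ε ≤ h (suc d) x X
        -ε≤h = begin
          - ε                                ≡⟨ solve 1 (λ e → :- e := :- (con ½ :* e) :- con ½ :* e) refl ε ⟩
          - (½ * ε) - ½ * ε                  ≤⟨ +-mono-≤ small (neg-antimono-≤ (subst (λ z → L * z ≤ ½ * ε) ∣X-E∣≡ close)) ⟩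
          h (suc d) x E - L * ∣ X - E ∣      ≤⟨ h-lipschitz (suc d) {x} {B} {X} {E} 0≤x (≤-trans x≤y y≤B) (0≤^ 0≤1-a (suc n))
                                                  (^≤1 0≤1-a (≤-by a 0≤a (solve 1 (λ c → con 1ℚ := con 1ℚ :- c :+ c) refl a)) (suc n)) (subst (_≤ 1ℚ) ∣X-E∣≡ near) ⟩
          h (suc d) x X                      ∎

  opaque
    bounded-above : (x : ℝ) → ∃[ B ] 0ℚ ≤ B × ∃[ N ] ∀ k → N ℕ.≤ k → seq x k ≤ B
    bounded-above x with cauchy x 1ℚ 0<1
    ... | N , close = ∣ seq x N ∣ + 1ℚ , 0≤+ (0≤∣p∣ (seq x N)) 0≤1 , N , λ k N≤k → begin
      seq x k                        ≡⟨ solve 2 (λ y z → y := z :+ (y :- z)) refl (seq x k) (seq x N) ⟩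
      seq x N + (seq x k - seq x N)  ≤⟨ +-mono-≤ (p≤∣p∣ (seq x N)) (≤-trans (p≤∣p∣ (seq x k - seq x N)) (<⇒≤ (close k N N≤k ℕₚ.≤-refl))) ⟩
      ∣ seq x N ∣ + 1ℚ               ∎
      where open ≤-Reasoning

    -- Dividing by 1 + L instead of L includes the case L = 0.
    divide : ∀ L ε → 0ℚ ≤ L → 0ℚ < ε → ∃[ δ ] 0ℚ < δ × L * δ ≤ ε
    divide L ε 0≤L 0<ε with invert {1ℚ + L} (<-≤-trans 0<1 (p≤p+q 0≤L))
    ... | w , 0<w , eq = w * ε , 0<* 0<w 0<ε , (begin
      L * (w * ε)              ≤⟨ ≤-by (w * ε) (<⇒≤ (0<* 0<w 0<ε)) (solve 3 (λ L w e → (con 1ℚ :+ L) :* w :* e := L :* (w :* e) :+ w :* e) refl L w ε) ⟩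
      (1ℚ + L) * w * ε         ≡⟨ cong (_* ε) eq ⟩
      1ℚ * ε                   ≡⟨ *-identityˡ ε ⟩
      ε                        ∎)
      where open ≤-Reasoning

    near-solution : ∀ d (c₀ : ℝ) → g d c₀ ≈ʳ fromℕ (suc d) → ∀ ε → 0ℚ < ε →
      ∃[ N ] ∀ k → N ℕ.≤ k → - ε ≤ h (suc d) (seq c₀ k) (expSum (- seq c₀ k) k)
    near-solution d c₀ sol ε 0<ε with sol ε 0<ε
    ... | N , solved = N , λ k N≤k → begin
      - ε                                                          ≤⟨ neg-antimono-≤ (<⇒≤ (solved k N≤k)) ⟩
      - ∣ seq (g d c₀) k - seq (fromℕ (suc d)) k ∣                 ≤⟨ neg-antimono-≤ (-p≤∣p∣ (seq (g d c₀) k - seq (fromℕ (suc d)) k)) ⟩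
      - (- (seq (g d c₀) k - seq (fromℕ (suc d)) k))               ≡⟨ solve 1 (λ z → :- (:- z) := z) refl (seq (g d c₀) k - seq (fromℕ (suc d)) k) ⟩
      seq (g d c₀) k - seq (fromℕ (suc d)) k                       ≡⟨ seq-g d c₀ k ⟩
      h (suc d) (seq c₀ k) (expSum (- seq c₀ k) k)                 ∎
      where open ≤-Reasoning

  module Constants (d : ℕ) (1≤d : 1 ℕ.≤ d) (c₀ c : ℝ) (sol : g d c₀ ≈ʳ fromℕ (suc d))
    (l : ℚ) (0<l : 0ℚ < l) (N₁ : ℕ) (l≤ : ∀ k → N₁ ℕ.≤ k → l ≤ seq c₀ k)
    (γ : ℚ) (0<γ : 0ℚ < γ) (N₂ : ℕ) (γ≤ : ∀ k → N₂ ℕ.≤ k → seq c₀ k + γ ≤ seq c k)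
    (B : ℚ) (0≤B : 0ℚ ≤ B) (N₃ : ℕ) (≤B : ∀ k → N₃ ℕ.≤ k → seq c k ≤ B)
    (κ : ℚ) (0<κ : 0ℚ < κ) (κ≤ : (1ℚ + B) * κ ≤ l)
    (η : ℚ) (0<η : 0ℚ < η) (N₄ : ℕ)
    (η≤ : ∀ n {e} → N₄ ℕ.≤ n → 0ℚ ≤ e → e ≤ 1ℚ → ι n * e ≤ B → η ≤ (1ℚ - e) ^ n)
    (ε : ℚ) (0<ε : 0ℚ < ε) (2ε≤ : ε + ε ≤ l * κ * (γ * η * κ ^ d)) where

    private
      L : ℚ
      L = ι (suc d) * (B + 1ℚ) + B * (ι (suc d) * (1ℚ + 1ℚ) ^ suc d)

      0<½ε : 0ℚ < ½ * ε
      0<½ε = 0<* (positive⁻¹ ½) 0<ε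

      0≤L : 0ℚ ≤ L
      0≤L = 0≤+ (0≤* (0≤ι (suc d)) (0≤+ 0≤B 0≤1)) (0≤* 0≤B (0≤* (0≤ι (suc d)) (0≤^ (0≤+ 0≤1 0≤1) (suc d))))

      opaque
        solution-bound : ∃[ N ] ∀ k → N ℕ.≤ k → - (½ * ε) ≤ h (suc d) (seq c₀ k) (expSum (- seq c₀ k) k)
        solution-bound = near-solution d c₀ sol (½ * ε) 0<½ε

        tolerance : ∃[ δ ] 0ℚ < δ × L * δ ≤ ½ * ε
        tolerance = divide L (½ * ε) 0≤L 0<½ε

      ε₁ : ℚ
      ε₁ = proj₁ tolerance

      Approximates : ℚ → ℕ → Set
      Approximates ε N = ∀ k n {e} → N ℕ.≤ k → N ℕ.≤ n → 0ℚ ≤ e → e ≤ 1ℚ → ι n * e ≤ B →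
        ∣ expSum (- (ι n * e)) k - (1ℚ - e) ^ n ∣ ≤ ε

      opaque
        close : ∃[ N ] Approximates ε₁ N
        close = expSum≈power B 0≤B ε₁ (proj₁ (proj₂ tolerance))

        near : ∃[ N ] Approximates 1ℚ N
        near = expSum≈power B 0≤B 1ℚ 0<1

        size : ∃[ N ] B ≤ ι N
        size = archimedean B

      N₅ N₆ N₇ N₈ : ℕ
      N₅ = proj₁ solution-bound
      N₆ = proj₁ close
      N₇ = proj₁ near
      N₈ = proj₁ size

      -- One threshold for both indices: N₁, N₂, N₃ and N₅ concern the approximation index, N₄ and
      -- N₈ the number of vertices, N₆ and N₇ both.
      K : ℕ
      K = N₁ ℕ.+ (N₂ ℕ.+ (N₃ ℕ.+ (N₄ ℕ.+ (N₅ ℕ.+ (N₆ ℕ.+ (N₇ ℕ.+ N₈))))))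
      rest : ∀ m {n j} → m ℕ.+ n ℕ.≤ j → n ℕ.≤ j
      rest m {n} h = ℕₚ.≤-trans (ℕₚ.m≤n+m n m) h
      result : ∀ k n → K ℕ.≤ k → K ℕ.≤ suc n → let e = seq c k * 1/suc n in
        0ℚ ≤ e × e ≤ 1ℚ × ι (suc n) * e ≤ B × ε ≤ h (suc d) (ι (suc n) * e) ((1ℚ - e) ^ suc n)
      result k n K≤k K≤n = 0≤b , b≤1 , nb≤B , step
        0<η (η≤ (suc n) (ℕₚ.m+n≤o⇒m≤o N₄ n₄) 0≤b b≤1 nb≤B) 0<κ (≤-trans (≤-reflexive (*-comm κ (1ℚ + B))) κ≤) (<⇒≤ 0<ε) 2ε≤
        (approximate (proj₂ near) (ℕₚ.m+n≤o⇒m≤o N₇ (rest N₆ k₆)) (ℕₚ.m+n≤o⇒m≤o N₇ (rest N₆ n₆)))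
        (≤-trans (*-monoˡ-≤ 0≤L (approximate (proj₂ close) (ℕₚ.m+n≤o⇒m≤o N₆ k₆) (ℕₚ.m+n≤o⇒m≤o N₆ n₆))) (proj₂ (proj₂ tolerance)))
        (proj₂ solution-bound k (ℕₚ.m+n≤o⇒m≤o N₅ k₅))
        where
        k₂ : N₂ ℕ.+ (N₃ ℕ.+ (N₄ ℕ.+ (N₅ ℕ.+ (N₆ ℕ.+ (N₇ ℕ.+ N₈))))) ℕ.≤ k
        k₂ = rest N₁ K≤k
        k₅ : N₅ ℕ.+ (N₆ ℕ.+ (N₇ ℕ.+ N₈)) ℕ.≤ k
        k₅ = rest N₄ (rest N₃ (rest N₂ k₂))
        k₆ : N₆ ℕ.+ (N₇ ℕ.+ N₈) ℕ.≤ k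
        k₆ = rest N₅ k₅
        n₄ : N₄ ℕ.+ (N₅ ℕ.+ (N₆ ℕ.+ (N₇ ℕ.+ N₈))) ℕ.≤ suc n
        n₄ = rest N₃ (rest N₂ (rest N₁ K≤n))
        n₆ : N₆ ℕ.+ (N₇ ℕ.+ N₈) ℕ.≤ suc n
        n₆ = rest N₅ (rest N₄ n₄)
        open Step d 1≤d n {seq c₀ k} {seq c k} {expSum (- seq c₀ k) k} {B} {l} {γ} {η} {κ} {ε} 0<l (l≤ k (ℕₚ.m+n≤o⇒m≤o N₁ K≤k)) (<⇒≤ 0<γ)
          (γ≤ k (ℕₚ.m+n≤o⇒m≤o N₂ k₂)) (≤B k (ℕₚ.m+n≤o⇒m≤o N₃ (rest N₂ k₂)))
          (≤-trans (proj₂ size) (ι-mono (rest N₇ (rest N₆ n₆))))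
        approximate : ∀ {N ε} → Approximates ε N → N ℕ.≤ k → N ℕ.≤ suc n →
          ∣ expSum (- seq c₀ k) k - (1ℚ - seq c₀ k * 1/suc n) ^ suc n ∣ ≤ ε
        approximate {N} {ε} approx N≤k N≤n =
          subst (λ z → ∣ expSum (- z) k - (1ℚ - seq c₀ k * 1/suc n) ^ suc n ∣ ≤ ε) (n* (seq c₀ k))
            (approx k (suc n) N≤k N≤n 0≤a a≤1 na≤B)

    opaque
      uniform-drift : UniformDrift d c
      uniform-drift = ε , 0<ε , B , 0≤B , K , result

  opaque
    drift : ∀ d → 1 ℕ.≤ d → (c₀ : ℝ) → 0ℝ <ʳ c₀ → g d c₀ ≈ʳ fromℕ (suc d) → (c : ℝ) → c₀ <ʳ c → UniformDrift d c
    drift d 1≤d c₀ (l , 0<l , N₁ , l<) sol c (γ , 0<γ , N₂ , γ<) with bounded-above c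
    ... | B , 0≤B , N₃ , ≤B with divide (1ℚ + B) l (0≤+ 0≤1 0≤B) 0<l | power-lower-bound B 0≤B
    ... | κ , 0<κ , κ≤ | η , 0<η , N₄ , η≤ with 0<* (0<* 0<l 0<κ) (0<* (0<* 0<γ 0<η) (0<^ 0<κ d))
    ... | 0<A = Constants.uniform-drift d 1≤d c₀ c sol
      l 0<l N₁ (λ k N₁≤k → <⇒≤ (subst (_< seq c₀ k) (+-identityˡ l) (l< k N₁≤k)))
      γ 0<γ N₂ (λ k N₂≤k → <⇒≤ (γ< k N₂≤k)) B 0≤B N₃ ≤B κ 0<κ κ≤ η 0<η N₄ η≤
      (½ * A) (0<* (positive⁻¹ ½) 0<A) (≤-reflexive (solve 1 (λ x → con ½ :* x :+ con ½ :* x := x) refl A))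
      where
      A : ℚ
      A = l * κ * (γ * η * κ ^ d)

-- The mean of W and the probability of a large deviation

module Tail where

  open import Data.Bool using (Bool; true; T?)
  open import Data.List using (List; []; _∷_; _++_; length; map; filterᵇ)
  open import Data.List.Membership.Propositional using (_∈_)
  open import Data.List.Membership.Propositional.Properties using (∈-filter⁻; ∈-map⁻)
  open import Data.List.Properties using (length-map)
  open import Data.List.Relation.Unary.Any using (here; there)
  open import Data.List.Relation.Unary.Unique.Propositional using (Unique)
  open import Data.List.Relation.Binary.Sublist.Propositional using (_⊆_)
  open import Data.Nat as ℕ using (ℕ; suc)
  import Data.Nat.Properties as ℕₚ
  open import Data.Product using (_,_; proj₁)
  open import Data.Rational using (ℚ; 0ℚ; 1ℚ; _+_; _*_; _-_; -_; _≤_; _<_; ∣_∣)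
  open import Data.Rational.Properties
  open import Data.Rational.Solver using (module +-*-Solver)
  open import Function using (_∘_)
  open import Relation.Binary.Definitions using (DecidableEquality)
  open import Relation.Binary.PropositionalEquality
  open Rational
  open ListSum
  open Growth using (h)
  open +-*-Solver

  opaque
    -- For n = d + 1 + k vertices, a (d-1)-simplex has k + 1 cofaces, so the mean involves the
    -- exponents k + 1 and k where `h` has n. Since qⁿ ≤ qᵏ⁺¹, the first change helps. Shortening n
    -- e to (k + 1) e costs at most e (m d + d). Passing from (1 - qⁿ)ᵐ to (1 - qᵏ)ᵐ costs at most m
    -- (m e), by `^-lipschitz` and Bernoulli's inequality, and this is multiplied by (k + 1) e ≤ B.
    mean-bound : ∀ d k {e B δ} → 0ℚ ≤ e → e ≤ 1ℚ → ι (suc d ℕ.+ k) * e ≤ B →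
      δ ≤ h (suc d) (ι (suc d ℕ.+ k) * e) ((1ℚ - e) ^ (suc d ℕ.+ k)) →
      ι (suc d) + (δ - e * (ι (suc d) * ι d + ι d + ι (suc d) * ι (suc d) * B)) ≤
      ι (suc d) * ((1ℚ - e) ^ suc k * (1ℚ + ι (suc k) * e)) + ι (suc k) * (e * (1ℚ - (1ℚ - e) ^ k) ^ suc d)
    mean-bound d k {e} {B} {δ} 0≤e e≤1 y≤B δ≤h = begin
      m + (δ - e * (m * D + D + m * m * B))
        ≤⟨ +-monoʳ-≤ m (+-mono-≤ δ≤h (neg-antimono-≤ (*-monoˡ-≤ 0≤e (+-monoʳ-≤ (m * D + D) (*-monoˡ-≤ (0≤p² m) Ne≤B))))) ⟩
      m + (m * (y + 1ℚ) * t + y * U - m - e * (m * D + D + m * m * (N * e)))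
        ≡⟨ cong (λ z → m + (m * (z + 1ℚ) * t + z * U - m - e * (m * D + D + m * m * (N * e)))) y≡ ⟩
      m + (m * (D * e + N * e + 1ℚ) * t + (D * e + N * e) * U - m - e * (m * D + D + m * m * (N * e)))
        ≤⟨ ≤-by (e * (m * D) * (1ℚ - t) + e * D * (1ℚ - U))
             (0≤+ (0≤* (0≤* 0≤e (0≤* 0≤m (0≤ι d))) (p≤q⇒0≤q-p t≤1)) (0≤* (0≤* 0≤e (0≤ι d)) (p≤q⇒0≤q-p U≤1)))
             (solve 6 (λ m D e N t U → m :* (t :* (con 1ℚ :+ N :* e)) :+ N :* (e :* (U :- m :* (m :* e))) := m :+ (m :* (D :* e :+ N :* e :+ con 1ℚ) :* t :+ (D :* e :+ N :* e) :* U :- m :- e :* (m :* D :+ D :+ m :* m :* (N :* e)))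
                :+ (e :* (m :* D) :* (con 1ℚ :- t) :+ e :* D :* (con 1ℚ :- U))) refl m D e N t U) ⟩
      m * (t * (1ℚ + N * e)) + N * (e * (U - m * (m * e)))
        ≤⟨ +-mono-≤ (*-monoˡ-≤ 0≤m (*-monoʳ-≤ (0≤+ 0≤1 (0≤* 0≤N 0≤e)) t≤)) (*-monoˡ-≤ 0≤N (*-monoˡ-≤ 0≤e U≤)) ⟩
      m * (q ^ suc k * (1ℚ + N * e)) + N * (e * (1ℚ - q ^ k) ^ suc d) ∎
      where
      open ≤-Reasoning
      m D N y q t U : ℚ
      m = ι (suc d)
      D = ι d
      N = ι (suc k)
      y = ι (suc d ℕ.+ k) * e
      q = 1ℚ - e
      t = q ^ (suc d ℕ.+ k)
      U = (1ℚ - t) ^ suc d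
      0≤m : 0ℚ ≤ m
      0≤m = 0≤ι (suc d)
      0≤N : 0ℚ ≤ N
      0≤N = 0≤ι (suc k)
      y≡ : y ≡ D * e + N * e
      y≡ = trans (cong (_* e) (trans (cong ι (sym (ℕₚ.+-suc d k))) (ι-+ d (suc k)))) (*-distribʳ-+ e D N)
      Ne≤B : N * e ≤ B
      Ne≤B = ≤-trans (*-monoʳ-≤ 0≤e (ι-mono (ℕ.s≤s (ℕₚ.m≤n+m k d)))) y≤B
      0≤q : 0ℚ ≤ q
      0≤q = p≤q⇒0≤q-p e≤1
      q≤1 : q ≤ 1ℚ
      q≤1 = ≤-by e 0≤e (solve 1 (λ c → con 1ℚ := con 1ℚ :- c :+ c) refl e)
      0≤t : 0ℚ ≤ t
      0≤t = 0≤^ 0≤q (suc d ℕ.+ k)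
      t≤1 : t ≤ 1ℚ
      t≤1 = ^≤1 0≤q q≤1 (suc d ℕ.+ k)
      t≤ : t ≤ q ^ suc k
      t≤ = ^-antitoneʳ 0≤q q≤1 (ℕ.s≤s (ℕₚ.m≤n+m k d))
      r : ℚ
      r = q ^ k
      0≤r : 0ℚ ≤ r
      0≤r = 0≤^ 0≤q k
      r≤1 : r ≤ 1ℚ
      r≤1 = ^≤1 0≤q q≤1 k
      1-≤1 : ∀ {c} → 0ℚ ≤ c → 1ℚ - c ≤ 1ℚ
      1-≤1 {c} 0≤c = ≤-by c 0≤c (solve 1 (λ c → con 1ℚ := con 1ℚ :- c :+ c) refl c)
      ∣1-_∣≤1 : ∀ {c} → 0ℚ ≤ c → c ≤ 1ℚ → ∣ 1ℚ - c ∣ ≤ 1ℚ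
      ∣1-_∣≤1 0≤c c≤1 = ≤-trans (≤-reflexive (0≤p⇒∣p∣≡p (p≤q⇒0≤q-p c≤1))) (1-≤1 0≤c)
      U≤1 : U ≤ 1ℚ
      U≤1 = ^≤1 (p≤q⇒0≤q-p t≤1) (1-≤1 0≤t) (suc d)
      t≤r : t ≤ r
      t≤r = ^-antitoneʳ 0≤q q≤1 (ℕₚ.m≤n+m k (suc d))
      r-t≤ : r - t ≤ m * e
      r-t≤ = begin
        r - t                     ≡⟨ cong (λ z → r - z) (^-homo-* q (suc d) k) ⟩
        r - q ^ suc d * r         ≡⟨ solve 2 (λ r s → r :- s :* r := r :* (con 1ℚ :- s)) refl r (q ^ suc d) ⟩
        r * (1ℚ - q ^ suc d)      ≤⟨ *-mono-≤ 0≤1 (p≤q⇒0≤q-p (^≤1 0≤q q≤1 (suc d))) r≤1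
                                       (+-monoʳ-≤ 1ℚ (neg-antimono-≤ (bernoulli 0≤e e≤1 (suc d)))) ⟩
        1ℚ * (1ℚ - (1ℚ - m * e))  ≡⟨ solve 1 (λ z → con 1ℚ :* (con 1ℚ :- (con 1ℚ :- z)) := z) refl (m * e) ⟩
        m * e                     ∎
      U≤ : U - m * (m * e) ≤ (1ℚ - r) ^ suc d
      U≤ = begin
        U - m * (m * e)                               ≤⟨ +-monoʳ-≤ U (neg-antimono-≤ lipschitz) ⟩
        U - (U - (1ℚ - r) ^ suc d)                    ≡⟨ solve 2 (λ a b → a :- (a :- b) := b) refl U ((1ℚ - r) ^ suc d) ⟩
        (1ℚ - r) ^ suc d                              ∎
        where
        lipschitz : U - (1ℚ - r) ^ suc d ≤ m * (m * e)
        lipschitz = begin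
          U - (1ℚ - r) ^ suc d                        ≤⟨ p≤∣p∣ (U - (1ℚ - r) ^ suc d) ⟩
          ∣ U - (1ℚ - r) ^ suc d ∣                    ≤⟨ ^-lipschitz {1ℚ - t} {1ℚ - r} (∣1-_∣≤1 0≤t t≤1) (∣1-_∣≤1 0≤r r≤1) ≤-refl (suc d) ⟩
          m * 1ℚ ^ suc d * ∣ (1ℚ - t) - (1ℚ - r) ∣    ≡⟨ cong₂ _*_ (trans (cong (m *_) (1^ (suc d))) (*-identityʳ m))
                                                           (trans (cong ∣_∣ (solve 2 (λ t r → (con 1ℚ :- t) :- (con 1ℚ :- r) := r :- t) refl t r)) (0≤p⇒∣p∣≡p (p≤q⇒0≤q-p t≤r))) ⟩
          m * (r - t)                                 ≤⟨ *-monoˡ-≤ 0≤m r-t≤ ⟩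
          m * (m * e)                                 ∎

  module RandomIncidence {A B : Set} (inc : A → B → Bool) (T : List A) (D : List B)
    (_≟ᴮ_ : DecidableEquality B) (D! : Unique D) (d k : ℕ)
    (faces≡ : ∀ {σ} → σ ∈ D → Incidence.faces inc T σ ≡ suc d)
    (cofaces≡ : ∀ {τ} → τ ∈ T → Incidence.deg inc T D τ ≡ suc k)
    (p : ℚ) (0≤p : 0ℚ ≤ p) (p≤1 : p ≤ 1ℚ) where

    open Incidence inc T
    open Bernoulli {B} p 0≤p p≤1

    μ : ℚ
    μ = E D (ι ∘ W)

    private
      L : ℚ
      L = ι (suc d ℕ.+ 1)

      c₁ c₂ : ℚ
      c₁ = q ^ suc k * (1ℚ + ι (suc k) * p)
      c₂ = p * (1ℚ - q ^ k) ^ suc d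

    -- Used twice in `tail`: it expresses both the mean and the variance bound through M =
    -- `length T`.
    double-count : length D ℕ.* suc d ≡ length T ℕ.* suc k
    double-count = begin
      length D ℕ.* suc d     ≡⟨ Σ-const (suc d) D ⟨
      Σ D (λ _ → suc d)      ≡⟨ Σ-cong D (sym ∘ faces≡) ⟩
      Σ D faces              ≡⟨ Σ-swap (λ σ τ → 𝟙 (inc τ σ)) D T ⟩
      Σ T (deg D)            ≡⟨ Σ-cong T cofaces≡ ⟩
      Σ T (λ _ → suc k)      ≡⟨ Σ-const (suc k) T ⟩
      length T ℕ.* suc k     ∎
      where open ≡-Reasoning

    opaque
      ∏-lower : ∀ {C : Set} {c} (φ : C → ℚ) xs → 0ℚ ≤ c → (∀ {x} → x ∈ xs → c ≤ φ x) →
        c ^ length xs ≤ ∏ (map φ xs)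
      ∏-lower φ []       0≤c h = ≤-refl
      ∏-lower φ (x ∷ xs) 0≤c h = *-mono-≤ (≤-trans 0≤c (h (here refl))) (0≤^ 0≤c (length xs)) (h (here refl)) (∏-lower φ xs 0≤c (h ∘ there))

      few-τ : ∀ {τ} → τ ∈ T → c₁ ≤ E D (λ S → ι (𝟙 (deg S τ ℕ.≤ᵇ 1)))
      few-τ {τ} τ∈T = subst (λ j → q ^ j * (1ℚ + ι j * p) ≤ E D (λ S → ι (𝟙 (deg S τ ℕ.≤ᵇ 1)))) (cofaces≡ τ∈T) (E-few (inc τ) D)

      -- The factor p is the probability that σ is present. Each of its d + 1 faces has at least k
      -- further cofaces, and one of them is chosen with probability at least 1 - qᵏ.
      no-free-face : ∀ {σ} → σ ∈ D → c₂ ≤ E D (λ S → ι (𝟙 (hits (witnesses _≟ᴮ_ σ) S)))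
      no-free-face {σ} σ∈D = ≤-trans
        (*-mono-≤ {p} {1ℚ - q ^ count (is _≟ᴮ_ σ) D} (≤-trans 0≤p present) (0≤^ (0≤1-q^ k) (suc d)) present faces-shared)
        (E-hits (witnesses _≟ᴮ_ σ) D)
        where
        present : p ≤ 1ℚ - q ^ count (is _≟ᴮ_ σ) D
        present = ≤-reflexive (trans (solve 1 (λ p → p := con 1ℚ :- (con 1ℚ :- p) :* con 1ℚ) refl p) (cong (λ j → 1ℚ - q ^ j) (sym (count-is _≟ᴮ_ D! σ∈D))))
        ∂σ : List A
        ∂σ = filterᵇ (λ τ → inc τ σ) T
        ∣∂σ∣ : length (map (other _≟ᴮ_ σ) ∂σ) ≡ suc d
        ∣∂σ∣ = trans (length-map (other _≟ᴮ_ σ) ∂σ) (trans (length-filter≡Σ (λ τ → T? (inc τ σ)) T) (faces≡ σ∈D))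
        shared : ∀ {P} → P ∈ map (other _≟ᴮ_ σ) ∂σ → 1ℚ - q ^ k ≤ 1ℚ - q ^ count P D
        shared P∈ with ∈-map⁻ (other _≟ᴮ_ σ) P∈
        ... | τ , τ∈∂σ , refl = +-monoʳ-≤ 1ℚ (neg-antimono-≤ (^-antitoneʳ 0≤q q≤1
          (ℕ.s≤s⁻¹ (subst (ℕ._≤ suc (count (other _≟ᴮ_ σ τ) D)) (cofaces≡ (proj₁ (∈-filter⁻ (λ τ → T? (inc τ σ)) {xs = T} τ∈∂σ)))
            (count-other _≟ᴮ_ τ D! σ∈D)))))
        faces-shared : (1ℚ - q ^ k) ^ suc d ≤ ∏ (map (λ P → 1ℚ - q ^ count P D) (map (other _≟ᴮ_ σ) ∂σ))
        faces-shared = subst (λ j → (1ℚ - q ^ k) ^ j ≤ ∏ (map (λ P → 1ℚ - q ^ count P D) (map (other _≟ᴮ_ σ) ∂σ))) ∣∂σ∣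
          (∏-lower (λ P → 1ℚ - q ^ count P D) (map (other _≟ᴮ_ σ) ∂σ) (0≤1-q^ k) shared)

      E-W : ι (length T) * c₁ + ι (length D) * c₂ ≤ μ
      E-W = begin
        ι (length T) * c₁ + ι (length D) * c₂
          ≤⟨ +-mono-≤ (E-Σ D c₁ (λ τ S → 𝟙 (deg S τ ℕ.≤ᵇ 1)) T few-τ)
                      (E-Σ D c₂ (λ σ S → 𝟙 (hits (witnesses _≟ᴮ_ σ) S)) D no-free-face) ⟩
        E D (λ S → ι (X S)) + E D (λ S → ι (Z S))
          ≡⟨ E-+ D (ι ∘ X) (ι ∘ Z) ⟨
        E D (λ S → ι (X S) + ι (Z S))
          ≤⟨ E-mono D (λ {S} S⊆D → ≤-trans (≤-reflexive (sym (ι-+ (X S) (Z S)))) (ι-mono (ℕₚ.+-monoʳ-≤ (X S) (Z≤ S⊆D)))) ⟩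
        μ ∎
        where
        open ≤-Reasoning
        X Z : List B → ℕ
        X S = Σ T (λ τ → 𝟙 (deg S τ ℕ.≤ᵇ 1))
        Z S = Σ D (λ σ → 𝟙 (hits (witnesses _≟ᴮ_ σ) S))
        Z≤ : ∀ {S} → S ⊆ D → Z S ℕ.≤ Σ S (λ σ → 𝟙 (free S σ ℕ.≡ᵇ 0))
        Z≤ {S} S⊆D = ℕₚ.≤-trans (Σ-mono D (λ {σ} _ → hits≤ _≟ᴮ_ S σ))
          (ℕₚ.≤-reflexive (sym (Σ-sublist _≟ᴮ_ (λ σ → 𝟙 (free S σ ℕ.≡ᵇ 0)) D! S⊆D)))

      bounded-difference : ∀ {b} → b ∈ D → ∀ S₁ S₂ → ∣ ι (W (S₁ ++ b ∷ S₂)) - ι (W (S₁ ++ S₂)) ∣ ≤ L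
      bounded-difference {b} b∈D S₁ S₂ = ∣p∣≤q
        (move (subst₂ (λ w j → w ℕ.≤ W S ℕ.+ (j ℕ.+ 1)) (sym (W-insert b S₁ S₂)) (faces≡ b∈D) (W-upper b S)))
        (subst (_≤ L) (solve 2 (λ a b → b :- a := :- (a :- b)) refl (ι W₊) (ι (W S)))
          (move (ℕₚ.≤-trans (subst₂ (λ w j → W S ℕ.≤ w ℕ.+ j) (sym (W-insert b S₁ S₂)) (faces≡ b∈D) (W-lower b S))
            (ℕₚ.+-monoʳ-≤ W₊ (ℕₚ.m≤m+n (suc d) 1)))))
        where
        S : List B
        S = S₁ ++ S₂
        W₊ : ℕ
        W₊ = W (S₁ ++ b ∷ S₂)
        move : ∀ {i j} → i ℕ.≤ j ℕ.+ (suc d ℕ.+ 1) → ι i - ι j ≤ L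
        move {i} {j} i≤ = ≤-trans (+-monoˡ-≤ (- ι j) (≤-trans (ι-mono i≤) (≤-reflexive (ι-+ j (suc d ℕ.+ 1)))))
          (≤-reflexive (solve 2 (λ a b → a :+ b :- a := b) refl (ι j) L))

      -- One of the two δ granted by `h` pays the error term of `mean-bound`, the other gives m (μ -
      -- M) ≥ M δ. `chebyshev` with C = M then compares (M δ)² with m² ∣D∣ p L² = M m L² (k + 1) p,
      -- which is only linear in M.
      tail : ∀ {y δ ε} (event : List B → Bool) →
        (∀ {S} → S ⊆ D → event S ≡ true → W S ℕ.≤ length T) →
        0ℚ < δ → 0ℚ ≤ ε → ι (suc d ℕ.+ k) * p ≤ y →
        δ + δ ≤ h (suc d) (ι (suc d ℕ.+ k) * p) (q ^ (suc d ℕ.+ k)) →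
        p * (ι (suc d) * ι d + ι d + ι (suc d) * ι (suc d) * y) ≤ δ →
        0ℚ < ι (length T) → ι (suc d) * y * (L * L) ≤ ι (length T) * (δ * δ * ε) →
        E D (ι ∘ 𝟙 ∘ event) ≤ ε
      tail {y} {δ} {ε} event below 0<δ 0≤ε np≤y 2δ≤h pR≤δ 0<M large =
        *-cancelˡ-≤ (M * (δ * δ)) (0<* 0<M (0<* 0<δ 0<δ)) (*-cancelˡ-≤ M 0<M (begin
          M * (M * (δ * δ) * P)
            ≡⟨ solve 3 (λ M d P → M :* (M :* (d :* d) :* P) := (M :* d) :* (M :* d) :* P) refl M δ P ⟩
          (M * δ) * (M * δ) * P
            ≤⟨ *-monoʳ-≤ 0≤P (*-mono-≤ (≤-trans 0≤Mδ excess) 0≤Mδ excess excess) ⟩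
          (m * (μ - M)) * (m * (μ - M)) * P
            ≡⟨ solve 3 (λ m x P → (m :* x) :* (m :* x) :* P := m :* m :* (x :* x :* P)) refl m (μ - M) P ⟩
          m * m * ((μ - M) * (μ - M) * P)
            ≤⟨ *-monoˡ-≤ (0≤p² m) (chebyshev D (ι ∘ W) M event bounded-difference (λ S⊆D eq → ι-mono (below S⊆D eq)) M≤μ) ⟩
          m * m * (ι (length D) * (p * (L * L)))
            ≡⟨ solve 4 (λ m D p L → m :* m :* (D :* (p :* L)) := m :* (D :* m) :* p :* L) refl m (ι (length D)) p (L * L) ⟩
          m * (ι (length D) * m) * p * (L * L)
            ≡⟨ cong (λ z → m * z * p * (L * L)) Dm≡ ⟩
          m * (M * ι (suc k)) * p * (L * L)
            ≡⟨ solve 5 (λ m M N p L → m :* (M :* N) :* p :* L := M :* m :* L :* (N :* p)) refl m M (ι (suc k)) p (L * L) ⟩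
          M * m * (L * L) * (ι (suc k) * p)
            ≤⟨ *-monoˡ-≤ (0≤* (0≤* (0≤ι (length T)) (0≤ι (suc d))) (0≤p² L))
                 (≤-trans (*-monoʳ-≤ 0≤p (ι-mono (ℕ.s≤s (ℕₚ.m≤n+m k d)))) np≤y) ⟩
          M * m * (L * L) * y
            ≡⟨ solve 4 (λ M m L y → M :* m :* L :* y := M :* (m :* y :* L)) refl M m (L * L) y ⟩
          M * (m * y * (L * L))
            ≤⟨ *-monoˡ-≤ (0≤ι (length T)) large ⟩
          M * (M * (δ * δ * ε))
            ≡⟨ solve 3 (λ M d e → M :* (M :* (d :* d :* e)) := M :* (M :* (d :* d) :* e)) refl M δ ε ⟩
          M * (M * (δ * δ) * ε) ∎))
        where
        open ≤-Reasoning
        M m P : ℚ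
        M = ι (length T)
        m = ι (suc d)
        P = E D (ι ∘ 𝟙 ∘ event)
        0≤P : 0ℚ ≤ P
        0≤P = subst (_≤ P) (E-const D 0ℚ) (E-mono D (λ {S} _ → 0≤ι (𝟙 (event S))))
        0≤Mδ : 0ℚ ≤ M * δ
        0≤Mδ = 0≤* (0≤ι (length T)) (<⇒≤ 0<δ)
        Dm≡ : ι (length D) * m ≡ M * ι (suc k)
        Dm≡ = trans (sym (ι-* (length D) (suc d))) (trans (cong ι double-count) (ι-* (length T) (suc k)))
        R : ℚ
        R = m * ι d + ι d + m * m * y
        mean : m + δ ≤ m * c₁ + ι (suc k) * c₂
        mean = begin
          m + δ                         ≡⟨ solve 2 (λ m d → m :+ d := m :+ (d :+ d :- d)) refl m δ ⟩
          m + (δ + δ - δ)               ≤⟨ +-monoʳ-≤ m (+-monoʳ-≤ (δ + δ) (neg-antimono-≤ pR≤δ)) ⟩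
          m + (δ + δ - p * R)           ≤⟨ mean-bound d k {p} {y} {δ + δ} 0≤p p≤1 np≤y 2δ≤h ⟩
          m * c₁ + ι (suc k) * c₂       ∎
        excess : M * δ ≤ m * (μ - M)
        excess = begin
          M * δ                                               ≡⟨ solve 3 (λ M m d → M :* d := M :* (m :+ d) :- m :* M) refl M m δ ⟩
          M * (m + δ) - m * M                                 ≤⟨ +-monoˡ-≤ (- (m * M)) (*-monoˡ-≤ (0≤ι (length T)) mean) ⟩
          M * (m * c₁ + ι (suc k) * c₂) - m * M               ≡⟨ solve 5 (λ M m a N b → M :* (m :* a :+ N :* b) :- m :* M := m :* (M :* a) :+ M :* N :* b :- m :* M) refl M m c₁ (ι (suc k)) c₂ ⟩
          m * (M * c₁) + M * ι (suc k) * c₂ - m * M           ≡⟨ cong (λ z → m * (M * c₁) + z * c₂ - m * M) (sym Dm≡) ⟩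
          m * (M * c₁) + ι (length D) * m * c₂ - m * M        ≡⟨ solve 5 (λ m A D b M → m :* A :+ D :* m :* b :- m :* M := m :* (A :+ D :* b :- M)) refl m (M * c₁) (ι (length D)) c₂ M ⟩
          m * (M * c₁ + ι (length D) * c₂ - M)                ≤⟨ *-monoˡ-≤ (0≤ι (suc d)) (+-monoˡ-≤ (- M) E-W) ⟩
          m * (μ - M)                                         ∎
        M≤μ : M ≤ μ
        M≤μ = 0≤q-p⇒p≤q (*-cancelˡ-≤ m (0<ι d) (≤-trans (≤-reflexive (*-zeroʳ m)) (≤-trans 0≤Mδ excess)))

-- Expressing v and Pr through W and the product measure

module LinialMeshulam where

  open import Data.Bool using (Bool; true; false; if_then_else_; _∧_)
  open import Data.Integer as ℤ using (ℤ; +_; 0ℤ)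
  import Data.Integer.Properties as ℤₚ
  open import Data.List using (List; []; _∷_; _++_; length; map; filter; upTo)
  open import Data.List.Properties using (filter-++; filter-all; filter-none)
  open import Data.List.Membership.Propositional using (_∈_; _∉_)
  open import Data.List.Membership.Propositional.Properties using (∈-++⁺ʳ; ∈-++⁻; ∈-map⁻; ∈-filter⁻)
  open import Data.List.Relation.Unary.All as All using ()
  open import Data.List.Relation.Unary.AllPairs using (_∷_)
  open import Data.List.Relation.Unary.Any using (here; there)
  open import Data.List.Relation.Unary.Unique.Propositional using (Unique)
  open import Data.List.Relation.Binary.Sublist.Propositional using (_⊆_; []; _∷_; _∷ʳ_; lookup)
  open import Data.Nat as ℕ using (ℕ; suc; _∸_)
  import Data.Nat.Properties as ℕₚ
  open import Data.Nat.Combinatorics using (_C_)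
  open import Data.Nat.ListAction using () renaming (sum to sumℕ)
  open import Data.List.Membership.DecPropositional using () renaming (_∈?_ to member?)
  open import Data.Product using (_,_; proj₂)
  open import Data.Rational using (ℚ; 0ℚ; 1ℚ; _+_; _*_; _-_; -_; _≤_)
  open import Data.Rational.Properties
  open import Data.Rational.Solver using (module +-*-Solver)
  open import Data.Sum using (_⊎_; inj₁; inj₂)
  open import Data.Empty using (⊥)
  open import Data.Fin.Subset using (Subset; ∣_∣)
  open import Data.Fin.Subset.Properties using (_⊆?_)
  open import Function using (_∘_)
  open import Level using (0ℓ)
  open import Relation.Nullary using (Dec; yes)
  open import Relation.Nullary.Decidable using (does; dec-true; dec-false; _because_; _×-dec_)
  open import Relation.Unary using (Pred; Decidable)
  open import Relation.Binary.PropositionalEquality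
  open import Defs using (ℝ; seq; Complex; Δ; skeleton; simplices; sublists; 𝒴; weight; Pr; f; a; v; α; degree; freeFaces; _≟ˢ_; ∑; ∏)
    renaming (1ℝ to 1ʳ; _-_ to _-ʳ_)
  open Rational
  open ListSum
  open SubsetCount
  open +-*-Solver

  module _ {n : ℕ} (j : ℕ) where

    private
      d : ℕ
      d = suc j

      T D : List (Subset n)
      T = simplices j (Δ n)
      D = simplices d (Δ n)

      skel : Complex n
      skel = skeleton j (Δ n)

    open Incidence (_⊆ᵇ_ {n}) T

    small : ∀ {σ} → σ ∈ skel → ∣ σ ∣ ℕ.≤ d
    small σ∈ = proj₂ (∈-filter⁻ (λ σ → ∣ σ ∣ ℕ.≤? d) {xs = Δ n} σ∈)

    -- Faces of the skeleton have at most d vertices, so filtering by size returns the random part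
    -- literally, including its order.
    simplices-skel++ : ∀ {S} → S ⊆ D → simplices d (skel ++ S) ≡ S
    simplices-skel++ {S} S⊆D = trans (filter-++ size skel S) (cong₂ _++_
      (filter-none size (All.tabulate (λ σ∈ eq → ℕₚ.<⇒≢ (ℕ.s≤s (small σ∈)) eq)))
      (filter-all size (All.tabulate (λ σ∈S → ∈-simplices d {Δ n} (lookup S⊆D σ∈S)))))
      where
      size : Decidable {A = Subset n} (λ σ → ∣ σ ∣ ≡ suc d)
      size σ = ∣ σ ∣ ℕ.≟ suc d

    faces≡ : ∀ {σ} → σ ∈ D → faces σ ≡ suc d
    faces≡ {σ} σ∈D = faces-simplex {n} j {σ} (∈-simplices d {Δ n} σ∈D)

    cofaces≡ : ∀ {τ} → τ ∈ T → deg D τ ≡ n ∸ d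
    cofaces≡ {τ} τ∈T = cofaces-simplex {n} j {τ} (∈-simplices j {Δ n} τ∈T)

    v≡W : ∀ {S} → S ⊆ D → v d (skel ++ S) ≡ + W S ℤ.- + (n C d)
    v≡W {S} S⊆D = cong (λ w → + w ℤ.- + (n C d))
      (trans (cong₂ ℕ._+_ (cong₂ ℕ._+_ (cong length simplices≡S) a≡) α≡)
             (W-formula d S (λ σ∈S → ℕₚ.≤-reflexive (faces≡ (lookup S⊆D σ∈S)))))
      where
      Y : Complex n
      Y = skel ++ S
      simplices≡S : simplices d Y ≡ S
      simplices≡S = simplices-skel++ S⊆D
      degree≡ : ∀ τ → degree d Y τ ≡ deg S τ
      degree≡ τ = trans (cong (length ∘ filter (τ ⊆?_)) simplices≡S) (length-filter≡Σ (τ ⊆?_) S)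
      free≡ : ∀ σ → length (freeFaces d Y σ) ≡ free S σ
      free≡ σ = trans (length-filter≡Σ (λ τ → (τ ⊆? σ) ×-dec (degree d Y τ ℕ.≟ 1)) T)
        (Σ-cong T (λ {τ} _ → cong (λ c → 𝟙 ((τ ⊆ᵇ σ) ∧ (c ℕ.≡ᵇ 1))) (degree≡ τ)))
      a≡ : a d Y ≡ Σ T (λ τ → 𝟙 (deg S τ ℕ.≡ᵇ 0))
      a≡ = trans (length-filter≡Σ (λ τ → degree d Y τ ℕ.≟ 0) T)
        (Σ-cong T (λ {τ} _ → cong (λ c → 𝟙 (c ℕ.≡ᵇ 0)) (degree≡ τ)))
      α-term : ∀ i → α d i Y ≡ Σ S (λ σ → 𝟙 (free S σ ℕ.≡ᵇ suc d ∸ i))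
      α-term i = trans (length-filter≡Σ (λ σ → length (freeFaces d Y σ) ℕ.≟ suc d ∸ i) (simplices d Y))
        (trans (cong (λ X → Σ X (λ σ → 𝟙 (length (freeFaces d Y σ) ℕ.≡ᵇ suc d ∸ i))) simplices≡S)
               (Σ-cong S (λ {σ} _ → cong (λ c → 𝟙 (c ℕ.≡ᵇ suc d ∸ i)) (free≡ σ))))
      α≡ : sumℕ (map (λ i → α d i Y ℕ.* (d ∸ i)) (upTo (suc d)))
         ≡ Σ (upTo (suc d)) (λ i → Σ S (λ σ → 𝟙 (free S σ ℕ.≡ᵇ suc d ∸ i)) ℕ.* (d ∸ i))
      α≡ = trans (sum-map≡Σ (λ i → α d i Y ℕ.* (d ∸ i)) (upTo (suc d)))
        (Σ-cong (upTo (suc d)) (λ {i} _ → cong (ℕ._* (d ∸ i)) (α-term i)))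

    v≤0⇒W≤ : ∀ {S} → S ⊆ D → does (v d (skel ++ S) ℤ.≤? 0ℤ) ≡ true → W S ℕ.≤ length T
    v≤0⇒W≤ {S} S⊆D eq = ℕₚ.≤-trans
      (ℤₚ.drop‿+≤+ (ℤₚ.i-j≤0⇒i≤j (subst (ℤ._≤ 0ℤ) (v≡W S⊆D) (proof (v d (skel ++ S) ℤ.≤? 0ℤ) eq))))
      (ℕₚ.≤-reflexive (sym (length-simplices n j)))
      where
      proof : ∀ {P : Set} (P? : Dec P) → does P? ≡ true → P
      proof (yes p) refl = p

  Σℚ : {A : Set} → List A → (A → ℚ) → ℚ
  Σℚ []       φ = 0ℚ
  Σℚ (x ∷ xs) φ = φ x + Σℚ xs φ

  module _ {A : Set} where

    Σℚ-cong : ∀ {φ ψ : A → ℚ} xs → (∀ {x} → x ∈ xs → φ x ≡ ψ x) → Σℚ xs φ ≡ Σℚ xs ψ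
    Σℚ-cong []       h = refl
    Σℚ-cong (x ∷ xs) h = cong₂ _+_ (h (here refl)) (Σℚ-cong xs (h ∘ there))

    Σℚ-++ : ∀ (φ : A → ℚ) xs ys → Σℚ (xs ++ ys) φ ≡ Σℚ xs φ + Σℚ ys φ
    Σℚ-++ φ []       ys = sym (+-identityˡ (Σℚ ys φ))
    Σℚ-++ φ (x ∷ xs) ys = trans (cong (λ s → φ x + s) (Σℚ-++ φ xs ys)) (sym (+-assoc (φ x) (Σℚ xs φ) (Σℚ ys φ)))

    Σℚ-map : ∀ {B : Set} (φ : B → ℚ) (f : A → B) xs → Σℚ (map f xs) φ ≡ Σℚ xs (φ ∘ f)
    Σℚ-map φ f []       = refl
    Σℚ-map φ f (x ∷ xs) = cong (λ s → φ (f x) + s) (Σℚ-map φ f xs)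

    Σℚ-*ˡ : ∀ k (φ : A → ℚ) xs → Σℚ xs (λ x → k * φ x) ≡ k * Σℚ xs φ
    Σℚ-*ˡ k φ []       = sym (*-zeroʳ k)
    Σℚ-*ˡ k φ (x ∷ xs) = trans (cong (λ s → k * φ x + s) (Σℚ-*ˡ k φ xs)) (sym (*-distribˡ-+ k (φ x) (Σℚ xs φ)))

    Σℚ-filter : ∀ {P : Pred A 0ℓ} (P? : Decidable P) φ xs →
      Σℚ (filter P? xs) φ ≡ Σℚ xs (λ x → ι (𝟙 (does (P? x))) * φ x)
    Σℚ-filter P? φ []       = refl
    Σℚ-filter P? φ (x ∷ xs) with P? x
    ... | true  because _ = cong₂ _+_ (sym (*-identityˡ (φ x))) (Σℚ-filter P? φ xs)
    ... | false because _ = trans (Σℚ-filter P? φ xs) (sym (trans (cong (_+ S) (*-zeroˡ (φ x))) (+-identityˡ S)))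
      where
      S : ℚ
      S = Σℚ xs (λ x → ι (𝟙 (does (P? x))) * φ x)

  sublists-⊆ : ∀ {A : Set} (D : List A) {S} → S ∈ sublists D → S ⊆ D
  sublists-⊆ []      (here refl) = []
  sublists-⊆ (x ∷ D) S∈ with ∈-++⁻ (map (x ∷_) (sublists D)) S∈
  ... | inj₂ S∈′ = x ∷ʳ sublists-⊆ D S∈′
  ... | inj₁ S∈′ with ∈-map⁻ (x ∷_) S∈′
  ...   | _ , S′∈ , refl = refl ∷ sublists-⊆ D S′∈

  module Weights {A : Set} (p : ℚ) (0≤p : 0ℚ ≤ p) (p≤1 : p ≤ 1ℚ) where

    open Bernoulli {A} p 0≤p p≤1 using (q; E; E-cong)

    likelihood : (A → Bool) → List A → ℚ
    likelihood b []      = 1ℚ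
    likelihood b (x ∷ D) = (if b x then p else q) * likelihood b D

    -- `b S` stands for the membership test. It is kept abstract, and its failure is demanded only
    -- for entries of D, to cover the test against `skel ++ S` and to let the induction pass to
    -- `b ∘ (x ∷_)`. Uniqueness guarantees that sublists of the tail omit x, so the two halves of
    -- `sublists` carry the factors p and q.
    Σ-sublists≡E : ∀ {D} → Unique D → (b : List A → A → Bool) →
      (∀ S {x} → x ∈ S → b S x ≡ true) → (∀ S {x} → x ∈ D → x ∉ S → b S x ≡ false) →
      ∀ X → Σℚ (sublists D) (λ S → X S * likelihood (b S) D) ≡ E D X
    Σ-sublists≡E {[]}    u b b-in b-out X = trans (+-identityʳ (X [] * 1ℚ)) (*-identityʳ (X []))
    Σ-sublists≡E {x ∷ D} (x∉ ∷ u) b b-in b-out X =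
      trans (Σℚ-++ φ (map (x ∷_) (sublists D)) (sublists D)) (cong₂ _+_
        (trans (Σℚ-map φ (x ∷_) (sublists D)) (trans (Σℚ-cong (sublists D) (λ {S} _ → present S))
          (trans (Σℚ-*ˡ p _ (sublists D)) (cong (p *_) (Σ-sublists≡E u (b ∘ (x ∷_)) (λ S y∈S → b-in (x ∷ S) (there y∈S)) out-of-cons (X ∘ (x ∷_)))))))
        (trans (Σℚ-cong (sublists D) absent)
          (trans (Σℚ-*ˡ q _ (sublists D)) (cong (q *_) (Σ-sublists≡E u b b-in (λ S y∈D → b-out S (there y∈D)) X)))))
      where
      φ : List A → ℚ
      φ S = X S * likelihood (b S) (x ∷ D)
      out-of-cons : ∀ S {y} → y ∈ D → y ∉ S → b (x ∷ S) y ≡ false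
      out-of-cons S {y} y∈D y∉S = b-out (x ∷ S) (there y∈D)
        (λ { (here y≡x) → All.lookup x∉ y∈D (sym y≡x) ; (there y∈S) → y∉S y∈S })
      swap : ∀ u v w → u * (v * w) ≡ v * (u * w)
      swap = solve 3 (λ u v w → u :* (v :* w) := v :* (u :* w)) refl
      present : ∀ S → φ (x ∷ S) ≡ p * (X (x ∷ S) * likelihood (b (x ∷ S)) D)
      present S rewrite b-in (x ∷ S) (here refl) = swap (X (x ∷ S)) p (likelihood (b (x ∷ S)) D)
      absent : ∀ {S} → S ∈ sublists D → φ S ≡ q * (X S * likelihood (b S) D)
      absent {S} S∈ rewrite b-out S (here refl) (λ x∈S → All.lookup x∉ (lookup (sublists-⊆ D S∈) x∈S) refl) =
        swap (X S) q (likelihood (b S) D)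

  seq-∑ : ∀ {A : Set} (w : A → ℝ) xs k → seq (∑ (map w xs)) k ≡ Σℚ xs (λ x → seq (w x) k)
  seq-∑ w []       k = refl
  seq-∑ w (x ∷ xs) k = cong (λ s → seq (w x) k + s) (seq-∑ w xs k)

  module _ {n : ℕ} (j : ℕ) (r : ℝ) (k : ℕ) (0≤p : 0ℚ ≤ seq r k) (p≤1 : seq r k ≤ 1ℚ) where

    private
      d : ℕ
      d = suc j
      D : List (Subset n)
      D = simplices d (Δ n)
      skel : Complex n
      skel = skeleton j (Δ n)

    open Weights {Subset n} (seq r k) 0≤p p≤1
    open Bernoulli {Subset n} (seq r k) 0≤p p≤1 using (E; q)

    private
      member : List (Subset n) → Subset n → Bool
      member S σ = does (member? _≟ˢ_ σ (skel ++ S))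

      seq-weight : ∀ Y xs →
        seq (∏ (map (λ σ → if does (member? _≟ˢ_ σ Y) then r else 1ʳ -ʳ r) xs)) k ≡
        likelihood (λ σ → does (member? _≟ˢ_ σ Y)) xs
      seq-weight Y []       = refl
      seq-weight Y (σ ∷ xs) = cong₂ _*_ (factor (does (member? _≟ˢ_ σ Y))) (seq-weight Y xs)
        where
        factor : ∀ b → seq (if b then r else 1ʳ -ʳ r) k ≡ (if b then seq r k else q)
        factor true  = refl
        factor false = refl

    -- `Pr` is a polynomial in its parameter and is evaluated termwise, so its k-th approximation is
    -- the same polynomial at the rational `seq r k`.
    seq-Pr≡E : ∀ {P : Pred (Complex n) 0ℓ} (P? : Decidable P) →
      seq (Pr d n r P?) k ≡ E D (λ S → ι (𝟙 (does (P? (skel ++ S)))))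
    seq-Pr≡E P? = begin
      seq (Pr d n r P?) k
        ≡⟨ seq-∑ (weight d r) (filter P? (𝒴 d n)) k ⟩
      Σℚ (filter P? (𝒴 d n)) (λ Y → seq (weight d r Y) k)
        ≡⟨ Σℚ-filter P? (λ Y → seq (weight d r Y) k) (𝒴 d n) ⟩
      Σℚ (𝒴 d n) (λ Y → ι (𝟙 (does (P? Y))) * seq (weight d r Y) k)
        ≡⟨ Σℚ-map (λ Y → ι (𝟙 (does (P? Y))) * seq (weight d r Y) k) (skel ++_) (sublists D) ⟩
      Σℚ (sublists D) (λ S → ι (𝟙 (does (P? (skel ++ S)))) * seq (weight d r (skel ++ S)) k)
        ≡⟨ Σℚ-cong (sublists D) (λ {S} _ → cong (ι (𝟙 (does (P? (skel ++ S)))) *_) (seq-weight (skel ++ S) D)) ⟩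
      Σℚ (sublists D) (λ S → ι (𝟙 (does (P? (skel ++ S)))) * likelihood (member S) D)
        ≡⟨ Σ-sublists≡E (simplices-unique n d) member
             (λ S {σ} σ∈S → dec-true (member? _≟ˢ_ σ (skel ++ S)) (∈-++⁺ʳ skel σ∈S))
             (λ S {σ} σ∈D σ∉S → dec-false (member? _≟ˢ_ σ (skel ++ S)) (λ σ∈Y → outside S σ∈D σ∉S (∈-++⁻ skel σ∈Y)))
             (λ S → ι (𝟙 (does (P? (skel ++ S))))) ⟩
      E D (λ S → ι (𝟙 (does (P? (skel ++ S))))) ∎
      where
      open ≡-Reasoning
      outside : ∀ S {σ} → σ ∈ D → σ ∉ S → σ ∈ skel ⊎ σ ∈ S → ⊥
      outside S σ∈D σ∉S (inj₁ σ∈skel) = ℕₚ.<⇒≢ (ℕ.s≤s (small j σ∈skel)) (∈-simplices d {Δ n} σ∈D)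
      outside S σ∈D σ∉S (inj₂ σ∈S)    = σ∉S σ∈S

-- Choice of thresholds and convergence to zero

module Convergence where

  open import Data.Bool using (Bool)
  open import Data.Integer as ℤ using (0ℤ)
  open import Data.List using (List; length; _++_)
  open import Data.List.Membership.Propositional using (_∈_)
  open import Data.Nat as ℕ using (ℕ; suc; NonZero; _∸_)
  import Data.Nat.Properties as ℕₚ
  open import Data.Product using (∃-syntax; _×_; _,_; proj₁; proj₂)
  open import Data.Rational using (ℚ; 0ℚ; 1ℚ; ½; _+_; _*_; _-_; -_; _≤_; _<_; ∣_∣)
  open import Data.Rational.Properties
  open import Data.Rational.Solver using (module +-*-Solver)
  open import Data.Fin.Subset using (Subset)
  open import Relation.Nullary.Decidable using (does)
  open import Relation.Binary.PropositionalEquality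
  open import Defs using (ℝ; seq; Δ; skeleton; simplices; Pr; v; _≟ˢ_; 0ℝ; _⟶_) renaming (_/_ to _/ʳ_)
  open Rational
  open Growth using (h)
  open ListSum using (𝟙)
  open SubsetCount
  open Drift using (UniformDrift)
  open LinialMeshulam
  open +-*-Solver

  opaque
    multiple : ∀ x y → 0ℚ < y → ∃[ N ] x ≤ y * ι N
    multiple x y 0<y with invert 0<y
    ... | w , 0<w , eq with archimedean (x * w)
    ... | N , xw≤N = N , (begin
      x              ≡⟨ *-identityʳ x ⟨
      x * 1ℚ         ≡⟨ cong (x *_) eq ⟨
      x * (y * w)    ≡⟨ solve 3 (λ x y w → x :* (y :* w) := y :* (x :* w)) refl x y w ⟩
      y * (x * w)    ≤⟨ *-monoˡ-≤ (<⇒≤ 0<y) xw≤N ⟩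
      y * ι N        ∎)
      where open ≤-Reasoning

  module _ (j : ℕ) (c : ℝ) where

    private
      d : ℕ
      d = suc j

      nonpositive : ∀ n .{{_ : NonZero n}} → ℕ → ℚ
      nonpositive n = seq (Pr d n (c /ʳ n) (λ Y → v d Y ℤ.≤? 0ℤ))

    module AtSize (k i : ℕ) {δ ε B : ℚ}
      (0≤p : 0ℚ ≤ seq c i * 1/suc (d ℕ.+ k)) (p≤1 : seq c i * 1/suc (d ℕ.+ k) ≤ 1ℚ)
      (np≤B : ι (suc d ℕ.+ k) * (seq c i * 1/suc (d ℕ.+ k)) ≤ B)
      (δ≤h : δ ≤ h (suc d) (ι (suc d ℕ.+ k) * (seq c i * 1/suc (d ℕ.+ k))) ((1ℚ - seq c i * 1/suc (d ℕ.+ k)) ^ (suc d ℕ.+ k)))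
      (0<δ : 0ℚ < δ) (0≤ε : 0ℚ ≤ ε) where

      private
        n : ℕ
        n = suc d ℕ.+ k
        p R δ′ : ℚ
        p = seq c i * 1/suc (d ℕ.+ k)
        R = ι (suc d) * ι d + ι d + ι (suc d) * ι (suc d) * B
        δ′ = ½ * δ
        T D : List (Subset n)
        T = simplices j (Δ n)
        D = simplices d (Δ n)
        event : List (Subset n) → Bool
        event S = does (v d (skeleton j (Δ n) ++ S) ℤ.≤? 0ℤ)
        cofaces : ∀ {τ} → τ ∈ T → Incidence.deg (_⊆ᵇ_ {n}) T D τ ≡ suc k
        cofaces τ∈T = trans (cofaces≡ {n} j τ∈T)
          (trans (cong (_∸ d) (sym (ℕₚ.+-suc d k))) (ℕₚ.m+n∸m≡n d (suc k)))
        open Tail.RandomIncidence (_⊆ᵇ_ {n}) T D _≟ˢ_ (simplices-unique n d) d k (faces≡ {n} j) cofaces p 0≤p p≤1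
        open Bernoulli {Subset n} p 0≤p p≤1 using (E; E-const; E-mono)
        Pr≡E : nonpositive n i ≡ E D (λ S → ι (𝟙 (event S)))
        Pr≡E = seq-Pr≡E {n} j (c /ʳ n) i 0≤p p≤1 (λ Y → v d Y ℤ.≤? 0ℤ)

      opaque
        0≤Pr : 0ℚ ≤ nonpositive n i
        0≤Pr = subst (0ℚ ≤_) (sym Pr≡E) (≤-trans (≤-reflexive (sym (E-const D 0ℚ))) (E-mono D (λ {S} _ → 0≤ι (𝟙 (event S)))))

        -- The second hypothesis is imposed on every M with n ≤ M + d, of which M = binom(n, d) is
        -- an instance; thresholds can then be chosen without binomial coefficients.
        Pr≤ : B * R ≤ δ′ * ι n →
          (∀ {M} → n ℕ.≤ M ℕ.+ d → ι (suc d) * B * (ι (suc d ℕ.+ 1) * ι (suc d ℕ.+ 1)) ≤ δ′ * δ′ * ε * ι M) →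
          nonpositive n i ≤ ε
        Pr≤ BR≤ large = subst (_≤ ε) (sym Pr≡E) (tail event (v≤0⇒W≤ {n} j) (0<* (positive⁻¹ ½) 0<δ) 0≤ε np≤B
          (≤-trans (≤-reflexive (solve 1 (λ x → con ½ :* x :+ con ½ :* x := x) refl δ)) δ≤h)
          (*-cancelˡ-≤ (ι n) (0<ι (d ℕ.+ k)) (begin
            ι n * (p * R)      ≡⟨ *-assoc (ι n) p R ⟨
            ι n * p * R        ≤⟨ *-monoʳ-≤ 0≤R np≤B ⟩
            B * R              ≤⟨ BR≤ ⟩
            δ′ * ι n           ≡⟨ *-comm δ′ (ι n) ⟩
            ι n * δ′           ∎))
          (subst (λ M → 0ℚ < ι M) (sym (length-simplices n j)) (<-≤-trans 0<1 (ι-mono {1} (1≤nCk {n} {d} (ℕₚ.m≤n⇒m≤1+n (ℕₚ.m≤m+n d k))))))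
          (≤-trans (large (subst (λ M → n ℕ.≤ M ℕ.+ d) (sym (length-simplices n j)) (n≤nC[1+k]+[1+k] n j)))
                   (≤-reflexive (*-comm (δ′ * δ′ * ε) (ι (length T))))))
          where
          open ≤-Reasoning
          0≤R : 0ℚ ≤ R
          0≤R = 0≤+ (0≤+ (0≤* (0≤ι (suc d)) (0≤ι d)) (0≤ι d))
            (0≤* (0≤p² (ι (suc d))) (≤-trans (0≤* (0≤ι n) 0≤p) np≤B))

    module Vanishing (δ : ℚ) (0<δ : 0ℚ < δ) (B : ℚ) (K : ℕ) (ε : ℚ) (0<ε : 0ℚ < ε)
      (drift : ∀ i n → K ℕ.≤ i → K ℕ.≤ suc n →
        0ℚ ≤ seq c i * 1/suc n × seq c i * 1/suc n ≤ 1ℚ × ι (suc n) * (seq c i * 1/suc n) ≤ B ×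
        δ ≤ h (suc d) (ι (suc n) * (seq c i * 1/suc n)) ((1ℚ - seq c i * 1/suc n) ^ suc n)) where

      private
        δ′ C₁ C₂ : ℚ
        δ′ = ½ * δ
        C₁ = B * (ι (suc d) * ι d + ι d + ι (suc d) * ι (suc d) * B)
        C₂ = ι (suc d) * B * (ι (suc d ℕ.+ 1) * ι (suc d ℕ.+ 1))

        0<δ′ : 0ℚ < δ′
        0<δ′ = 0<* (positive⁻¹ ½) 0<δ

        opaque
          large₁ : ∃[ N ] C₁ ≤ δ′ * ι N
          large₁ = multiple C₁ δ′ 0<δ′

          large₂ : ∃[ N ] C₂ ≤ δ′ * δ′ * ε * ι N
          large₂ = multiple C₂ (δ′ * δ′ * ε) (0<* (0<* 0<δ′ 0<δ′) 0<ε)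

        N₁ N₂ : ℕ
        N₁ = proj₁ large₁
        N₂ = proj₁ large₂

        rest : ∀ m {n j} → m ℕ.+ n ℕ.≤ j → n ℕ.≤ j
        rest m {n} h = ℕₚ.≤-trans (ℕₚ.m≤n+m n m) h

      -- The summand suc d permits writing n = d + 1 + k, and the last d makes up for having only
      -- binom(n, d) ≥ n - d.
      N : ℕ
      N = suc d ℕ.+ (K ℕ.+ (N₁ ℕ.+ (N₂ ℕ.+ d)))

      opaque
        at-size : ∀ i k → N ℕ.≤ i → N ℕ.≤ suc d ℕ.+ k →
          0ℚ ≤ nonpositive (suc d ℕ.+ k) i × nonpositive (suc d ℕ.+ k) i ≤ ε
        at-size i k N≤i N≤n = S.0≤Pr , S.Pr≤
          (≤-trans (proj₂ large₁) (*-monoˡ-≤ (<⇒≤ 0<δ′) (ι-mono (ℕₚ.m+n≤o⇒m≤o N₁ N₁≤))))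
          (λ {M} n≤M+d → ≤-trans (proj₂ large₂) (*-monoˡ-≤ (<⇒≤ (0<* (0<* 0<δ′ 0<δ′) 0<ε))
            (ι-mono (ℕₚ.+-cancelʳ-≤ d N₂ M (ℕₚ.≤-trans (rest N₁ N₁≤) n≤M+d)))))
          where
          N₁≤ : N₁ ℕ.+ (N₂ ℕ.+ d) ℕ.≤ suc d ℕ.+ k
          N₁≤ = rest K (rest (suc d) N≤n)
          bounds : 0ℚ ≤ seq c i * 1/suc (d ℕ.+ k) × seq c i * 1/suc (d ℕ.+ k) ≤ 1ℚ ×
            ι (suc (d ℕ.+ k)) * (seq c i * 1/suc (d ℕ.+ k)) ≤ B ×
            δ ≤ h (suc d) (ι (suc (d ℕ.+ k)) * (seq c i * 1/suc (d ℕ.+ k))) ((1ℚ - seq c i * 1/suc (d ℕ.+ k)) ^ suc (d ℕ.+ k))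
          bounds = drift i (d ℕ.+ k) (ℕₚ.m+n≤o⇒m≤o K (rest (suc d) N≤i)) (ℕₚ.m+n≤o⇒m≤o K (rest (suc d) N≤n))
          module S = AtSize k i {δ} {ε} {B} (proj₁ bounds) (proj₁ (proj₂ bounds)) (proj₁ (proj₂ (proj₂ bounds)))
            (proj₂ (proj₂ (proj₂ bounds))) 0<δ (<⇒≤ 0<ε)

        vanishes : ∀ n .{{_ : NonZero n}} i → N ℕ.≤ n → N ℕ.≤ i →
          0ℚ ≤ nonpositive n i × nonpositive n i ≤ ε
        vanishes n i N≤n N≤i = go n (n ∸ suc d) (sym (ℕₚ.m+[n∸m]≡n (ℕₚ.m+n≤o⇒m≤o (suc d) N≤n))) N≤n
          where
          -- Generalising n allows the equation to be matched with `refl`, after which `c / n`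
          -- contains `1/suc (d + k)` definitionally.
          go : ∀ n .{{_ : NonZero n}} k → n ≡ suc d ℕ.+ k → N ℕ.≤ n → 0ℚ ≤ nonpositive n i × nonpositive n i ≤ ε
          go .(suc d ℕ.+ k) k refl N≤n = at-size i k N≤i N≤n

    ⟶0 : UniformDrift d c → (λ n → Pr d n (c /ʳ n) (λ Y → v d Y ℤ.≤? 0ℤ)) ⟶ 0ℝ
    -- The rational ε₀ lies below ε in the limit. Half of it bounds the probability, and the other
    -- half is the margin that the strict order on reals requires.
    ⟶0 (δ , 0<δ , B , _ , K , drift) ε (ε₀ , 0<ε₀ , N₀ , ε₀<ε) = N , λ n N≤n → ½ * ε₀ , 0<* (positive⁻¹ ½) 0<ε₀ , N ℕ.+ N₀ , λ i N≤i → below n i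
      (vanishes n i N≤n (ℕₚ.m+n≤o⇒m≤o N N≤i)) (ε₀<ε i (ℕₚ.≤-trans (ℕₚ.m≤n+m N₀ N) N≤i))
      where
      open Vanishing δ 0<δ B K (½ * ε₀) (0<* (positive⁻¹ ½) 0<ε₀) drift
      below : ∀ n .{{_ : NonZero n}} i → 0ℚ ≤ nonpositive n i × nonpositive n i ≤ ½ * ε₀ → 0ℚ + ε₀ < seq ε i →
        ∣ nonpositive n i - 0ℚ ∣ + ½ * ε₀ < seq ε i
      below n i (0≤P , P≤) ε₀< = begin-strict
        ∣ P - 0ℚ ∣ + ½ * ε₀       ≡⟨ cong (λ z → ∣ z ∣ + ½ * ε₀) (+-identityʳ P) ⟩
        ∣ P ∣ + ½ * ε₀            ≡⟨ cong (_+ ½ * ε₀) (0≤p⇒∣p∣≡p 0≤P) ⟩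
        P + ½ * ε₀                ≤⟨ +-monoˡ-≤ (½ * ε₀) P≤ ⟩
        ½ * ε₀ + ½ * ε₀           ≡⟨ solve 1 (λ x → con ½ :* x :+ con ½ :* x := con 0ℚ :+ x) refl ε₀ ⟩
        0ℚ + ε₀                   <⟨ ε₀< ⟩
        seq ε i                   ∎
        where
        open ≤-Reasoning
        P : ℚ
        P = nonpositive n i

open import Defs
open import Data.Nat using (ℕ; suc; _≤_)
open import Data.Nat.Properties using (≤-trans; n≤1+n)
open import Data.Integer using (0ℤ; _≤?_)

theorem5 : (d : ℕ) → 2 ≤ d →
    (c₀ : ℝ) → IsUniquePositiveSolution (g d) (fromℕ (suc d)) c₀ →
    (c : ℝ) → c₀ < c →
    (λ n → Pr d n (c / n) (λ Y → v d Y ≤? 0ℤ)) ⟶ 0ℝ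
theorem5 (suc j) 2≤d c₀ solves c c₀<c =
  Convergence.⟶0 j c (Drift.drift (suc j) (≤-trans (n≤1+n 1) 2≤d) c₀ positive solution c c₀<c)
  where open IsUniquePositiveSolution solves
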